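{- Let $N\in\mathbb{N}$ be composite and let $p$ be a prime factor of $N$ with $p<b$ for some $b\le N/5$. Suppose a pair $m,r$ of natural numbers with $2\le m<p$ and $r=p\bmod m$ is known. Then, given $N,b,m,r$, a nontrivial factor of $N$ can be found in $\mathcal{O}(d^{1+\epsilon})$ (for every $\epsilon>0$; counting arithmetic operations modulo $N$ and gcd computations with $N$), where $d=\lceil (b/m)^{1/2}\rceil$. -}

module Defs where

open import Data.Bool using (if_then_else_)
open import Data.Fin using (Fin)
open import Data.Integer using (∣_∣)
open import Data.Nat
open import Data.Nat.DivMod using (_%_)
open import Data.Nat.Divisibility using (_∣_)
open import Data.Nat.GCD using (gcd)
open import Data.Nat.Primality using (Prime; Composite)
open import Data.Product using (_×_)
open import Data.Rational using (ℚ; ↥_; ↧ₙ_)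
open import Data.Vec using (Vec; []; _∷_; lookup)
open import Relation.Binary.PropositionalEquality using (_≡_)

-- Computation model: algebraic computation trees over ℤ/N with a gcd-with-N
-- instruction.  A tree does not mention N: it touches the modulus only by
-- executing instructions, and it branches only on gcd outcomes (a test x ≡ y
-- mod N is the outcome `full` for x - y).  Hence no work that depends on the
-- input can be hidden in the construction of the tree.

data Op : Set where
  add sub mul : Op

-- gcd (x , N) = 1, gcd (x , N) = N, or a value strictly in between.
data Outcome : Set where
  one full proper : Outcome

-- `Tree k` has k readable registers; each instruction pushes its result in
-- front of them (position zero).
data Tree (k : ℕ) : Set where
  arith  : Op → Fin k → Fin k → Tree (suc k) → Tree k
  gcdN   : Fin k → (Outcome → Tree (suc k)) → Tree k
  return : Fin k → Tree k

module _ (N : ℕ) .{{_ : NonZero N}} where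

  ⟦_⟧ : Op → ℕ → ℕ → ℕ
  ⟦ add ⟧ x y = (x + y) % N
  ⟦ sub ⟧ x y = (x + (N ∸ y % N)) % N
  ⟦ mul ⟧ x y = (x * y) % N

  outcome : ℕ → Outcome
  outcome g = if g ≡ᵇ 1 then one else if g ≡ᵇ N then full else proper

  output : ∀ {k} → Tree k → Vec ℕ k → ℕ
  output (arith o i j t) ρ = output t (⟦ o ⟧ (lookup ρ i) (lookup ρ j) ∷ ρ)
  output (gcdN i t)      ρ = let g = gcd (lookup ρ i) N in
                             output (t (outcome g)) (g ∷ ρ)
  output (return i)      ρ = lookup ρ i

  -- Number of arithmetic operations modulo N plus number of gcds with N
  -- along the executed path.
  cost : ∀ {k} → Tree k → Vec ℕ k → ℕ
  cost (arith o i j t) ρ = suc (cost t (⟦ o ⟧ (lookup ρ i) (lookup ρ j) ∷ ρ))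
  cost (gcdN i t)      ρ = let g = gcd (lookup ρ i) N in
                           suc (cost (t (outcome g)) (g ∷ ρ))
  cost (return i)      ρ = 0

-- An algorithm generates its tree from the size parameter d alone; the known
-- data N, b, m, r are the initial registers, and 1 is the only constant.
Algorithm : Set
Algorithm = ℕ → Tree 5

inputs : (N b m r : ℕ) → Vec ℕ 5
inputs N b m r = N ∷ b ∷ m ∷ r ∷ 1 ∷ []

-- d = ⌈ (b / m)^(1/2) ⌉ : the least natural number d with b / m ≤ d².
_IsCeilSqrtOf_/_ : (d b m : ℕ) → Set
d IsCeilSqrtOf b / m =
  b ≤ m * (d * d) × (∀ e → b ≤ m * (e * e) → d ≤ e)

record Setting (N b m r p : ℕ) .{{_ : NonZero m}} : Set where
  field
    N-composite : Composite N
    p-prime     : Prime p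
    p∣N         : p ∣ N
    p<b         : p < b
    b≤N/5       : 5 * b ≤ N
    2≤m         : 2 ≤ m
    m<p         : m < p
    r≡p%m       : r ≡ p % m

NontrivialFactor : (q N : ℕ) → Set
NontrivialFactor q N = q ∣ N × 1 < q × q < N

-- t ≤ C · d ^ (1 + ε) for ε = u / v > 0, with both sides raised to the v-th
-- power.
_≤_·_^[1+_] : (t C d : ℕ) (ε : ℚ) → Set
t ≤ C · d ^[1+ ε ] = t ^ v ≤ C ^ v * d ^ (v + u)
  where
  u = ∣ ↥ ε ∣
  v = ↧ₙ ε

{-# OPTIONS --safe #-}

-- Write p = r + m k with k < d² and k = x + j d.  Then p divides f x for some
-- x < d, where f x = ∏_{j<d} (r + m (x + j d)), so gcds with N of the d values
-- of f give a factor, except that such a gcd may be N; then the d factors of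
-- f x are tried one by one, each of which lies strictly between 0 and N
-- because m d² < 4 b < N.
--
-- With f_k the product over j < k one has f_{2h} x = f_h x · f_h (x + h d), so
-- it suffices to translate a polynomial of degree < d that is given by its
-- values at 0, …, d - 1.  By Newton's formula this amounts to three linear
-- maps whose matrices are binomial coefficients, that is, to three convolutions
-- with factorials.  A convolution of length B^s is a product of polynomials in
-- s variables of degree < B (Toom–Cook) and takes O(s (2B)^s) operations, where
-- (2B)^s = 2^s B^s is d^{1 + 1/log₂ B} for B^s ≈ d.
--
-- No division is possible modulo N.  Everything is computed over ℤ up to a
-- scale whose prime factors are at most 4 d, and these are tested first.
--
-- As trees are not uniform, the tree for d can use the cheapest of the admissible
-- bases B, so that a fixed B (large in terms of ε) may be used for the bound.

module Submission where

open import Level using (0ℓ)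
open import Algebra.Bundles using (Semiring)
import Algebra.Properties.Semiring.Sum as SemiringSum
open import Data.Bool using (true; false; T)
open import Data.Fin using (Fin; zero; suc; toℕ; fromℕ<; opposite)
import Data.Fin.Properties as Finₚ
open import Data.Integer as ℤ using (ℤ; +_; -[1+_]; ∣_∣)
import Data.Integer.Divisibility.Signed as ℤ∣
import Data.Integer.Properties as ℤₚ
open import Data.Integer.Tactic.RingSolver using (solve-∀)
open import Data.List using (List; upTo; filter)
import Data.List.Relation.Unary.All as All
import Data.List.Relation.Unary.All.Properties as Allₚ
open import Data.List.Membership.Propositional.Properties using (∈-filter⁺; ∈-upTo⁺)
open import Data.Maybe using (Maybe; just; nothing)
open import Data.Nat as ℕ using (ℕ; NonZero; zero; suc; _!)
open import Data.Nat.Coprimality using (coprime-divisor)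
import Data.Nat.DivMod as DM
open import Data.Nat.Divisibility using (_∣_; ∣-trans; ∣-antisym; ∣1⇒≡1; ∣⇒≤; 0∣⇒≡0; m∣m*n; n∣m*n; m%n≡0⇒n∣m)
open import Data.Nat.GCD using (gcd; gcd[m,n]∣m; gcd[m,n]∣n; gcd-greatest; gcd-zeroˡ)
open import Data.Nat.Primality using (prime⇒irreducible)
import Data.Nat.Properties as ℕₚ
import Data.Nat.Tactic.RingSolver as ℕ-Solver
open import Data.List.Extrema ℕₚ.≤-totalOrder using (argmin; argmin-all; f[argmin]≤f[xs])
open import Data.Product using (_×_; _,_; Σ-syntax; proj₁; proj₂)
open import Data.Rational using (ℚ; mkℚ; Positive)
open import Data.Sum using (_⊎_; inj₁; inj₂; [_,_])
open import Data.Unit using (⊤; tt)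
open import Data.Vec using (Vec; _∷_; lookup)
open import Function using (_∘_; id)
open import Relation.Nullary using (¬_; Dec; yes; no; contradiction)
open import Relation.Binary.PropositionalEquality hiding ([_])
open import Defs

-- Sums

-- Values are computed over ℤ and reduced modulo N only at the end, because the identities behind
-- the convolutions are proved by cancelling factorials, which fails modulo N. A circuit then
-- produces S · f x with a scale S common to all x. If S is coprime to N, the gcds with N are
-- unaffected. S is built from signs, (d - 1)! and the interpolation scale ∏_{k<C} k!, where C = 2 B
-- is the number of evaluation points; so a base is admissible if C ≤ 4 d. The signed Newton
-- transform turns translation by a into ∇^a. Since f̂ vanishes beyond the degree of f, at most d
-- terms of the expansion of ∇^a survive, however large a is; translating by h d is no dearer than
-- translating by 1. Besides C^s = 2^s B^s, the cost has one factor of order s for the halvings of d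
-- and one for the levels of Toom-Cook. As (1 + s)² ≤ 4^s, everything is at most a constant times
-- 8^s B^s. For ε ≥ 1 / v take B = 2^(1 + 3 v): the v-th power of 8^s is then 2^(3 v s) ≤ B^s ≤ B d,
-- so that the v-th power of the cost gains only one factor d.

Ix : ℕ → ℕ → Set
Ix b zero    = ⊤
Ix b (suc s) = Fin b × Ix b s

-- The digits of an index may exceed the base B.
value : ∀ B {b} s → Ix b s → ℕ
value B zero    _       = 0
value B (suc s) (i , x) = toℕ i ℕ.* B ℕ.^ s ℕ.+ value B s x

-- Over an arbitrary semiring, because the sums over ℤ describe what circuits compute and the sums
-- over ℕ what they cost.
module Sums (R : Semiring 0ℓ 0ℓ) where

  private module R = Semiring R
  open R using (Carrier; _≈_; 0#; _+_; _*_; +-congˡ; +-identityˡ; +-identityʳ)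
  open SemiringSum R public
  open import Relation.Binary.Reasoning.Setoid R.setoid

  Σ< : ℕ → (ℕ → Carrier) → Carrier
  Σ< n f = sum {n} (f ∘ toℕ)

  sum-cong : ∀ n {f g : Fin n → Carrier} → (∀ i → f i ≈ g i) → sum f ≈ sum g
  sum-cong n = sum-cong-≋ {n}

  sum-zero : ∀ n {f : Fin n → Carrier} → (∀ i → f i ≈ 0#) → sum f ≈ 0#
  sum-zero n f≈0 = R.trans (sum-cong n f≈0) (sum-replicate-zero n)

  Σ<-split : ∀ m n f → Σ< (m ℕ.+ n) f ≈ Σ< m f + Σ< n (f ∘ (m ℕ.+_))
  Σ<-split zero    n f = R.sym (+-identityˡ _)
  Σ<-split (suc m) n f = R.trans (+-congˡ (Σ<-split m n (f ∘ suc))) (R.sym (R.+-assoc _ _ _))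

  Σ<-truncate : ∀ m n f → (∀ i → f (m ℕ.+ i) ≈ 0#) → Σ< (m ℕ.+ n) f ≈ Σ< m f
  Σ<-truncate m n f f≈0 = begin
    Σ< (m ℕ.+ n) f                    ≈⟨ Σ<-split m n f ⟩
    Σ< m f + Σ< n (f ∘ (m ℕ.+_))      ≈⟨ +-congˡ (sum-zero n (f≈0 ∘ toℕ)) ⟩
    Σ< m f + 0#                       ≈⟨ +-identityʳ _ ⟩
    Σ< m f                            ∎

  Σ<-blocks : ∀ b w g → Σ< b (λ i → Σ< w (λ k → g (i ℕ.* w ℕ.+ k))) ≈ Σ< (b ℕ.* w) g
  Σ<-blocks zero    w g = R.refl
  Σ<-blocks (suc b) w g = begin
    Σ< w g + Σ< b (λ i → Σ< w (λ k → g (w ℕ.+ i ℕ.* w ℕ.+ k)))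
      ≈⟨ +-congˡ (sum-cong b λ i → sum-cong w λ k →
           R.reflexive (cong g (ℕₚ.+-assoc w (toℕ i ℕ.* w) (toℕ k)))) ⟩
    Σ< w g + Σ< b (λ i → Σ< w (λ k → g (w ℕ.+ (i ℕ.* w ℕ.+ k))))
      ≈⟨ +-congˡ (Σ<-blocks b w (g ∘ (w ℕ.+_))) ⟩
    Σ< w g + Σ< (b ℕ.* w) (g ∘ (w ℕ.+_))
      ≈⟨ Σ<-split w (b ℕ.* w) g ⟨
    Σ< (w ℕ.+ b ℕ.* w) g ∎

  ΣIx : ∀ {b} s → (Ix b s → Carrier) → Carrier
  ΣIx         zero    f = f tt
  ΣIx {b = b} (suc s) f = sum {b} λ i → ΣIx s λ x → f (i , x)

  ΣIx-cong : ∀ {b} s {f g : Ix b s → Carrier} → (∀ x → f x ≈ g x) → ΣIx s f ≈ ΣIx s g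
  ΣIx-cong         zero    e = e tt
  ΣIx-cong {b = b} (suc s) e = sum-cong b λ i → ΣIx-cong s λ x → e (i , x)

  *-distribˡ-ΣIx : ∀ {b} s c (f : Ix b s → Carrier) → c * ΣIx s f ≈ ΣIx s (λ x → c * f x)
  *-distribˡ-ΣIx         zero    c f = R.refl
  *-distribˡ-ΣIx {b = b} (suc s) c f =
    R.trans (*-distribˡ-sum {b} c _) (sum-cong b λ i → *-distribˡ-ΣIx s c λ x → f (i , x))

  ΣIx-sum : ∀ {b} n s (f : Ix b s → Fin n → Carrier) →
            ΣIx s (λ x → sum (f x)) ≈ sum (λ k → ΣIx s (λ x → f x k))
  ΣIx-sum         n zero    f = R.refl
  ΣIx-sum {b = b} n (suc s) f =
    R.trans (sum-cong b λ i → ΣIx-sum n s λ x → f (i , x)) (∑-comm {b} {n} _)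

  ΣIx-comm : ∀ {b b′} s s′ (f : Ix b s → Ix b′ s′ → Carrier) →
             ΣIx s (λ x → ΣIx s′ (f x)) ≈ ΣIx s′ (λ y → ΣIx s (λ x → f x y))
  ΣIx-comm           s zero     f = R.refl
  ΣIx-comm {b′ = b′} s (suc s′) f = R.trans
    (ΣIx-sum b′ s λ x k → ΣIx s′ λ y → f x (k , y))
    (sum-cong b′ λ k → ΣIx-comm s s′ λ x y → f x (k , y))

  ΣIx-value : ∀ B s (g : ℕ → Carrier) → ΣIx s (g ∘ value B {B} s) ≈ Σ< (B ℕ.^ s) g
  ΣIx-value B zero    g = R.sym (+-identityʳ _)
  ΣIx-value B (suc s) g = R.trans
    (sum-cong B λ i → ΣIx-value B s λ k → g (toℕ i ℕ.* B ℕ.^ s ℕ.+ k))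
    (Σ<-blocks B (B ℕ.^ s) g)

-- Circuits

data Src (I : Set) : Set where
  zer uni : Src I
  reg     : I → Src I

-- Circuits from I-indexed to J-indexed families of integers.
data Circ : Set → Set → Set₁ where
  wire : ∀ {I J} → (J → Src I) → Circ I J
  gate : ∀ {I} → Op → Src I → Src I → Circ I ⊤
  _⟫_  : ∀ {I J K} → Circ I J → Circ J K → Circ I K
  _△_  : ∀ {I J K} → Circ I J → Circ I K → Circ I (J ⊎ K)

infixl 5 _⟫_
infixr 6 _△_

⟦_⟧ᵒ : Op → ℤ → ℤ → ℤ
⟦ add ⟧ᵒ = ℤ._+_
⟦ sub ⟧ᵒ = ℤ._-_
⟦ mul ⟧ᵒ = ℤ._*_

read : ∀ {I} → (I → ℤ) → Src I → ℤ
read ρ zer     = + 0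
read ρ uni     = + 1
read ρ (reg i) = ρ i

-- Integers rather than residues: in ℤ nonzero factors can be cancelled, and the modulus enters only
-- through `compile-correct`.
sem : ∀ {I J} → Circ I J → (I → ℤ) → J → ℤ
sem (wire f)     ρ j = read ρ (f j)
sem (gate o x y) ρ _ = ⟦ o ⟧ᵒ (read ρ x) (read ρ y)
sem (c ⟫ c′)     ρ   = sem c′ (sem c ρ)
sem (c △ c′)     ρ   = [ sem c ρ , sem c′ ρ ]

size : ∀ {I J} → Circ I J → ℕ
size (wire _)     = 0
size (gate _ _ _) = 1
size (c ⟫ c′)     = size c ℕ.+ size c′
size (c △ c′)     = size c ℕ.+ size c′

read-cong : ∀ {I} {ρ ρ′ : I → ℤ} → ρ ≗ ρ′ → read ρ ≗ read ρ′
read-cong e zer     = refl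
read-cong e uni     = refl
read-cong e (reg i) = e i

sem-cong : ∀ {I J} (c : Circ I J) {ρ ρ′ : I → ℤ} → ρ ≗ ρ′ → sem c ρ ≗ sem c ρ′
sem-cong (wire f)     e j        = read-cong e (f j)
sem-cong (gate o x y) e _        = cong₂ ⟦ o ⟧ᵒ (read-cong e x) (read-cong e y)
sem-cong (c ⟫ c′)     e          = sem-cong c′ (sem-cong c e)
sem-cong (c △ c′)     e (inj₁ j) = sem-cong c e j
sem-cong (c △ c′)     e (inj₂ j) = sem-cong c′ e j

-- Registers z and u are to hold 0 and 1.  The continuation gets the renaming
-- of the old registers and the position of the outputs.
Cont : Set → ℕ → Set
Cont J k = ∀ {k′} → (Fin k → Fin k′) → (J → Fin k′) → Tree k′

source : ∀ {I : Set} {k} → Fin k → Fin k → (I → Fin k) → Src I → Fin k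
source z u env zer     = z
source z u env uni     = u
source z u env (reg i) = env i

-- In continuation-passing style, since trees have no sequential composition and every instruction
-- shifts the positions of all earlier registers.
compile : ∀ {I J k} → Circ I J → (z u : Fin k) → (I → Fin k) → Cont J k → Tree k
compile (wire f)     z u env κ = κ id (source z u env ∘ f)
compile (gate o x y) z u env κ =
  arith o (source z u env x) (source z u env y) (κ suc (λ _ → zero))
compile (c ⟫ c′)     z u env κ =
  compile c z u env λ w e → compile c′ (w z) (w u) e λ w′ e′ → κ (w′ ∘ w) e′
compile (c △ c′)     z u env κ =
  compile c z u env λ w e → compile c′ (w z) (w u) (w ∘ env) λ w′ e′ →
    κ (w′ ∘ w) [ w′ ∘ e , e′ ]

-- Congruence modulo N and correctness of compilation

module _ (N : ℕ) .{{_ : NonZero N}} where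

  infix 4 _≈_

  record _≈_ (x : ℕ) (y : ℤ) : Set where
    constructor _,_
    field
      quotient : ℤ
      equation : + x ≡ y ℤ.+ quotient ℤ.* + N
  open _≈_ public

  private
    +-% : ∀ a → + (a ℕ.% N) ≡ + a ℤ.- + (a ℕ./ N) ℤ.* + N
    +-% a = begin
      + (a ℕ.% N)                                  ≡⟨ lem (+ (a ℕ.% N)) q ⟩
      (+ (a ℕ.% N) ℤ.+ q) ℤ.- q                    ≡⟨ cong (λ h → (+ (a ℕ.% N) ℤ.+ h) ℤ.- h) (ℤₚ.pos-* (a ℕ./ N) N) ⟨
      + (a ℕ.% N ℕ.+ a ℕ./ N ℕ.* N) ℤ.- + (a ℕ./ N ℕ.* N) ≡⟨ cong₂ (λ h h′ → + h ℤ.- h′) (sym (DM.m≡m%n+[m/n]*n a N)) (ℤₚ.pos-* (a ℕ./ N) N) ⟩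
      + a ℤ.- q                                    ∎
      where
      open ≡-Reasoning
      q = + (a ℕ./ N) ℤ.* + N
      lem : ∀ x y → x ≡ (x ℤ.+ y) ℤ.- y
      lem = solve-∀

  ≈-refl : ∀ n → n ≈ + n
  ≈-refl n = + 0 , lem (+ n) (+ N)
    where
    lem : ∀ a b → a ≡ a ℤ.+ + 0 ℤ.* b
    lem = solve-∀

  op-≈ : ∀ o {x y a b} → x ≈ a → y ≈ b → ⟦_⟧ N o x y ≈ ⟦ o ⟧ᵒ a b
  op-≈ add {x} {y} {a} {b} (s , p) (t , q) = s ℤ.+ t ℤ.- k , (begin
    + ((x ℕ.+ y) ℕ.% N)                              ≡⟨ +-% (x ℕ.+ y) ⟩
    + x ℤ.+ + y ℤ.- k ℤ.* + N                        ≡⟨ cong₂ (λ g h → g ℤ.+ h ℤ.- k ℤ.* + N) p q ⟩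
    (a ℤ.+ s ℤ.* + N) ℤ.+ (b ℤ.+ t ℤ.* + N) ℤ.- k ℤ.* + N ≡⟨ lem a b s t k (+ N) ⟩
    a ℤ.+ b ℤ.+ (s ℤ.+ t ℤ.- k) ℤ.* + N ∎)
    where
    open ≡-Reasoning
    k = + ((x ℕ.+ y) ℕ./ N)
    lem : ∀ a b s t k n → (a ℤ.+ s ℤ.* n) ℤ.+ (b ℤ.+ t ℤ.* n) ℤ.- k ℤ.* n
        ≡ a ℤ.+ b ℤ.+ (s ℤ.+ t ℤ.- k) ℤ.* n
    lem = solve-∀
  op-≈ mul {x} {y} {a} {b} (s , p) (t , q) = a ℤ.* t ℤ.+ s ℤ.* b ℤ.+ s ℤ.* t ℤ.* + N ℤ.- k , (begin
    + ((x ℕ.* y) ℕ.% N)                              ≡⟨ +-% (x ℕ.* y) ⟩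
    + (x ℕ.* y) ℤ.- k ℤ.* + N                        ≡⟨ cong (ℤ._- k ℤ.* + N) (ℤₚ.pos-* x y) ⟩
    + x ℤ.* + y ℤ.- k ℤ.* + N                        ≡⟨ cong₂ (λ g h → g ℤ.* h ℤ.- k ℤ.* + N) p q ⟩
    (a ℤ.+ s ℤ.* + N) ℤ.* (b ℤ.+ t ℤ.* + N) ℤ.- k ℤ.* + N ≡⟨ lem a b s t k (+ N) ⟩
    a ℤ.* b ℤ.+ (a ℤ.* t ℤ.+ s ℤ.* b ℤ.+ s ℤ.* t ℤ.* + N ℤ.- k) ℤ.* + N ∎)
    where
    open ≡-Reasoning
    k = + ((x ℕ.* y) ℕ./ N)
    lem : ∀ a b s t k n → (a ℤ.+ s ℤ.* n) ℤ.* (b ℤ.+ t ℤ.* n) ℤ.- k ℤ.* n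
        ≡ a ℤ.* b ℤ.+ (a ℤ.* t ℤ.+ s ℤ.* b ℤ.+ s ℤ.* t ℤ.* n ℤ.- k) ℤ.* n
    lem = solve-∀
  op-≈ sub {x} {y} {a} {b} (s , p) (t , q) = + 1 ℤ.+ s ℤ.- t ℤ.+ l ℤ.- k , (begin
    + ((x ℕ.+ (N ℕ.∸ y ℕ.% N)) ℕ.% N)                ≡⟨ +-% (x ℕ.+ (N ℕ.∸ y ℕ.% N)) ⟩
    + x ℤ.+ + (N ℕ.∸ y ℕ.% N) ℤ.- k ℤ.* + N          ≡⟨ cong (λ h → + x ℤ.+ h ℤ.- k ℤ.* + N) (trans (sym (ℤₚ.⊖-≥ (ℕₚ.<⇒≤ (DM.m%n<n y N)))) (sym (ℤₚ.m-n≡m⊖n N (y ℕ.% N)))) ⟩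
    + x ℤ.+ (+ N ℤ.- + (y ℕ.% N)) ℤ.- k ℤ.* + N      ≡⟨ cong (λ h → + x ℤ.+ (+ N ℤ.- h) ℤ.- k ℤ.* + N) (+-% y) ⟩
    + x ℤ.+ (+ N ℤ.- (+ y ℤ.- l ℤ.* + N)) ℤ.- k ℤ.* + N ≡⟨ cong₂ (λ g h → g ℤ.+ (+ N ℤ.- (h ℤ.- l ℤ.* + N)) ℤ.- k ℤ.* + N) p q ⟩
    (a ℤ.+ s ℤ.* + N) ℤ.+ (+ N ℤ.- ((b ℤ.+ t ℤ.* + N) ℤ.- l ℤ.* + N)) ℤ.- k ℤ.* + N ≡⟨ lem a b s t k l (+ N) ⟩
    a ℤ.- b ℤ.+ (+ 1 ℤ.+ s ℤ.- t ℤ.+ l ℤ.- k) ℤ.* + N ∎)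
    where
    open ≡-Reasoning
    k = + ((x ℕ.+ (N ℕ.∸ y ℕ.% N)) ℕ./ N)
    l = + (y ℕ./ N)
    lem : ∀ a b s t k l n → (a ℤ.+ s ℤ.* n) ℤ.+ (n ℤ.- ((b ℤ.+ t ℤ.* n) ℤ.- l ℤ.* n)) ℤ.- k ℤ.* n
        ≡ a ℤ.- b ℤ.+ (+ 1 ℤ.+ s ℤ.- t ℤ.+ l ℤ.- k) ℤ.* n
    lem = solve-∀

  record Extends {k k′} (ρ : Vec ℕ k) (ρ′ : Vec ℕ k′) (w : Fin k → Fin k′) : Set where
    constructor extends
    field preserved : ∀ i → lookup ρ′ (w i) ≡ lookup ρ i
  open Extends public

  Extends-trans : ∀ {k k′ k″} {ρ : Vec ℕ k} {ρ′ : Vec ℕ k′} {ρ″ : Vec ℕ k″} {w w′} →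
                  Extends ρ ρ′ w → Extends ρ′ ρ″ w′ → Extends ρ ρ″ (w′ ∘ w)
  Extends-trans {w = w} (extends p) (extends q) = extends λ i → trans (q (w i)) (p i)

  preserve-≈ : ∀ {k k′} {ρ : Vec ℕ k} {ρ′ : Vec ℕ k′} {w} → Extends ρ ρ′ w →
               ∀ i {a} → lookup ρ i ≈ a → lookup ρ′ (w i) ≈ a
  preserve-≈ E i {a} = subst (_≈ a) (sym (preserved E i))

  source-≈ : ∀ {I k} {z u : Fin k} {env : I → Fin k} (ρ : Vec ℕ k) {σ : I → ℤ} →
             lookup ρ z ≈ + 0 → lookup ρ u ≈ + 1 → (∀ i → lookup ρ (env i) ≈ σ i) →
             ∀ x → lookup ρ (source z u env x) ≈ read σ x
  source-≈ ρ hz hu he zer     = hz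
  source-≈ ρ hz hu he uni     = hu
  source-≈ ρ hz hu he (reg i) = he i

  -- For an arbitrary predicate of the final output, because a tree returns only inside the
  -- continuation and has no intermediate result to speak about.
  compile-correct : ∀ {I J k} (c : Circ I J) {z u : Fin k} {env : I → Fin k} {κ : Cont J k}
    {ρ : Vec ℕ k} {σ : I → ℤ} (Q : ℕ → Set) →
    lookup ρ z ≈ + 0 → lookup ρ u ≈ + 1 → (∀ i → lookup ρ (env i) ≈ σ i) →
    (∀ {k′} (ρ′ : Vec ℕ k′) w e → Extends ρ ρ′ w → (∀ j → lookup ρ′ (e j) ≈ sem c σ j) →
      Q (output N (κ w e) ρ′)) →
    Q (output N (compile c z u env κ) ρ)
  compile-correct (wire f) {ρ = ρ} Q hz hu he H =
    H _ _ _ (extends λ _ → refl) (λ j → source-≈ ρ hz hu he (f j))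
  compile-correct (gate o x y) {ρ = ρ} Q hz hu he H =
    H _ _ _ (extends λ _ → refl) (λ _ → op-≈ o (source-≈ ρ hz hu he x) (source-≈ ρ hz hu he y))
  compile-correct (c ⟫ c′) Q hz hu he H =
    compile-correct c Q hz hu he λ ρ₁ w e E he₁ →
    compile-correct c′ Q (preserve-≈ E _ hz) (preserve-≈ E _ hu) he₁ λ ρ₂ w′ e′ E′ →
      H ρ₂ _ _ (Extends-trans E E′)
  compile-correct (c △ c′) Q hz hu he H =
    compile-correct c Q hz hu he λ ρ₁ w e E he₁ →
    compile-correct c′ Q (preserve-≈ E _ hz) (preserve-≈ E _ hu) (λ i → preserve-≈ E _ (he i))
      λ ρ₂ w′ e′ E′ he₂ → H ρ₂ _ _ (Extends-trans E E′)
        λ { (inj₁ j) → preserve-≈ E′ _ (he₁ j) ; (inj₂ j) → he₂ j }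

  compile-cost : ∀ {I J k} (c : Circ I J) {z u : Fin k} {env : I → Fin k} {κ : Cont J k}
    {ρ : Vec ℕ k} b → (∀ {k′} (ρ′ : Vec ℕ k′) w e → cost N (κ w e) ρ′ ℕ.≤ b) →
    cost N (compile c z u env κ) ρ ℕ.≤ size c ℕ.+ b
  compile-cost (wire f)     b H = H _ _ _
  compile-cost (gate o x y) b H = ℕ.s≤s (H _ _ _)
  compile-cost (c ⟫ c′)     b H = ℕₚ.≤-trans
    (compile-cost c (size c′ ℕ.+ b) λ ρ₁ w e → compile-cost c′ b λ ρ₂ w′ e′ → H ρ₂ _ _)
    (ℕₚ.≤-reflexive (sym (ℕₚ.+-assoc (size c) _ b)))
  compile-cost (c △ c′)     b H = ℕₚ.≤-trans
    (compile-cost c (size c′ ℕ.+ b) λ ρ₁ w e → compile-cost c′ b λ ρ₂ w′ e′ → H ρ₂ _ _)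
    (ℕₚ.≤-reflexive (sym (ℕₚ.+-assoc (size c) _ b)))

-- Circuit combinators

module Sℕ = Sums ℕₚ.+-*-semiring
open Sums ℤₚ.+-*-semiring

vec : ∀ {I} n → (Fin n → Circ I ⊤) → Circ I (Fin n)
vec zero    f = wire λ ()
vec (suc n) f = f zero △ vec n (f ∘ suc) ⟫ wire λ { zero → reg (inj₁ tt) ; (suc k) → reg (inj₂ k) }

sem-vec : ∀ {I} n (f : Fin n → Circ I ⊤) ρ k → sem (vec n f) ρ k ≡ sem (f k) ρ tt
sem-vec (suc n) f ρ zero    = refl
sem-vec (suc n) f ρ (suc k) = sem-vec n (f ∘ suc) ρ k

size-vec : ∀ {I} n (f : Fin n → Circ I ⊤) → size (vec n f) ≡ Sℕ.sum (size ∘ f)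
size-vec zero    f = refl
size-vec (suc n) f = trans (ℕₚ.+-identityʳ _) (cong (size (f zero) ℕ.+_) (size-vec n (f ∘ suc)))

tup : ∀ {I J} n → (Fin n → Circ I J) → Circ I (Fin n × J)
tup zero    f = wire λ ()
tup (suc n) f = f zero △ tup n (f ∘ suc)
  ⟫ wire λ { (zero , j) → reg (inj₁ j) ; (suc k , j) → reg (inj₂ (k , j)) }

sem-tup : ∀ {I J} n (f : Fin n → Circ I J) ρ k j → sem (tup n f) ρ (k , j) ≡ sem (f k) ρ j
sem-tup (suc n) f ρ zero    j = refl
sem-tup (suc n) f ρ (suc k) j = sem-tup n (f ∘ suc) ρ k j

size-tup : ∀ {I J} n (f : Fin n → Circ I J) → size (tup n f) ≡ Sℕ.sum (size ∘ f)
size-tup zero    f = refl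
size-tup (suc n) f = trans (ℕₚ.+-identityʳ _) (cong (size (f zero) ℕ.+_) (size-tup n (f ∘ suc)))

tupIx : ∀ {I b} s → (Ix b s → Circ I ⊤) → Circ I (Ix b s)
tupIx         zero    f = f tt
tupIx {b = b} (suc s) f = tup b λ i → tupIx s λ x → f (i , x)

sem-tupIx : ∀ {I b} s (f : Ix b s → Circ I ⊤) ρ x → sem (tupIx s f) ρ x ≡ sem (f x) ρ tt
sem-tupIx         zero    f ρ _       = refl
sem-tupIx {b = b} (suc s) f ρ (i , x) =
  trans (sem-tup b _ ρ i x) (sem-tupIx s (λ x → f (i , x)) ρ x)

sum-const : ∀ n {f : Fin n → ℕ} {c} → (∀ i → f i ≡ c) → Sℕ.sum f ≡ n ℕ.* c
sum-const zero    h = refl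
sum-const (suc n) h = cong₂ ℕ._+_ (h zero) (sum-const n (h ∘ suc))

sum-mono : ∀ n {f g : Fin n → ℕ} → (∀ i → f i ℕ.≤ g i) → Sℕ.sum f ℕ.≤ Sℕ.sum g
sum-mono zero    h = ℕ.z≤n
sum-mono (suc n) h = ℕₚ.+-mono-≤ (h zero) (sum-mono n (h ∘ suc))

size-tupIx : ∀ {I b} s (f : Ix b s → Circ I ⊤) c → (∀ x → size (f x) ≡ c) →
             size (tupIx s f) ≡ b ℕ.^ s ℕ.* c
size-tupIx         zero    f c h = trans (h tt) (sym (ℕₚ.*-identityˡ c))
size-tupIx {b = b} (suc s) f c h = trans (size-tup b _)
  (trans (sum-const b λ i → size-tupIx s (λ x → f (i , x)) c λ x → h (i , x))
         (sym (ℕₚ.*-assoc b _ c)))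

-- Accumulators: `nothing` is the register that is added to.
_then_ : ∀ {I} → Circ (Maybe I) ⊤ → Circ (Maybe I) ⊤ → Circ (Maybe I) ⊤
c then c′ = c △ wire (reg ∘ just)
  ⟫ wire (λ { nothing → reg (inj₁ tt) ; (just i) → reg (inj₂ i) }) ⟫ c′

-- Relative to a running total, so that terms chain without further additions. Started at zero, a
-- linear form then costs exactly the sum of the absolute values of its coefficients.
record Adds {I} (c : Circ (Maybe I) ⊤) (g : (I → ℤ) → ℤ) : Set where
  constructor adds
  field sum-of : ∀ ρ → sem c ρ tt ≡ ρ nothing ℤ.+ g (ρ ∘ just)
open Adds

then-adds : ∀ {I} {c c′ : Circ (Maybe I) ⊤} {g g′} → Adds c g → Adds c′ g′ →
            Adds (c then c′) (λ ρ → g ρ ℤ.+ g′ ρ)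
then-adds {g = g} (adds p) (adds q) = adds λ ρ →
  trans (q _) (trans (cong (ℤ._+ _) (p ρ)) (ℤₚ.+-assoc (ρ nothing) (g (ρ ∘ just)) _))

size-then : ∀ {I} (c c′ : Circ (Maybe I) ⊤) → size (c then c′) ≡ size c ℕ.+ size c′
size-then c c′ = cong (ℕ._+ size c′) (trans (ℕₚ.+-identityʳ _) (ℕₚ.+-identityʳ _))

keep : ∀ {I} → Circ (Maybe I) ⊤
keep = wire λ _ → reg nothing

keep-adds : ∀ {I} → Adds {I} keep (λ _ → + 0)
keep-adds = adds λ ρ → sym (ℤₚ.+-identityʳ _)

weaken : ∀ {I} → Src I → Src (Maybe I)
weaken zer     = zer
weaken uni     = uni
weaken (reg i) = reg (just i)

read-weaken : ∀ {I} (ρ : Maybe I → ℤ) x → read ρ (weaken x) ≡ read (ρ ∘ just) x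
read-weaken ρ zer     = refl
read-weaken ρ uni     = refl
read-weaken ρ (reg i) = refl

repeat : ∀ {I} → Op → Src I → ℕ → Circ (Maybe I) ⊤
repeat o x zero    = keep
repeat o x (suc n) = gate o (reg nothing) (weaken x) then repeat o x n

-- Repeated addition is cheap enough: the coefficients depend on the base alone, or are values of
-- `δ`, or serve to write down a single number of size at most linear in d.
addmul : ∀ {I} → ℤ → Src I → Circ (Maybe I) ⊤
addmul (+ n)    x = repeat add x n
addmul -[1+ n ] x = repeat sub x (suc n)

Adds-cong : ∀ {I} {c : Circ (Maybe I) ⊤} {g g′} → (∀ ρ → g ρ ≡ g′ ρ) → Adds c g → Adds c g′
Adds-cong e (adds p) = adds λ ρ → trans (p ρ) (cong (ℤ._+_ (ρ nothing)) (e _))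

repeat-add : ∀ {I} (x : Src I) n → Adds (repeat add x n) (λ ρ → + n ℤ.* read ρ x)
repeat-add x zero    = keep-adds
repeat-add x (suc n) = Adds-cong (λ ρ → sym (ℤₚ.suc-* (+ n) (read ρ x)))
  (then-adds {g = λ ρ → read ρ x} (adds λ ρ → cong (ℤ._+_ (ρ nothing)) (read-weaken ρ x)) (repeat-add x n))

repeat-sub : ∀ {I} (x : Src I) n → Adds (repeat sub x n) (λ ρ → ℤ.- + n ℤ.* read ρ x)
repeat-sub x zero    = keep-adds
repeat-sub x (suc n) = Adds-cong (λ ρ → lem (+ n) (read ρ x))
  (then-adds {g = λ ρ → ℤ.- read ρ x}
    (adds λ ρ → cong (λ y → ρ nothing ℤ.- y) (read-weaken ρ x)) (repeat-sub x n))
  where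
  lem : ∀ n y → ℤ.- y ℤ.+ ℤ.- n ℤ.* y ≡ ℤ.- (+ 1 ℤ.+ n) ℤ.* y
  lem = solve-∀

addmul-adds : ∀ {I} z (x : Src I) → Adds (addmul z x) (λ ρ → z ℤ.* read ρ x)
addmul-adds (+ n)    x = repeat-add x n
addmul-adds -[1+ n ] x = repeat-sub x (suc n)

size-repeat : ∀ {I} o (x : Src I) n → size (repeat o x n) ≡ n
size-repeat o x zero    = refl
size-repeat o x (suc n) =
  trans (size-then (gate o (reg nothing) (weaken x)) (repeat o x n)) (cong suc (size-repeat o x n))

size-addmul : ∀ {I} z (x : Src I) → size (addmul z x) ≡ ∣ z ∣
size-addmul (+ n)    x = size-repeat add x n
size-addmul -[1+ n ] x = size-repeat sub x (suc n)

addAll : ∀ {I} n → (Fin n → Circ (Maybe I) ⊤) → Circ (Maybe I) ⊤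
addAll zero    f = keep
addAll (suc n) f = f zero then addAll n (f ∘ suc)

addAll-adds : ∀ {I} n {f : Fin n → Circ (Maybe I) ⊤} {g : Fin n → (I → ℤ) → ℤ} →
              (∀ k → Adds (f k) (g k)) → Adds (addAll n f) (λ ρ → sum λ k → g k ρ)
addAll-adds zero    h = keep-adds
addAll-adds (suc n) h = then-adds (h zero) (addAll-adds n (h ∘ suc))

size-addAll : ∀ {I} n (f : Fin n → Circ (Maybe I) ⊤) → size (addAll n f) ≡ Sℕ.sum (size ∘ f)
size-addAll zero    f = refl
size-addAll (suc n) f =
  trans (size-then (f zero) (addAll n (f ∘ suc))) (cong (size (f zero) ℕ.+_) (size-addAll n (f ∘ suc)))

addIx : ∀ {I b} s → (Ix b s → Circ (Maybe I) ⊤) → Circ (Maybe I) ⊤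
addIx         zero    f = f tt
addIx {b = b} (suc s) f = addAll b λ i → addIx s λ x → f (i , x)

addIx-adds : ∀ {I b} s {f : Ix b s → Circ (Maybe I) ⊤} {g : Ix b s → (I → ℤ) → ℤ} →
             (∀ x → Adds (f x) (g x)) → Adds (addIx s f) (λ ρ → ΣIx s λ x → g x ρ)
addIx-adds         zero    h = h tt
addIx-adds {b = b} (suc s) h = addAll-adds b λ i → addIx-adds s λ x → h (i , x)

size-addIx : ∀ {I b} s (f : Ix b s → Circ (Maybe I) ⊤) →
             size (addIx s f) ≡ Sℕ.ΣIx s (size ∘ f)
size-addIx         zero    f = refl
size-addIx {b = b} (suc s) f =
  trans (size-addAll b _) (Sℕ.sum-cong b λ i → size-addIx s λ x → f (i , x))

from0 : ∀ {I} → Circ (Maybe I) ⊤ → Circ I ⊤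
from0 c = wire (λ { nothing → zer ; (just i) → reg i }) ⟫ c

sem-from0 : ∀ {I} {c : Circ (Maybe I) ⊤} {g} → Adds c g → ∀ ρ → sem (from0 c) ρ tt ≡ g ρ
sem-from0 (adds p) ρ = trans (p _) (ℤₚ.+-identityˡ _)

lin : ∀ {I} n → (Fin n → ℤ) → (Fin n → Src I) → Circ I ⊤
lin n w x = from0 (addAll n λ k → addmul (w k) (x k))

sem-lin : ∀ {I} n w (x : Fin n → Src I) ρ → sem (lin n w x) ρ tt ≡ sum λ k → w k ℤ.* read ρ (x k)
sem-lin n w x = sem-from0 (addAll-adds n λ k → addmul-adds (w k) (x k))

size-lin : ∀ {I} n w (x : Fin n → Src I) → size (lin n w x) ≡ Sℕ.sum λ k → ∣ w k ∣
size-lin n w x = trans (size-addAll n _) (Sℕ.sum-cong n λ k → size-addmul (w k) (x k))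

-- The Kronecker delta, by recursion on both arguments, so that a common shift of them is invisible
-- to conversion.
δ : ℕ → ℕ → ℤ
δ zero    zero    = + 1
δ (suc m) (suc n) = δ m n
δ _       _       = + 0

module _ where
  open import Data.Integer using (_+_; _*_; _-_)

  Σ<-δ : ∀ n k (f : ℕ → ℤ) → k ℕ.< n → Σ< n (λ i → δ i k * f i) ≡ f k
  Σ<-δ (suc n) zero    f (ℕ.s≤s _) = trans
    (cong₂ _+_ (ℤₚ.*-identityˡ (f 0)) (sum-zero n λ i → refl)) (ℤₚ.+-identityʳ _)
  Σ<-δ (suc n) (suc k) f (ℕ.s≤s p) = trans (ℤₚ.+-identityˡ _) (Σ<-δ n k (f ∘ suc) p)

  -- Each i ≤ k meets the antidiagonal in the single j = k - i, which is below n. For i > k there is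
  -- no such j, hence the vanishing hypothesis on `t`.
  Σ<-convolve : ∀ n k (F : ℕ → ℕ → ℤ) (t : ℕ → ℤ) → k ℕ.< n →
                (∀ i j → i ℕ.+ j ≡ k → F i j ≡ t i) → (∀ i → k ℕ.< i → t i ≡ + 0) →
                Σ< n (λ i → Σ< n (λ j → δ (i ℕ.+ j) k * F i j)) ≡ Σ< n t
  Σ<-convolve n k F t k<n F≡t t≡0 = sum-cong n λ i → inner (toℕ i) k (F (toℕ i)) (t (toℕ i))
    k<n (F≡t (toℕ i)) (t≡0 (toℕ i))
    where
    inner : ∀ i k f t → k ℕ.< n → (∀ j → i ℕ.+ j ≡ k → f j ≡ t) → (k ℕ.< i → t ≡ + 0) →
            Σ< n (λ j → δ (i ℕ.+ j) k * f j) ≡ t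
    inner zero    k       f t k<n h _ = trans (Σ<-δ n k f k<n) (h k refl)
    inner (suc i) zero    f t k<n _ z = trans (sum-zero n λ j → refl) (sym (z (ℕ.s≤s ℕ.z≤n)))
    inner (suc i) (suc k) f t k<n h z =
      inner i k f t (ℕₚ.<-trans (ℕₚ.n<1+n k) k<n) (λ j e → h j (cong suc e)) (z ∘ ℕ.s≤s)

open import Data.Integer using (_+_; _*_; _-_; -_; _^_)

-- Toom–Cook multiplication

Σ² : ∀ {b} s → (Ix b s → Ix b s → ℤ) → ℤ
Σ² s F = ΣIx s λ x → ΣIx s λ y → F x y

Σ²-cong : ∀ {b} s {F G : Ix b s → Ix b s → ℤ} → (∀ x y → F x y ≡ G x y) → Σ² s F ≡ Σ² s G
Σ²-cong s e = ΣIx-cong s λ x → ΣIx-cong s λ y → e x y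

*-distribˡ-Σ² : ∀ {b} s c (F : Ix b s → Ix b s → ℤ) → c * Σ² s F ≡ Σ² s λ x y → c * F x y
*-distribˡ-Σ² s c F = trans (*-distribˡ-ΣIx s c _) (ΣIx-cong s λ x → *-distribˡ-ΣIx s c _)

Σ²-sum : ∀ {b} n s (F : Ix b s → Ix b s → Fin n → ℤ) →
         Σ² s (λ x y → sum (F x y)) ≡ sum λ k → Σ² s λ x y → F x y k
Σ²-sum n s F = trans (ΣIx-cong s λ x → ΣIx-sum n s (F x)) (ΣIx-sum n s _)

Σ²-suc : ∀ {b} s (φ : Ix b s → Ix b s → ℤ) (f g : Fin b → Ix b s → ℤ) →
         Σ² s (λ x y → φ x y * (sum (λ i → f i x) * sum (λ j → g j y)))
         ≡ Σ² (suc s) λ (i , x) (j , y) → φ x y * (f i x * g j y)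
Σ²-suc {b} s φ f g = begin
  Σ² s (λ x y → φ x y * (sum (λ i → f i x) * sum (λ j → g j y)))
    ≡⟨ Σ²-cong s expand ⟩
  Σ² s (λ x y → sum λ i → sum λ j → φ x y * (f i x * g j y))
    ≡⟨ Σ²-sum b s (λ x y i → sum λ j → φ x y * (f i x * g j y)) ⟩
  sum (λ i → ΣIx s λ x → ΣIx s λ y → sum λ j → φ x y * (f i x * g j y))
    ≡⟨ sum-cong b (λ i → ΣIx-cong s λ x → ΣIx-sum b s (λ y j → φ x y * (f i x * g j y))) ⟩
  Σ² (suc s) (λ (i , x) (j , y) → φ x y * (f i x * g j y)) ∎
  where
  open ≡-Reasoning
  expand : ∀ x y → φ x y * (sum (λ i → f i x) * sum (λ j → g j y))
                 ≡ sum λ i → sum λ j → φ x y * (f i x * g j y)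
  expand x y = begin
    φ x y * (sum (λ i → f i x) * sum (λ j → g j y))
      ≡⟨ cong (φ x y *_) (*-distribʳ-sum {b} (sum (λ j → g j y)) (λ i → f i x)) ⟩
    φ x y * sum (λ i → f i x * sum (λ j → g j y))
      ≡⟨ *-distribˡ-sum {b} (φ x y) (λ i → f i x * sum (λ j → g j y)) ⟩
    sum (λ i → φ x y * (f i x * sum (λ j → g j y)))
      ≡⟨ sum-cong b (λ i → trans (cong (φ x y *_) (*-distribˡ-sum {b} (f i x) (λ j → g j y)))
                                 (*-distribˡ-sum {b} (φ x y) (λ j → f i x * g j y))) ⟩
    sum (λ i → sum λ j → φ x y * (f i x * g j y)) ∎

-- A functional Λ e on the values at 0, …, C - 1 that extracts D times the
-- coefficient of x^e.
record Interpolation (C : ℕ) : Set where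
  field
    Λ       : ℕ → ℕ → ℤ
    D       : ℤ
    extract : ∀ e n → e ℕ.< C → n ℕ.< C → Σ< C (λ a → Λ e a * (+ a) ^ n) ≡ D * δ e n

-- A polynomial in s variables of degree < B in each is the family of its
-- coefficients, indexed by Ix B s.
module Toom (B C : ℕ) (B+B≤C : B ℕ.+ B ℕ.≤ C) (I : Interpolation C) where

  open Interpolation I

  evaluate : ∀ {K} s → (Ix B (suc s) → K) → Fin C → Circ K (Ix B s)
  evaluate s in₁ a = tupIx s λ x → lin B (λ i → (+ toℕ a) ^ toℕ i) (λ i → reg (in₁ (i , x)))

  interpolate : ∀ s → Circ (Fin C × Ix C s) (Ix C (suc s))
  interpolate s = tup C λ e → tupIx s λ x → lin C (λ a → Λ (toℕ e) (toℕ a)) (λ a → reg (a , x))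

  -- The first variable is replaced by its values at C points, the resulting polynomials in one
  -- variable fewer are multiplied recursively, and the first variable is interpolated back. This
  -- leads to C^s scalar products.
  times : ∀ s → Circ (Ix B s ⊎ Ix B s) (Ix C s)
  times zero    = gate mul (reg (inj₁ tt)) (reg (inj₂ tt))
  times (suc s) = tup C (λ a → evaluate s inj₁ a △ evaluate s inj₂ a ⟫ times s) ⟫ interpolate s

  -- Tested against a weight ψ that sees only the value of an index. Values add when indices do,
  -- even where digit sums exceed B, so carries never occur; and quantifying over ψ lets the
  -- induction absorb the leading digit.
  sem-times : ∀ s ρ (ψ : ℕ → ℤ) →
    ΣIx s (λ e → ψ (value B s e) * sem (times s) ρ e)
    ≡ D ^ s * Σ² s λ x y → ψ (value B s x ℕ.+ value B s y) * (ρ (inj₁ x) * ρ (inj₂ y))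
  sem-times zero    ρ ψ = sym (ℤₚ.*-identityˡ _)
  sem-times (suc s) ρ ψ = begin
    sum (λ e → ΣIx s λ x → ψ (toℕ e ℕ.* W ℕ.+ value B s x) * sem (times (suc s)) ρ (e , x))
      ≡⟨ sum-cong C (λ e → ΣIx-cong s λ x → cong (ψ (toℕ e ℕ.* W ℕ.+ value B s x) *_) (outputs e x)) ⟩
    sum (λ e → ΣIx s λ x → ψₑ e (value B s x) * sum λ a → Λ (toℕ e) (toℕ a) * p a x)
      ≡⟨ sum-cong C (λ e → per-coefficient e) ⟩
    sum (λ e → Σ² (suc s) λ (i , x) (j , y) → K e (i , x) (j , y) * (D * δ (toℕ e) (toℕ i ℕ.+ toℕ j)))
      ≡⟨ Σ²-sum C (suc s) (λ (i , x) (j , y) e → K e (i , x) (j , y) * (D * δ (toℕ e) (toℕ i ℕ.+ toℕ j))) ⟨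
    Σ² (suc s) (λ (i , x) (j , y) → sum λ e → K e (i , x) (j , y) * (D * δ (toℕ e) (toℕ i ℕ.+ toℕ j)))
      ≡⟨ Σ²-cong (suc s) collapse ⟩
    Σ² (suc s) (λ x y → D ^ suc s * (ψ (value B (suc s) x ℕ.+ value B (suc s) y) * (ρ (inj₁ x) * ρ (inj₂ y))))
      ≡⟨ *-distribˡ-Σ² (suc s) (D ^ suc s) (λ x y → ψ (value B (suc s) x ℕ.+ value B (suc s) y) * (ρ (inj₁ x) * ρ (inj₂ y))) ⟨
    D ^ suc s * Σ² (suc s) (λ x y → ψ (value B (suc s) x ℕ.+ value B (suc s) y) * (ρ (inj₁ x) * ρ (inj₂ y))) ∎
    where
    open ≡-Reasoning
    W = B ℕ.^ s
    ψₑ : Fin C → ℕ → ℤ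
    ψₑ e k = ψ (toℕ e ℕ.* W ℕ.+ k)
    σ : Fin C → Ix B s ⊎ Ix B s → ℤ
    σ a = sem (evaluate s inj₁ a △ evaluate s inj₂ a) ρ
    p : Fin C → Ix C s → ℤ
    p a = sem (times s) (σ a)
    α : Fin C → Fin B → ℤ
    α a i = (+ toℕ a) ^ toℕ i

    outputs : ∀ e x → sem (times (suc s)) ρ (e , x) ≡ sum λ a → Λ (toℕ e) (toℕ a) * p a x
    outputs e x = trans (sem-tup C _ _ e x) (trans (sem-tupIx s _ _ x)
      (trans (sem-lin C (λ a → Λ (toℕ e) (toℕ a)) (λ a → reg (a , x)) _)
      (sum-cong C λ a → cong (Λ (toℕ e) (toℕ a) *_)
        (sem-tup C (λ a → evaluate s inj₁ a △ evaluate s inj₂ a ⟫ times s) ρ a x))))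

    sem-evaluate : ∀ in₁ a x → sem (evaluate s in₁ a) ρ x ≡ sum λ i → α a i * ρ (in₁ (i , x))
    sem-evaluate in₁ a x = trans (sem-tupIx s _ ρ x) (sem-lin B (α a) (λ i → reg (in₁ (i , x))) ρ)

    K : Fin C → Ix B (suc s) → Ix B (suc s) → ℤ
    K e (i , x) (j , y) = D ^ s * (ψₑ e (value B s x ℕ.+ value B s y) * (ρ (inj₁ (i , x)) * ρ (inj₂ (j , y))))

    product-at : ∀ e a → ΣIx s (λ x → ψₑ e (value B s x) * p a x)
      ≡ Σ² (suc s) λ (i , x) (j , y) → K e (i , x) (j , y) * (+ toℕ a) ^ (toℕ i ℕ.+ toℕ j)
    product-at e a = begin
      ΣIx s (λ x → ψₑ e (value B s x) * p a x)
        -- For a fixed leading digit e, the weight left for the lower digits is ψ translated by e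
        -- B^s.
        ≡⟨ sem-times s (σ a) (ψₑ e) ⟩
      D ^ s * Σ² s (λ x y → φ x y * (σ a (inj₁ x) * σ a (inj₂ y)))
        ≡⟨ cong (D ^ s *_) (Σ²-cong s λ x y → cong (φ x y *_)
             (cong₂ _*_ (sem-evaluate inj₁ a x) (sem-evaluate inj₂ a y))) ⟩
      D ^ s * Σ² s (λ x y → φ x y * (sum (λ i → α a i * ρ (inj₁ (i , x))) * sum (λ j → α a j * ρ (inj₂ (j , y)))))
        ≡⟨ cong (D ^ s *_) (Σ²-suc s φ (λ i x → α a i * ρ (inj₁ (i , x))) (λ j y → α a j * ρ (inj₂ (j , y)))) ⟩
      D ^ s * Σ² (suc s) (λ (i , x) (j , y) → φ x y * (α a i * ρ (inj₁ (i , x)) * (α a j * ρ (inj₂ (j , y)))))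
        ≡⟨ *-distribˡ-Σ² (suc s) (D ^ s) (λ (i , x) (j , y) → φ x y * (α a i * ρ (inj₁ (i , x)) * (α a j * ρ (inj₂ (j , y))))) ⟩
      Σ² (suc s) (λ (i , x) (j , y) → D ^ s * (φ x y * (α a i * ρ (inj₁ (i , x)) * (α a j * ρ (inj₂ (j , y))))))
        ≡⟨ Σ²-cong (suc s) (λ (i , x) (j , y) → trans
             (lem (D ^ s) (φ x y) (α a i) (ρ (inj₁ (i , x))) (α a j) (ρ (inj₂ (j , y))))
             (cong (K e (i , x) (j , y) *_) (sym (ℤₚ.^-distribˡ-+-* (+ toℕ a) (toℕ i) (toℕ j))))) ⟩
      Σ² (suc s) (λ (i , x) (j , y) → K e (i , x) (j , y) * (+ toℕ a) ^ (toℕ i ℕ.+ toℕ j)) ∎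
      where
      φ : Ix B s → Ix B s → ℤ
      φ x y = ψₑ e (value B s x ℕ.+ value B s y)
      lem : ∀ d f a u b v → d * (f * (a * u * (b * v))) ≡ d * (f * (u * v)) * (a * b)
      lem = solve-∀

    per-coefficient : ∀ e → ΣIx s (λ x → ψₑ e (value B s x) * sum λ a → Λ (toℕ e) (toℕ a) * p a x)
      ≡ Σ² (suc s) λ (i , x) (j , y) → K e (i , x) (j , y) * (D * δ (toℕ e) (toℕ i ℕ.+ toℕ j))
    per-coefficient e = begin
      ΣIx s (λ x → ψₑ e (value B s x) * sum λ a → l a * p a x)
        ≡⟨ ΣIx-cong s (λ x → trans (*-distribˡ-sum {C} (ψₑ e (value B s x)) (λ a → l a * p a x))
             (sum-cong C λ a → swap (ψₑ e (value B s x)) (l a) (p a x))) ⟩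
      ΣIx s (λ x → sum λ a → l a * (ψₑ e (value B s x) * p a x))
        ≡⟨ ΣIx-sum C s (λ x a → l a * (ψₑ e (value B s x) * p a x)) ⟩
      sum (λ a → ΣIx s λ x → l a * (ψₑ e (value B s x) * p a x))
        ≡⟨ sum-cong C (λ a → trans (sym (*-distribˡ-ΣIx s (l a) (λ x → ψₑ e (value B s x) * p a x)))
             (trans (cong (l a *_) (product-at e a)) (*-distribˡ-Σ² (suc s) (l a)
               λ (i , x) (j , y) → K e (i , x) (j , y) * (+ toℕ a) ^ (toℕ i ℕ.+ toℕ j)))) ⟩
      sum (λ a → Σ² (suc s) λ (i , x) (j , y) → l a * (K e (i , x) (j , y) * (+ toℕ a) ^ (toℕ i ℕ.+ toℕ j)))
        ≡⟨ Σ²-sum C (suc s) (λ (i , x) (j , y) a → l a * (K e (i , x) (j , y) * (+ toℕ a) ^ (toℕ i ℕ.+ toℕ j))) ⟨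
      Σ² (suc s) (λ (i , x) (j , y) → sum λ a → l a * (K e (i , x) (j , y) * (+ toℕ a) ^ (toℕ i ℕ.+ toℕ j)))
        ≡⟨ Σ²-cong (suc s) (λ (i , x) (j , y) → trans
             (sum-cong C λ a → swap (l a) (K e (i , x) (j , y)) ((+ toℕ a) ^ (toℕ i ℕ.+ toℕ j)))
             (trans (sym (*-distribˡ-sum {C} (K e (i , x) (j , y)) (λ a → l a * (+ toℕ a) ^ (toℕ i ℕ.+ toℕ j))))
               (cong (K e (i , x) (j , y) *_)
                 (extract (toℕ e) (toℕ i ℕ.+ toℕ j) (Finₚ.toℕ<n e) (digit-sum i j))))) ⟩
      Σ² (suc s) (λ (i , x) (j , y) → K e (i , x) (j , y) * (D * δ (toℕ e) (toℕ i ℕ.+ toℕ j))) ∎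
      where
      l : Fin C → ℤ
      l a = Λ (toℕ e) (toℕ a)
      swap : ∀ x y z → x * (y * z) ≡ y * (x * z)
      swap = solve-∀
      -- This is where C ≥ 2 B is needed: exponents of a product must stay within the range of the
      -- interpolation.
      digit-sum : ∀ (i j : Fin B) → toℕ i ℕ.+ toℕ j ℕ.< C
      digit-sum i j = ℕₚ.<-≤-trans (ℕₚ.+-mono-< (Finₚ.toℕ<n i) (Finₚ.toℕ<n j)) B+B≤C

    collapse : ∀ x y → (sum λ e → K e x y * (D * δ (toℕ e) (toℕ (proj₁ x) ℕ.+ toℕ (proj₁ y))))
      ≡ D ^ suc s * (ψ (value B (suc s) x ℕ.+ value B (suc s) y) * (ρ (inj₁ x) * ρ (inj₂ y)))
    collapse (i , x) (j , y) = begin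
      sum (λ e → K e (i , x) (j , y) * (D * δ (toℕ e) n))
        ≡⟨ sum-cong C (λ e → lem (D ^ s) (ψₑ e v) r D (δ (toℕ e) n)) ⟩
      Σ< C (λ e → δ e n * (D * D ^ s * (ψ (e ℕ.* W ℕ.+ v) * r)))
        ≡⟨ Σ<-δ C n (λ e → D * D ^ s * (ψ (e ℕ.* W ℕ.+ v) * r)) (ℕₚ.<-≤-trans (ℕₚ.+-mono-< (Finₚ.toℕ<n i) (Finₚ.toℕ<n j)) B+B≤C) ⟩
      D ^ suc s * (ψ (n ℕ.* W ℕ.+ v) * r)
        ≡⟨ cong (λ k → D ^ suc s * (ψ k * r)) (digits (toℕ i) (toℕ j) W (value B s x) (value B s y)) ⟩
      D ^ suc s * (ψ (value B (suc s) (i , x) ℕ.+ value B (suc s) (j , y)) * r) ∎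
      where
      n = toℕ i ℕ.+ toℕ j
      v = value B s x ℕ.+ value B s y
      r = ρ (inj₁ (i , x)) * ρ (inj₂ (j , y))
      lem : ∀ d f r D δ → d * (f * r) * (D * δ) ≡ δ * (D * d * (f * r))
      lem = solve-∀
      digits : ∀ i j w x y → (i ℕ.+ j) ℕ.* w ℕ.+ (x ℕ.+ y) ≡ (i ℕ.* w ℕ.+ x) ℕ.+ (j ℕ.* w ℕ.+ y)
      digits = ℕ-Solver.solve-∀

-- Convolution

ΣIx-mono : ∀ {b} s {f g : Ix b s → ℕ} → (∀ x → f x ℕ.≤ g x) → Sℕ.ΣIx s f ℕ.≤ Sℕ.ΣIx s g
ΣIx-mono         zero    h = h tt
ΣIx-mono {b = b} (suc s) h = sum-mono b λ i → ΣIx-mono s λ x → h (i , x)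

ΣIx-one : ∀ b s → Sℕ.ΣIx {b} s (λ _ → 1) ≡ b ℕ.^ s
ΣIx-one b zero    = refl
ΣIx-one b (suc s) = sum-const b λ _ → ΣIx-one b s

-- Serves to show that each output of `times` is added into at most one coefficient, so that
-- collecting costs at most C^s.
Σ∣δ∣≤1 : ∀ n m → Sℕ.Σ< n (λ k → ∣ δ m k ∣) ℕ.≤ 1
Σ∣δ∣≤1 zero    m       = ℕ.z≤n
Σ∣δ∣≤1 (suc n) zero    = ℕ.s≤s (ℕₚ.≤-reflexive (Sℕ.sum-zero n λ _ → refl))
Σ∣δ∣≤1 (suc n) (suc m) = Σ∣δ∣≤1 n m

sum-affine : ∀ n c d (f : Fin n → ℕ) → Sℕ.sum (λ a → c ℕ.* f a ℕ.+ d) ≡ c ℕ.* Sℕ.sum f ℕ.+ n ℕ.* d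
sum-affine n c d f = trans (Sℕ.∑-distrib-+ {n} (λ a → c ℕ.* f a) (λ _ → d))
  (cong₂ ℕ._+_ (sym (Sℕ.*-distribˡ-sum {n} c f)) (sum-const n {c = d} λ _ → refl))

module Convolution (B C : ℕ) (B+B≤C : B ℕ.+ B ℕ.≤ C) .{{_ : NonZero C}} (I : Interpolation C) where

  open Interpolation I
  open Toom B C B+B≤C I

  private
    ‖α‖ : Fin C → ℕ
    ‖α‖ a = Sℕ.sum {B} λ i → ∣ (+ toℕ a) ^ toℕ i ∣
    ‖Λ‖ : Fin C → ℕ
    ‖Λ‖ e = Sℕ.sum {C} λ a → ∣ Λ (toℕ e) (toℕ a) ∣

  overhead : ℕ
  overhead = Sℕ.sum (λ a → ‖α‖ a ℕ.+ ‖α‖ a) ℕ.+ Sℕ.sum ‖Λ‖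

  -- Solves the recurrence T (s + 1) ≤ C · T s + C^s · `overhead`; the last term is enlarged by a
  -- factor C to fit the closed form.
  size-times : ∀ s → size (times s) ℕ.≤ C ℕ.^ s ℕ.* (1 ℕ.+ s ℕ.* overhead)
  size-times zero    = ℕₚ.≤-refl
  size-times (suc s) = begin
    size (times (suc s))
      ≡⟨ cong₂ ℕ._+_ (size-tup C _) (trans (size-tup C _) (sum-cong′ λ e → size-tupIx s _ (‖Λ‖ e) λ x →
             size-lin C (λ a → Λ (toℕ e) (toℕ a)) (λ a → reg (a , x)))) ⟩
    Sℕ.sum {C} (λ a → size (evaluate s inj₁ a) ℕ.+ size (evaluate s inj₂ a) ℕ.+ size (times s))
      ℕ.+ Sℕ.sum (λ e → P ℕ.* ‖Λ‖ e)
      ≤⟨ ℕₚ.+-mono-≤ (sum-mono C bound) (ℕₚ.≤-reflexive (sym (Sℕ.*-distribˡ-sum {C} P ‖Λ‖))) ⟩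
    Sℕ.sum (λ a → P ℕ.* (‖α‖ a ℕ.+ ‖α‖ a) ℕ.+ P ℕ.* (1 ℕ.+ s ℕ.* overhead)) ℕ.+ P ℕ.* Sℕ.sum ‖Λ‖
      ≡⟨ cong (ℕ._+ P ℕ.* Sℕ.sum ‖Λ‖) (sum-affine C P (P ℕ.* (1 ℕ.+ s ℕ.* overhead)) (λ a → ‖α‖ a ℕ.+ ‖α‖ a)) ⟩
    P ℕ.* Sℕ.sum (λ a → ‖α‖ a ℕ.+ ‖α‖ a) ℕ.+ C ℕ.* (P ℕ.* (1 ℕ.+ s ℕ.* overhead)) ℕ.+ P ℕ.* Sℕ.sum ‖Λ‖
      ≡⟨ regroup P (Sℕ.sum (λ a → ‖α‖ a ℕ.+ ‖α‖ a)) C s (Sℕ.sum ‖Λ‖) ⟩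
    C ℕ.* (P ℕ.* (1 ℕ.+ s ℕ.* overhead)) ℕ.+ 1 ℕ.* (P ℕ.* overhead)
      ≤⟨ ℕₚ.+-monoʳ-≤ (C ℕ.* (P ℕ.* (1 ℕ.+ s ℕ.* overhead))) (ℕₚ.*-monoˡ-≤ (P ℕ.* overhead) (ℕ.>-nonZero⁻¹ C)) ⟩
    C ℕ.* (P ℕ.* (1 ℕ.+ s ℕ.* overhead)) ℕ.+ C ℕ.* (P ℕ.* overhead)
      ≡⟨ factor C P s overhead ⟩
    C ℕ.^ suc s ℕ.* (1 ℕ.+ suc s ℕ.* overhead) ∎
    where
    open ℕₚ.≤-Reasoning
    P = C ℕ.^ s
    sum-cong′ = Sℕ.sum-cong C
    regroup : ∀ P x C s l → P ℕ.* x ℕ.+ C ℕ.* (P ℕ.* (1 ℕ.+ s ℕ.* (x ℕ.+ l))) ℕ.+ P ℕ.* l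
      ≡ C ℕ.* (P ℕ.* (1 ℕ.+ s ℕ.* (x ℕ.+ l))) ℕ.+ 1 ℕ.* (P ℕ.* (x ℕ.+ l))
    regroup = ℕ-Solver.solve-∀
    factor : ∀ C P s κ → C ℕ.* (P ℕ.* (1 ℕ.+ s ℕ.* κ)) ℕ.+ C ℕ.* (P ℕ.* κ)
      ≡ C ℕ.* P ℕ.* (1 ℕ.+ (1 ℕ.+ s) ℕ.* κ)
    factor = ℕ-Solver.solve-∀
    B≤C : B ℕ.≤ C
    B≤C = ℕₚ.≤-trans (ℕₚ.m≤m+n B B) B+B≤C
    size-evaluate : ∀ {K} (in₁ : Ix B (suc s) → K) a → size (evaluate s in₁ a) ℕ.≤ P ℕ.* ‖α‖ a
    size-evaluate in₁ a = ℕₚ.≤-trans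
      (ℕₚ.≤-reflexive (size-tupIx s _ (‖α‖ a) λ x →
        size-lin B (λ i → (+ toℕ a) ^ toℕ i) (λ i → reg (in₁ (i , x)))))
      (ℕₚ.*-monoˡ-≤ (‖α‖ a) (ℕₚ.^-monoˡ-≤ s B≤C))
    bound : ∀ a → size (evaluate s inj₁ a) ℕ.+ size (evaluate s inj₂ a) ℕ.+ size (times s)
      ℕ.≤ P ℕ.* (‖α‖ a ℕ.+ ‖α‖ a) ℕ.+ P ℕ.* (1 ℕ.+ s ℕ.* overhead)
    bound a = ℕₚ.+-mono-≤
      (ℕₚ.≤-trans (ℕₚ.+-mono-≤ (size-evaluate inj₁ a) (size-evaluate inj₂ a))
                  (ℕₚ.≤-reflexive (sym (ℕₚ.*-distribˡ-+ P (‖α‖ a) (‖α‖ a)))))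
      (size-times s)

  pad : ∀ {X n} → (Fin n → X) → ℕ → Src X
  pad {n = n} f k with k ℕ.<? n
  ... | yes k<n = reg (f (fromℕ< k<n))
  ... | no  _   = zer

  read-pad : ∀ {X n} (f : Fin n → X) ρ i → read ρ (pad f (toℕ i)) ≡ ρ (f i)
  read-pad {n = n} f ρ i with toℕ i ℕ.<? n
  ... | yes i<n = cong (ρ ∘ f) (Finₚ.fromℕ<-toℕ i i<n)
  ... | no  i≮n = contradiction (Finₚ.toℕ<n i) i≮n

  read-pad-≥ : ∀ {X n} (f : Fin n → X) ρ k → read ρ (pad f (n ℕ.+ k)) ≡ + 0
  read-pad-≥ {n = n} f ρ k with n ℕ.+ k ℕ.<? n
  ... | yes n+k<n = contradiction n+k<n (ℕₚ.m+n≮m n k)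
  ... | no  _     = refl

  collect : ∀ n s → Circ (Ix C s) (Fin n)
  collect n s = vec n λ k → from0 (addIx s λ e → addmul (δ (value B s e) (toℕ k)) (reg e))

  -- Both sequences are padded with zeros to length B^s, and only the first n coefficients of the
  -- product are kept.
  convolve : ∀ n s → Circ (Fin n ⊎ Fin n) (Fin n)
  convolve n s = wire [ pad inj₁ ∘ value B s , pad inj₂ ∘ value B s ] ⟫ times s ⟫ collect n s

  sem-convolve : ∀ n s → n ℕ.≤ B ℕ.^ s → ∀ ρ k →
    sem (convolve n s) ρ k ≡
    D ^ s * sum λ i → sum λ j → δ (toℕ i ℕ.+ toℕ j) (toℕ k) * (ρ (inj₁ i) * ρ (inj₂ j))
  sem-convolve n s n≤B^s ρ k = begin
    sem (convolve n s) ρ k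
      ≡⟨ trans (sem-vec n _ _ k) (sem-from0 (addIx-adds s λ e → addmul-adds (δ (value B s e) (toℕ k)) (reg e)) _) ⟩
    ΣIx s (λ e → δ (value B s e) (toℕ k) * sem (times s) σ e)
      -- This weight merges all outputs of value k, whatever their digits; the carries postponed by
      -- `times` are done here.
      ≡⟨ sem-times s σ (λ m → δ m (toℕ k)) ⟩
    D ^ s * Σ² s (λ x y → F (value B s x) (value B s y))
      ≡⟨ cong (D ^ s *_) (ΣIx-cong s λ x → ΣIx-value B s (F (value B s x))) ⟩
    D ^ s * ΣIx s (λ x → Σ< (B ℕ.^ s) (F (value B s x)))
      ≡⟨ cong (D ^ s *_) (ΣIx-value B s λ i → Σ< (B ℕ.^ s) (F i)) ⟩
    D ^ s * Σ< (B ℕ.^ s) (λ i → Σ< (B ℕ.^ s) (F i))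
      ≡⟨ cong (λ m → D ^ s * Σ< m (λ i → Σ< m (F i))) (sym (ℕₚ.m+[n∸m]≡n n≤B^s)) ⟩
    D ^ s * Σ< (n ℕ.+ t) (λ i → Σ< (n ℕ.+ t) (F i))
      ≡⟨ cong (D ^ s *_) (Σ<-truncate n t (λ i → Σ< (n ℕ.+ t) (F i)) λ i → sum-zero (n ℕ.+ t) λ j → outer-zero i (toℕ j)) ⟩
    D ^ s * Σ< n (λ i → Σ< (n ℕ.+ t) (F i))
      ≡⟨ cong (D ^ s *_) (sum-cong n λ i → Σ<-truncate n t (F (toℕ i)) (inner-zero (toℕ i))) ⟩
    D ^ s * Σ< n (λ i → Σ< n (F i))
      ≡⟨ cong (D ^ s *_) (sum-cong n λ i → sum-cong n λ j →
           cong (δ (toℕ i ℕ.+ toℕ j) (toℕ k) *_) (cong₂ _*_ (read-pad inj₁ ρ i) (read-pad inj₂ ρ j))) ⟩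
    D ^ s * sum (λ i → sum λ j → δ (toℕ i ℕ.+ toℕ j) (toℕ k) * (ρ (inj₁ i) * ρ (inj₂ j))) ∎
    where
    open ≡-Reasoning
    t = B ℕ.^ s ℕ.∸ n
    σ = sem (wire [ pad inj₁ ∘ value B s , pad inj₂ ∘ value B s ]) ρ
    F : ℕ → ℕ → ℤ
    F i j = δ (i ℕ.+ j) (toℕ k) * (read ρ (pad inj₁ i) * read ρ (pad inj₂ j))
    outer-zero : ∀ i j → F (n ℕ.+ i) j ≡ + 0
    outer-zero i j = trans (cong (λ z → δ (n ℕ.+ i ℕ.+ j) (toℕ k) * (z * read ρ (pad inj₂ j))) (read-pad-≥ inj₁ ρ i))
      (ℤₚ.*-zeroʳ (δ (n ℕ.+ i ℕ.+ j) (toℕ k)))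
    inner-zero : ∀ i j → F i (n ℕ.+ j) ≡ + 0
    inner-zero i j = trans (cong (λ z → d * (x * z)) (read-pad-≥ inj₂ ρ j))
      (trans (cong (d *_) (ℤₚ.*-zeroʳ x)) (ℤₚ.*-zeroʳ d))
      where
      d = δ (i ℕ.+ (n ℕ.+ j)) (toℕ k)
      x = read ρ (pad inj₁ i)

  size-convolve : ∀ n s → size (convolve n s) ℕ.≤ C ℕ.^ s ℕ.* (2 ℕ.+ s ℕ.* overhead)
  size-convolve n s = begin
    size (times s) ℕ.+ size (collect n s)
      ≤⟨ ℕₚ.+-mono-≤ (size-times s) size-collect ⟩
    C ℕ.^ s ℕ.* (1 ℕ.+ s ℕ.* overhead) ℕ.+ C ℕ.^ s
      ≡⟨ lem (C ℕ.^ s) (s ℕ.* overhead) ⟩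
    C ℕ.^ s ℕ.* (2 ℕ.+ s ℕ.* overhead) ∎
    where
    open ℕₚ.≤-Reasoning
    lem : ∀ P x → P ℕ.* (1 ℕ.+ x) ℕ.+ P ≡ P ℕ.* (2 ℕ.+ x)
    lem = ℕ-Solver.solve-∀
    size-collect : size (collect n s) ℕ.≤ C ℕ.^ s
    size-collect = begin
      size (collect n s)
        ≡⟨ trans (size-vec n _) (Sℕ.sum-cong n λ k → trans (size-addIx s _)
             (Sℕ.ΣIx-cong s λ e → size-addmul (δ (value B s e) (toℕ k)) (reg e))) ⟩
      Sℕ.sum {n} (λ k → Sℕ.ΣIx s λ e → ∣ δ (value B s e) (toℕ k) ∣)
        ≡⟨ Sℕ.ΣIx-sum n s (λ e k → ∣ δ (value B s e) (toℕ k) ∣) ⟨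
      Sℕ.ΣIx s (λ e → Sℕ.Σ< n λ k → ∣ δ (value B s e) k ∣)
        ≤⟨ ΣIx-mono s (λ e → Σ∣δ∣≤1 n (value B s e)) ⟩
      Sℕ.ΣIx {C} s (λ _ → 1)
        ≡⟨ ΣIx-one C s ⟩
      C ℕ.^ s ∎

-- Differences and interpolation

-- With this sign, sampling at 0 is an involution f ↦ f̂, where f̂ k = ∇^ k f 0.
∇^ : ℕ → (ℕ → ℤ) → ℕ → ℤ
∇^ zero    f x = f x
∇^ (suc k) f x = ∇^ k f x - ∇^ k f (suc x)

-- (-1)^i times the binomial coefficient of y and i.
binom : ℕ → ℕ → ℤ
binom _       zero    = + 1
binom zero    (suc i) = + 0
binom (suc y) (suc i) = binom y (suc i) - binom y i

binom-zero : ∀ y i → y ℕ.< i → binom y i ≡ + 0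
binom-zero zero    (suc i) _         = refl
binom-zero (suc y) (suc i) (ℕ.s≤s p) =
  cong₂ _-_ (binom-zero y (suc i) (ℕₚ.<-trans p (ℕₚ.n<1+n i))) (binom-zero y i p)

∇^-cong : ∀ k {f g : ℕ → ℤ} → f ≗ g → ∇^ k f ≗ ∇^ k g
∇^-cong zero    e x = e x
∇^-cong (suc k) e x = cong₂ _-_ (∇^-cong k e x) (∇^-cong k e (suc x))

∇^-scale : ∀ k c f x → ∇^ k (λ y → c * f y) x ≡ c * ∇^ k f x
∇^-scale zero    c f x = refl
∇^-scale (suc k) c f x = trans (cong₂ _-_ (∇^-scale k c f x) (∇^-scale k c f (suc x)))
  (lem c (∇^ k f x) (∇^ k f (suc x)))
  where
  lem : ∀ c a b → c * a - c * b ≡ c * (a - b)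
  lem = solve-∀

-- The binomial theorem for (1 - E)^y, where E is the shift by one. The length M is free because
-- `binom y i` vanishes for i > y, and one length must serve all y.
∇^-expand : ∀ y M f x → y ℕ.< M → ∇^ y f x ≡ Σ< M λ i → binom y i * f (i ℕ.+ x)
∇^-expand zero (suc M) f x _ = sym (trans
  (cong₂ _+_ (ℤₚ.*-identityˡ (f x)) (sum-zero M λ _ → refl)) (ℤₚ.+-identityʳ (f x)))
∇^-expand (suc y) (suc M) f x (ℕ.s≤s y<M) = begin
  ∇^ y f x - ∇^ y f (suc x)
    ≡⟨ cong₂ _-_ (∇^-expand y (suc M) f x (ℕₚ.m<n⇒m<1+n y<M)) (∇^-expand y M f (suc x) y<M) ⟩
  (+ 1 * f x + Σ< M p) - Σ< M (λ i → binom y i * f (i ℕ.+ suc x))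
    ≡⟨ cong (λ z → (+ 1 * f x + Σ< M p) - z)
         (sum-cong M λ i → cong (λ m → binom y (toℕ i) * f m) (ℕₚ.+-suc (toℕ i) x)) ⟩
  (+ 1 * f x + Σ< M p) - Σ< M q
    ≡⟨ lem (+ 1 * f x) (Σ< M p) (Σ< M q) ⟩
  + 1 * f x + (Σ< M p + - + 1 * Σ< M q)
    ≡⟨ cong (λ z → + 1 * f x + (Σ< M p + z)) (*-distribˡ-sum {M} (- + 1) (q ∘ toℕ)) ⟩
  + 1 * f x + (Σ< M p + Σ< M (λ i → - + 1 * q i))
    ≡⟨ cong (λ z → + 1 * f x + z) (∑-distrib-+ {M} (p ∘ toℕ) (λ i → - + 1 * q (toℕ i))) ⟨
  + 1 * f x + Σ< M (λ i → p i + - + 1 * q i)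
    ≡⟨ cong (λ z → + 1 * f x + z) (sum-cong M λ i →
         lem′ (binom y (suc (toℕ i))) (binom y (toℕ i)) (f (suc (toℕ i ℕ.+ x)))) ⟩
  + 1 * f x + Σ< M (λ i → binom (suc y) (suc i) * f (suc i ℕ.+ x)) ∎
  where
  open ≡-Reasoning
  p q : ℕ → ℤ
  p i = binom y (suc i) * f (suc (i ℕ.+ x))
  q i = binom y i * f (suc (i ℕ.+ x))
  lem : ∀ a b c → (a + b) - c ≡ a + (b + - + 1 * c)
  lem = solve-∀
  lem′ : ∀ a b f → a * f + - + 1 * (b * f) ≡ (a - b) * f
  lem′ = solve-∀

-- With x = 0: ∇^ y acts on f̂ as the translation of f by y.  The case k = 0 is the
-- involution.
∇^-dual : ∀ y f k x → ∇^ y (λ k → ∇^ k f x) k ≡ ∇^ k f (y ℕ.+ x)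
∇^-dual zero    f k x = refl
∇^-dual (suc y) f k x = trans (cong₂ _-_ (∇^-dual y f k x) (∇^-dual y f (suc k) x))
  (lem (∇^ k f (y ℕ.+ x)) (∇^ k f (suc y ℕ.+ x)))
  where
  lem : ∀ a b → a - (a - b) ≡ b
  lem = solve-∀

-- Here the support of f bounds the sum instead of y, which may be far larger than n.
∇^-expand-truncated : ∀ y n f x → (∀ i → f (n ℕ.+ i ℕ.+ x) ≡ + 0) →
                      ∇^ y f x ≡ Σ< n λ i → binom y i * f (i ℕ.+ x)
∇^-expand-truncated y n f x f≡0 = trans
  (∇^-expand y (n ℕ.+ suc y) f x (ℕₚ.m≤n+m (suc y) n))
  (Σ<-truncate n (suc y) (λ i → binom y i * f (i ℕ.+ x)) λ i →
    trans (cong (binom y (n ℕ.+ i) *_) (f≡0 i)) (ℤₚ.*-zeroʳ (binom y (n ℕ.+ i))))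

-- The Leibniz rule: an affine factor has the constant difference -β, so only one correction term
-- appears.
∇^-affine : ∀ k f α β x → ∇^ (suc k) (λ y → (α + β * + y) * f y) x
  ≡ (α + β * + x) * ∇^ (suc k) f x - + suc k * β * ∇^ k f (suc x)
∇^-affine zero f α β x = lem α β (+ x) (f x) (f (suc x))
  where
  lem : ∀ α β x a b → (α + β * x) * a - (α + β * (+ 1 + x)) * b
    ≡ (α + β * x) * (a - b) - + 1 * β * b
  lem = solve-∀
∇^-affine (suc k) f α β x = trans (cong₂ _-_ (∇^-affine k f α β x) (∇^-affine k f α β (suc x)))
  (lem α β (+ x) (+ k) (∇^ k f x) (∇^ k f (1 ℕ.+ x)) (∇^ k f (2 ℕ.+ x)))
  where
  lem : ∀ α β x k a b c →
    (α + β * x) * (a - b) - (+ 1 + k) * β * b - ((α + β * (+ 1 + x)) * (b - c) - (+ 1 + k) * β * c)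
    ≡ (α + β * x) * ((a - b) - (b - c)) - (+ 2 + k) * β * (b - c)
  lem = solve-∀

-- Degree by vanishing differences, which requires no coefficients and is the property that Newton's
-- formula consumes.
Degree<_ : ℕ → (ℕ → ℤ) → Set
(Degree< n) f = ∀ x → ∇^ n f x ≡ + 0

Degree<-affine : ∀ n f α β → (Degree< n) f → (Degree< suc n) (λ y → (α + β * + y) * f y)
Degree<-affine n f α β d x = begin
  ∇^ (suc n) (λ y → (α + β * + y) * f y) x
    ≡⟨ ∇^-affine n f α β x ⟩
  (α + β * + x) * (∇^ n f x - ∇^ n f (suc x)) - + suc n * β * ∇^ n f (suc x)
    ≡⟨ cong₂ (λ a b → (α + β * + x) * (a - b) - + suc n * β * b) (d x) (d (suc x)) ⟩
  (α + β * + x) * + 0 - + suc n * β * + 0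
    ≡⟨ lem (α + β * + x) (+ suc n * β) ⟩
  + 0 ∎
  where
  open ≡-Reasoning
  lem : ∀ a b → a * + 0 - b * + 0 ≡ + 0
  lem = solve-∀

Degree<-mono : ∀ m n f → (Degree< m) f → (Degree< (n ℕ.+ m)) f
Degree<-mono m zero    f d   = d
Degree<-mono m (suc n) f d x = cong₂ _-_ (Degree<-mono m n f d x) (Degree<-mono m n f d (suc x))

^-suc-affine : ∀ n y → (+ y) ^ suc n ≡ (+ 0 + + 1 * + y) * (+ y) ^ n
^-suc-affine n y = cong (_* (+ y) ^ n) (lem (+ y))
  where
  lem : ∀ y → y ≡ + 0 + + 1 * y
  lem = solve-∀

Degree<-^ : ∀ n → (Degree< suc n) (λ x → (+ x) ^ n)
Degree<-^ zero    x = refl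
Degree<-^ (suc n) x = trans (∇^-cong (2 ℕ.+ n) (^-suc-affine n) x)
  (Degree<-affine (suc n) (λ x → (+ x) ^ n) (+ 0) (+ 1) (Degree<-^ n) x)

-- This is (-1)^n n!, the n-th difference of x^n.
leading : ℕ → ℤ
leading zero    = + 1
leading (suc n) = - + suc n * leading n

∇^-^ : ∀ n x → ∇^ n (λ x → (+ x) ^ n) x ≡ leading n
∇^-^ zero    x = refl
∇^-^ (suc n) x = begin
  ∇^ (suc n) (λ x → (+ x) ^ suc n) x
    ≡⟨ ∇^-cong (suc n) (^-suc-affine n) x ⟩
  ∇^ (suc n) (λ x → (+ 0 + + 1 * + x) * (+ x) ^ n) x
    ≡⟨ ∇^-affine n (λ x → (+ x) ^ n) (+ 0) (+ 1) x ⟩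
  (+ 0 + + 1 * + x) * ∇^ (suc n) (λ x → (+ x) ^ n) x - + suc n * + 1 * ∇^ n (λ x → (+ x) ^ n) (suc x)
    ≡⟨ cong₂ (λ a b → (+ 0 + + 1 * + x) * a - + suc n * + 1 * b) (Degree<-^ n x) (∇^-^ n (suc x)) ⟩
  (+ 0 + + 1 * + x) * + 0 - + suc n * + 1 * leading n
    ≡⟨ lem (+ x) (+ suc n) (leading n) ⟩
  - + suc n * leading n ∎
  where
  open ≡-Reasoning
  lem : ∀ x n l → (+ 0 + + 1 * x) * + 0 - n * + 1 * l ≡ - n * l
  lem = solve-∀

δ-refl : ∀ n → δ n n ≡ + 1
δ-refl zero    = refl
δ-refl (suc n) = δ-refl n

δ-≢ : ∀ {m n} → m ≢ n → δ m n ≡ + 0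
δ-≢ {zero}  {zero}  m≢n = contradiction refl m≢n
δ-≢ {zero}  {suc n} m≢n = refl
δ-≢ {suc m} {zero}  m≢n = refl
δ-≢ {suc m} {suc n} m≢n = δ-≢ (m≢n ∘ cong suc)

-- Peel off the top coefficient with a C-th difference.
module Extend (C : ℕ) (I : Interpolation C) where

  open Interpolation I

  top : ℕ → ℤ
  top e = Σ< C λ a → Λ e a * (+ a) ^ C

  -- `Λ e` may take any values from C on; before the point C is added they are set to zero.
  cut : (ℕ → ℤ) → ℕ → ℤ
  cut f a with a ℕ.<? C
  ... | yes _ = f a
  ... | no  _ = + 0

  Σ<-cut : ∀ (f g : ℕ → ℤ) → Σ< (suc C) (λ a → cut f a * g a) ≡ Σ< C (λ a → f a * g a)
  Σ<-cut f g = begin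
    Σ< (suc C) (λ a → cut f a * g a)
      ≡⟨ cong (λ m → Σ< m (λ a → cut f a * g a)) (ℕₚ.+-comm 1 C) ⟩
    Σ< (C ℕ.+ 1) (λ a → cut f a * g a)
      ≡⟨ Σ<-truncate C 1 (λ a → cut f a * g a) (λ i → cong (_* g (C ℕ.+ i)) (cut-≥ i)) ⟩
    Σ< C (λ a → cut f a * g a)
      ≡⟨ sum-cong C (λ i → cong (_* g (toℕ i)) (cut-< (toℕ i) (Finₚ.toℕ<n i))) ⟩
    Σ< C (λ a → f a * g a) ∎
    where
    open ≡-Reasoning
    cut-< : ∀ a → a ℕ.< C → cut f a ≡ f a
    cut-< a a<C with a ℕ.<? C
    ... | yes _   = refl
    ... | no  a≮C = contradiction a<C a≮C
    cut-≥ : ∀ i → cut f (C ℕ.+ i) ≡ + 0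
    cut-≥ i with C ℕ.+ i ℕ.<? C
    ... | yes C+i<C = contradiction C+i<C (ℕₚ.m+n≮m C i)
    ... | no  _     = refl

  -- The C-th difference kills x^n for n < C and sends x^C to `leading C`, so it extracts the new
  -- top coefficient. An old functional is wrong only on x^C, by `top e`; a multiple of the
  -- difference corrects this after scaling by `leading C`, which replaces a division.
  Λ⁺ : ℕ → ℕ → ℤ
  Λ⁺ e a with e ℕ.≟ C
  ... | yes _ = D * binom C a
  ... | no  _ = leading C * cut (Λ e) a + - top e * binom C a

  difference : ℕ → ℤ
  difference n = Σ< (suc C) λ a → binom C a * (+ a) ^ n

  difference-∇ : ∀ n → difference n ≡ ∇^ C (λ x → (+ x) ^ n) 0
  difference-∇ n = trans
    (sum-cong (suc C) λ a → cong (λ m → binom C (toℕ a) * (+ m) ^ n) (sym (ℕₚ.+-identityʳ (toℕ a))))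
    (sym (∇^-expand C (suc C) (λ x → (+ x) ^ n) 0 (ℕₚ.n<1+n C)))

  difference-< : ∀ n → n ℕ.< C → difference n ≡ + 0
  difference-< n n<C = trans (difference-∇ n) (subst (λ m → ∇^ m (λ x → (+ x) ^ n) 0 ≡ + 0)
    (ℕₚ.m∸n+n≡m n<C) (Degree<-mono (suc n) (C ℕ.∸ suc n) (λ x → (+ x) ^ n) (Degree<-^ n) 0))

  difference-C : difference C ≡ leading C
  difference-C = trans (difference-∇ C) (∇^-^ C 0)

  extract⁺ : ∀ e n → e ℕ.< suc C → n ℕ.< suc C →
             Σ< (suc C) (λ a → Λ⁺ e a * (+ a) ^ n) ≡ leading C * D * δ e n
  extract⁺ e n e<1+C n<1+C with e ℕ.≟ C
  ... | yes refl = trans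
    (trans (sum-cong (suc C) λ a → ℤₚ.*-assoc D (binom C (toℕ a)) ((+ toℕ a) ^ n))
           (sym (*-distribˡ-sum {suc C} D (λ a → binom C (toℕ a) * (+ toℕ a) ^ n))))
    (by-n (n ℕ.≟ C))
    where
    by-n : Dec (n ≡ C) → D * difference n ≡ leading C * D * δ C n
    by-n (yes refl) = trans (cong (D *_) difference-C)
      (trans (lem D (leading C)) (cong (leading C * D *_) (sym (δ-refl C))))
      where
      lem : ∀ d l → d * l ≡ l * d * + 1
      lem = solve-∀
    by-n (no n≢C) = trans (cong (D *_) (difference-< n (ℕₚ.≤∧≢⇒< (ℕ.s≤s⁻¹ n<1+C) n≢C)))
      (trans (lem D (leading C)) (cong (leading C * D *_) (sym (δ-≢ (n≢C ∘ sym)))))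
      where
      lem : ∀ d l → d * + 0 ≡ l * d * + 0
      lem = solve-∀
  ... | no e≢C = begin
    Σ< (suc C) (λ a → (leading C * cut (Λ e) a + - top e * binom C a) * (+ a) ^ n)
      ≡⟨ sum-cong (suc C) (λ a → lem (leading C) (cut (Λ e) (toℕ a)) (- top e) (binom C (toℕ a)) ((+ toℕ a) ^ n)) ⟩
    Σ< (suc C) (λ a → leading C * (cut (Λ e) a * (+ a) ^ n) + - top e * (binom C a * (+ a) ^ n))
      ≡⟨ ∑-distrib-+ {suc C} (λ a → leading C * (cut (Λ e) (toℕ a) * (+ toℕ a) ^ n))
                             (λ a → - top e * (binom C (toℕ a) * (+ toℕ a) ^ n)) ⟩
    Σ< (suc C) (λ a → leading C * (cut (Λ e) a * (+ a) ^ n)) + Σ< (suc C) (λ a → - top e * (binom C a * (+ a) ^ n))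
      ≡⟨ cong₂ _+_ (*-distribˡ-sum {suc C} (leading C) (λ a → cut (Λ e) (toℕ a) * (+ toℕ a) ^ n))
                   (*-distribˡ-sum {suc C} (- top e) (λ a → binom C (toℕ a) * (+ toℕ a) ^ n)) ⟨
    leading C * Σ< (suc C) (λ a → cut (Λ e) a * (+ a) ^ n) + - top e * difference n
      ≡⟨ cong (λ z → leading C * z + - top e * difference n) (Σ<-cut (Λ e) (λ a → (+ a) ^ n)) ⟩
    leading C * Σ< C (λ a → Λ e a * (+ a) ^ n) + - top e * difference n
      ≡⟨ by-n (n ℕ.≟ C) ⟩
    leading C * D * δ e n ∎
    where
    open ≡-Reasoning
    lem : ∀ l c t b p → (l * c + t * b) * p ≡ l * (c * p) + t * (b * p)
    lem = solve-∀
    by-n : Dec (n ≡ C) →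
      leading C * Σ< C (λ a → Λ e a * (+ a) ^ n) + - top e * difference n ≡ leading C * D * δ e n
    by-n (yes refl) = trans (cong (λ z → leading C * top e + - top e * z) difference-C)
      (trans (lem₁ (leading C) (top e) D) (cong (leading C * D *_) (sym (δ-≢ e≢C))))
      where
      lem₁ : ∀ l t d → l * t + - t * l ≡ l * d * + 0
      lem₁ = solve-∀
    by-n (no n≢C) = trans
      (cong₂ (λ y z → leading C * y + - top e * z)
        (extract e n (ℕₚ.≤∧≢⇒< (ℕ.s≤s⁻¹ e<1+C) e≢C) n<C) (difference-< n n<C))
      (lem₂ (leading C) (top e) D (δ e n))
      where
      n<C = ℕₚ.≤∧≢⇒< (ℕ.s≤s⁻¹ n<1+C) n≢C
      lem₂ : ∀ l t d x → l * (d * x) + - t * + 0 ≡ l * d * x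
      lem₂ = solve-∀

-- Up to sign the scale is ∏_{k<C} k!, the Vandermonde determinant of the points 0, ..., C - 1, so
-- its prime factors are below C.
interpolation : ∀ C → Interpolation C
interpolation zero    = record { Λ = λ _ _ → + 0 ; D = + 1 ; extract = λ _ _ () }
interpolation (suc C) = record { Λ = Λ⁺ ; D = leading C * Interpolation.D (interpolation C) ; extract = extract⁺ }
  where open Extend C (interpolation C)

-- Progressions and factorials

infixl 7 _⊙_
_⊙_ : ∀ {I n} → Circ I (Fin n) → Circ I (Fin n) → Circ I (Fin n)
_⊙_ {n = n} c c′ = c △ c′ ⟫ vec n λ k → gate mul (reg (inj₁ k)) (reg (inj₂ k))

sem-⊙ : ∀ {I n} (c c′ : Circ I (Fin n)) ρ k → sem (c ⊙ c′) ρ k ≡ sem c ρ k * sem c′ ρ k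
sem-⊙ {n = n} c c′ ρ k = sem-vec n _ _ k

size-⊙ : ∀ {I n} (c c′ : Circ I (Fin n)) → size (c ⊙ c′) ≡ size c ℕ.+ size c′ ℕ.+ n
size-⊙ {n = n} c c′ = cong (size c ℕ.+ size c′ ℕ.+_)
  (trans (size-vec n _) (trans (sum-const n λ _ → refl) (ℕₚ.*-identityʳ n)))

num : ∀ {I} → ℕ → Circ I ⊤
num k = from0 (addmul (+ k) uni)

sem-num : ∀ {I} k (ρ : I → ℤ) → sem (num k) ρ tt ≡ + k
sem-num k ρ = trans (sem-from0 (addmul-adds (+ k) uni) ρ) (ℤₚ.*-identityʳ (+ k))

size-num : ∀ {I} k → size (num {I} k) ≡ k
size-num {I} k = size-addmul {I} (+ k) uni

reversed : ∀ {n} → Circ (Fin n) (Fin n)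
reversed = wire (reg ∘ opposite)

-- Exclusive prefixes: entry k combines the start with the k entries before it, so entry 0 is the
-- start itself.
scan : Op → ∀ n → Circ (⊤ ⊎ Fin n) (Fin n)
scan o zero    = wire λ ()
scan o (suc n) =
  wire (λ (_ : ⊤) → reg (inj₁ tt))
  △ (gate o (reg (inj₁ tt)) (reg (inj₂ zero)) △ wire (λ k → reg (inj₂ (suc k))) ⟫ scan o n)
  ⟫ wire λ { zero → reg (inj₁ tt) ; (suc k) → reg (inj₂ k) }

fold : Op → ℤ → (ℕ → ℤ) → ℕ → ℤ
fold o a x zero    = a
fold o a x (suc k) = fold o (⟦ o ⟧ᵒ a (x 0)) (x ∘ suc) k

sem-scan : ∀ o n ρ x → (∀ k → ρ (inj₂ k) ≡ x (toℕ k)) →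
           ∀ k → sem (scan o n) ρ k ≡ fold o (ρ (inj₁ tt)) x (toℕ k)
sem-scan o (suc n) ρ x e zero    = refl
sem-scan o (suc n) ρ x e (suc k) = trans (sem-scan o n _ (x ∘ suc) (e ∘ suc) k)
  (cong (λ z → fold o (⟦ o ⟧ᵒ (ρ (inj₁ tt)) z) (x ∘ suc) (toℕ k)) (e zero))

size-scan : ∀ o n → size (scan o n) ≡ n
size-scan o zero    = refl
size-scan o (suc n) = trans (ℕₚ.+-identityʳ _) (cong suc (size-scan o n))

Π : ℕ → (ℕ → ℤ) → ℤ
Π zero    f = + 1
Π (suc k) f = f 0 * Π k (f ∘ suc)

Π-cong : ∀ k {f g : ℕ → ℤ} → f ≗ g → Π k f ≡ Π k g
Π-cong zero    e = refl
Π-cong (suc k) e = cong₂ _*_ (e 0) (Π-cong k (e ∘ suc))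

Π-snoc : ∀ k f → Π (suc k) f ≡ Π k f * f k
Π-snoc zero    f = trans (ℤₚ.*-identityʳ (f 0)) (sym (ℤₚ.*-identityˡ (f 0)))
Π-snoc (suc k) f = trans (cong (f 0 *_) (Π-snoc k (f ∘ suc))) (sym (ℤₚ.*-assoc (f 0) _ _))

Π-neg : ∀ k f → Π k (λ l → - f l) ≡ (- + 1) ^ k * Π k f
Π-neg zero    f = refl
Π-neg (suc k) f = trans (cong (- f 0 *_) (Π-neg k (f ∘ suc))) (lem (f 0) ((- + 1) ^ k) (Π k (f ∘ suc)))
  where
  lem : ∀ a s p → - a * (s * p) ≡ (- + 1 * s) * (a * p)
  lem = solve-∀

fold-mul : ∀ k a x → fold mul a x k ≡ a * Π k x
fold-mul zero    a x = sym (ℤₚ.*-identityʳ a)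
fold-mul (suc k) a x = trans (fold-mul k (a * x 0) (x ∘ suc)) (ℤₚ.*-assoc a (x 0) _)

fold-add : ∀ k a s → fold add a (λ _ → s) k ≡ a + + k * s
fold-add zero    a s = sym (ℤₚ.+-identityʳ a)
fold-add (suc k) a s = trans (fold-add k (a + s) s) (lem a s (+ k))
  where
  lem : ∀ a s k → a + s + k * s ≡ a + (+ 1 + k) * s
  lem = solve-∀

fold-sub : ∀ k a s → fold sub a (λ _ → s) k ≡ a - + k * s
fold-sub zero    a s = sym (ℤₚ.+-identityʳ a)
fold-sub (suc k) a s = trans (fold-sub k (a - s) s) (lem a s (+ k))
  where
  lem : ∀ a s k → a - s - k * s ≡ a - (+ 1 + k) * s
  lem = solve-∀

progression : ∀ {I} → Op → ∀ n → (start step : Src I) → Circ I (Fin n)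
progression o n start step = wire [ (λ _ → start) , (λ _ → step) ] ⟫ scan o n

sem-progression : ∀ {I} o n (a s : Src I) ρ k →
                  sem (progression o n a s) ρ k ≡ fold o (read ρ a) (λ _ → read ρ s) (toℕ k)
sem-progression o n a s ρ = sem-scan o n _ (λ _ → read ρ s) (λ _ → refl)

-- As prefix products, all n factorial powers together take 2 n gates; separately they would take
-- quadratically many.
factors : ∀ {I} → Op → ∀ n → Src I → Circ I (Fin n)
factors o n a = progression o n a uni ⟫ wire [ (λ _ → uni) , reg ] ⟫ scan mul n

size-factors : ∀ {I} o n (a : Src I) → size (factors o n a) ≡ n ℕ.+ n
size-factors o n a = cong₂ ℕ._+_ (trans (ℕₚ.+-identityʳ _) (size-scan o n)) (size-scan mul n)

sem-factors : ∀ {I} o n (a : Src I) ρ k →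
              sem (factors o n a) ρ k ≡ Π (toℕ k) (fold o (read ρ a) (λ _ → + 1))
sem-factors o n a ρ k = trans
  (sem-scan mul n _ (fold o (read ρ a) (λ _ → + 1)) (sem-progression o n a uni ρ) k)
  (trans (fold-mul (toℕ k) (+ 1) _) (ℤₚ.*-identityˡ _))

rising falling : ℤ → ℕ → ℤ
rising  a k = Π k λ l → a + + l
falling a k = Π k λ l → a - + l

sem-rising : ∀ {I} n (a : Src I) ρ k → sem (factors add n a) ρ k ≡ rising (read ρ a) (toℕ k)
sem-rising n a ρ k = trans (sem-factors add n a ρ k) (Π-cong (toℕ k) λ l →
  trans (fold-add l (read ρ a) (+ 1)) (cong (λ z → read ρ a + z) (ℤₚ.*-identityʳ (+ l))))

sem-falling : ∀ {I} n (a : Src I) ρ k → sem (factors sub n a) ρ k ≡ falling (read ρ a) (toℕ k)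
sem-falling n a ρ k = trans (sem-factors sub n a ρ k) (Π-cong (toℕ k) λ l →
  trans (fold-sub l (read ρ a) (+ 1)) (cong (λ z → read ρ a - z) (ℤₚ.*-identityʳ (+ l))))

fact : ℕ → ℤ
fact = rising (+ 1)

fact-suc : ∀ k → fact (suc k) ≡ fact k * + suc k
fact-suc k = Π-snoc k λ l → + 1 + + l

fact-! : ∀ k → fact k ≡ + (k !)
fact-! zero    = refl
fact-! (suc k) = trans (fact-suc k) (trans (cong (_* + suc k) (fact-! k))
  (trans (sym (ℤₚ.pos-* (k !) (suc k))) (cong +_ (ℕₚ.*-comm (k !) (suc k)))))

-- With t + k = e the falling product is e! / k!. It stands in for 1 / k!, the factor e! being the
-- same for all k.
falling-fact : ∀ t k → falling (+ (t ℕ.+ k)) t * fact k ≡ fact (t ℕ.+ k)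
falling-fact zero    k = ℤₚ.*-identityˡ (fact k)
falling-fact (suc t) k = begin
  (+ suc (t ℕ.+ k) - + 0) * Π t (λ l → + suc (t ℕ.+ k) - + suc l) * fact k
    ≡⟨ cong (λ p → (+ suc (t ℕ.+ k) - + 0) * p * fact k) (Π-cong t λ l → lem₁ (+ (t ℕ.+ k)) (+ l)) ⟩
  (+ suc (t ℕ.+ k) - + 0) * falling (+ (t ℕ.+ k)) t * fact k
    ≡⟨ lem₂ (+ suc (t ℕ.+ k)) (falling (+ (t ℕ.+ k)) t) (fact k) ⟩
  falling (+ (t ℕ.+ k)) t * fact k * + suc (t ℕ.+ k)
    ≡⟨ cong (_* + suc (t ℕ.+ k)) (falling-fact t k) ⟩
  fact (t ℕ.+ k) * + suc (t ℕ.+ k)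
    ≡⟨ fact-suc (t ℕ.+ k) ⟨
  fact (suc t ℕ.+ k) ∎
  where
  open ≡-Reasoning
  lem₁ : ∀ m l → (+ 1 + m) - (+ 1 + l) ≡ m - l
  lem₁ = solve-∀
  lem₂ : ∀ a b c → (a - + 0) * b * c ≡ b * c * a
  lem₂ = solve-∀

rising-neg : ∀ a t → rising (- a) t ≡ (- + 1) ^ t * falling a t
rising-neg a t = trans (Π-cong t λ l → lem a (+ l)) (Π-neg t λ l → a - + l)
  where
  lem : ∀ a l → - a + l ≡ - (a - l)
  lem = solve-∀

rising-fact : ∀ t k → rising (- + (t ℕ.+ k)) t * fact k ≡ (- + 1) ^ t * fact (t ℕ.+ k)
rising-fact t k = trans (cong (_* fact k) (rising-neg (+ (t ℕ.+ k)) t))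
  (trans (ℤₚ.*-assoc ((- + 1) ^ t) _ (fact k)) (cong ((- + 1) ^ t *_) (falling-fact t k)))

-- The sign (-1)^i is distributed over the i factors of y (y - 1) ⋯ (y - i + 1), so that no separate
-- sign has to be computed.
binom-fact : ∀ y i → binom y i * fact i ≡ rising (- + y) i
binom-fact zero    zero    = refl
binom-fact (suc y) zero    = refl
binom-fact zero    (suc i) = refl
binom-fact (suc y) (suc i) = begin
  (binom y (suc i) - binom y i) * fact (suc i)
    ≡⟨ ℤₚ.*-distribʳ-+ (fact (suc i)) (binom y (suc i)) (- binom y i) ⟩
  binom y (suc i) * fact (suc i) + - binom y i * fact (suc i)
    ≡⟨ cong₂ _+_ (trans (binom-fact y (suc i)) (Π-snoc i λ l → - + y + + l)) (cong (- binom y i *_) (fact-suc i)) ⟩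
  rising (- + y) i * (- + y + + i) + - binom y i * (fact i * + suc i)
    ≡⟨ lem₁ (rising (- + y) i * (- + y + + i)) (binom y i) (fact i) (+ suc i) ⟩
  rising (- + y) i * (- + y + + i) - binom y i * fact i * + suc i
    ≡⟨ cong (λ p → rising (- + y) i * (- + y + + i) - p * + suc i) (binom-fact y i) ⟩
  rising (- + y) i * (- + y + + i) - rising (- + y) i * + suc i
    ≡⟨ lem₂ (rising (- + y) i) (+ y) (+ i) ⟩
  (- + suc y + + 0) * rising (- + y) i
    ≡⟨ cong (λ p → (- + suc y + + 0) * p) (Π-cong i λ l → lem₃ (+ y) (+ l)) ⟩
  rising (- + suc y) (suc i) ∎
  where
  open ≡-Reasoning
  lem₁ : ∀ p b f i → p + - b * (f * i) ≡ p - b * f * i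
  lem₁ = solve-∀
  lem₂ : ∀ p y i → p * (- y + i) - p * (+ 1 + i) ≡ (- (+ 1 + y) + + 0) * p
  lem₂ = solve-∀
  lem₃ : ∀ y l → - y + l ≡ - (+ 1 + y) + (+ 1 + l)
  lem₃ = solve-∀

-- Translation of polynomials

fact-nonZero : ∀ k → ℤ.NonZero (fact k)
fact-nonZero k = subst ℤ.NonZero (sym (fact-! k)) (k ℕₚ.!≢0)

square-sign : ∀ n → (- + 1) ^ n * (- + 1) ^ n ≡ + 1
square-sign zero    = refl
square-sign (suc n) = trans (lem ((- + 1) ^ n)) (square-sign n)
  where
  lem : ∀ s → (- + 1 * s) * (- + 1 * s) ≡ s * s
  lem = solve-∀

-- The signed (i + j)! / (i! j!) factors into a function of i, one of j and one of i + j; this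
-- separation makes the difference matrix a convolution. The proof multiplies by i! j! and cancels
-- in ℤ.
binom-scaled : ∀ e i j → i ℕ.+ j ℕ.≤ e →
  rising (- + e) (e ℕ.∸ i) * falling (+ e) (e ℕ.∸ j) * fact (i ℕ.+ j)
  ≡ (- + 1) ^ e * (fact e * fact e) * binom (i ℕ.+ j) i
binom-scaled e i j i+j≤e =
  ℤₚ.*-cancelʳ-≡ _ _ (fact i) {{fact-nonZero i}} (ℤₚ.*-cancelʳ-≡ _ _ (fact j) {{fact-nonZero j}} (begin
    φ′ * φ * fact (i ℕ.+ j) * fact i * fact j
      ≡⟨ lem₁ φ′ φ (fact (i ℕ.+ j)) (fact i) (fact j) ⟩
    (φ′ * fact i) * (φ * fact j) * fact (i ℕ.+ j)
      ≡⟨ cong₂ (λ x y → x * y * fact (i ℕ.+ j)) φ′-fact φ-fact ⟩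
    (σ t * fact e) * fact e * fact (i ℕ.+ j)
      ≡⟨ lem₂ (σ t) (fact e) (fact (i ℕ.+ j)) ⟩
    σ t * + 1 * (fact e * fact e) * fact (i ℕ.+ j)
      ≡⟨ cong (λ z → σ t * z * (fact e * fact e) * fact (i ℕ.+ j)) (square-sign i) ⟨
    σ t * (σ i * σ i) * (fact e * fact e) * fact (i ℕ.+ j)
      ≡⟨ lem₃ (σ t) (σ i) (fact e * fact e) (fact (i ℕ.+ j)) ⟩
    (σ t * σ i) * (fact e * fact e) * (σ i * fact (i ℕ.+ j))
      ≡⟨ cong₂ (λ x y → x * (fact e * fact e) * y) sign-e (sym binom-fact₂) ⟩
    σ e * (fact e * fact e) * (binom (i ℕ.+ j) i * fact i * fact j)
      ≡⟨ lem₄ (σ e * (fact e * fact e)) (binom (i ℕ.+ j) i) (fact i) (fact j) ⟩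
    σ e * (fact e * fact e) * binom (i ℕ.+ j) i * fact i * fact j ∎))
  where
  open ≡-Reasoning
  σ : ℕ → ℤ
  σ n = (- + 1) ^ n
  t = e ℕ.∸ i
  φ′ = rising (- + e) t
  φ = falling (+ e) (e ℕ.∸ j)
  t+i : t ℕ.+ i ≡ e
  t+i = ℕₚ.m∸n+n≡m (ℕₚ.≤-trans (ℕₚ.m≤m+n i j) i+j≤e)
  φ′-fact : φ′ * fact i ≡ σ t * fact e
  φ′-fact = subst (λ e → rising (- + e) t * fact i ≡ σ t * fact e) t+i (rising-fact t i)
  φ-fact : φ * fact j ≡ fact e
  φ-fact = subst (λ m → falling (+ m) (e ℕ.∸ j) * fact j ≡ fact m)
    (ℕₚ.m∸n+n≡m (ℕₚ.≤-trans (ℕₚ.m≤n+m j i) i+j≤e)) (falling-fact (e ℕ.∸ j) j)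
  sign-e : σ t * σ i ≡ σ e
  sign-e = trans (sym (ℤₚ.^-distribˡ-+-* (- + 1) t i)) (cong σ t+i)
  binom-fact₂ : binom (i ℕ.+ j) i * fact i * fact j ≡ σ i * fact (i ℕ.+ j)
  binom-fact₂ = trans (cong (_* fact j) (binom-fact (i ℕ.+ j) i)) (rising-fact i j)
  lem₁ : ∀ a b c x y → a * b * c * x * y ≡ (a * x) * (b * y) * c
  lem₁ = solve-∀
  lem₂ : ∀ s e k → (s * e) * e * k ≡ s * + 1 * (e * e) * k
  lem₂ = solve-∀
  lem₃ : ∀ s i e k → s * (i * i) * e * k ≡ (s * i) * e * (i * k)
  lem₃ = solve-∀
  lem₄ : ∀ c b i j → c * (b * i * j) ≡ c * b * i * j
  lem₄ = solve-∀

opposite-∸ : ∀ {e} (k : Fin (suc e)) → toℕ (opposite k) ≡ e ℕ.∸ toℕ k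
opposite-∸ k = Finₚ.opposite-prop k

toℕ≤e : ∀ {e} (k : Fin (suc e)) → toℕ k ℕ.≤ e
toℕ≤e k = ℕ.s≤s⁻¹ (Finₚ.toℕ<n k)

module Transform (B C : ℕ) (B+B≤C : B ℕ.+ B ℕ.≤ C) .{{_ : NonZero C}} (I : Interpolation C)
                 (e s : ℕ) (n≤B^s : suc e ℕ.≤ B ℕ.^ s) where

  open Interpolation I using (D)
  open Convolution B C B+B≤C I

  private n = suc e

  -- Entry k is e! / k!, in the second case with the sign (-1)^(e - k). The prefix products give e!
  -- / (e - k)! at k, whence the reversal.
  falling-facts rising-facts : ∀ {J} → Circ J (Fin n)
  falling-facts = num e ⟫ factors sub n (reg tt) ⟫ reversed
  rising-facts  = num e ⟫ gate sub zer (reg tt) ⟫ factors add n (reg tt) ⟫ reversed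

  sem-falling-facts : ∀ {J} (ρ : J → ℤ) k → sem falling-facts ρ k ≡ falling (+ e) (e ℕ.∸ toℕ k)
  sem-falling-facts ρ k = trans (sem-falling n (reg tt) (sem (num e) ρ) (opposite k))
    (cong₂ falling (sem-num e ρ) (opposite-∸ k))

  sem-rising-facts : ∀ {J} (ρ : J → ℤ) k → sem rising-facts ρ k ≡ rising (- + e) (e ℕ.∸ toℕ k)
  sem-rising-facts ρ k = trans (sem-rising n (reg tt) (sem (num e ⟫ gate sub zer (reg tt)) ρ) (opposite k))
    (cong₂ rising (trans (ℤₚ.+-identityˡ _) (cong -_ (sem-num e ρ))) (opposite-∸ k))

  facts : ∀ {J} → Circ J (Fin n)
  facts = factors add n uni

  -- Up to scale, ∇^k u 0 = k! · Σ_{i+j=k} ((-1)^i u i / i!) · (1 / j!). The sign used is (-1)^(e -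
  -- i), which leaves (-1)^e in the scale.
  differences : ∀ {J} → Circ J (Fin n) → Circ J (Fin n)
  differences x = ((x ⊙ rising-facts) △ falling-facts ⟫ convolve n s) ⊙ facts

  differences-scale : ℤ
  differences-scale = D ^ s * ((- + 1) ^ e * (fact e * fact e))

  sem-differences : ∀ {J} (x : Circ J (Fin n)) ρ u → (∀ k → sem x ρ k ≡ u (toℕ k)) →
    ∀ k → sem (differences x) ρ k ≡ differences-scale * ∇^ (toℕ k) u 0
  sem-differences x ρ u x≡u k = begin
    sem (differences x) ρ k
      ≡⟨ sem-⊙ ((x ⊙ rising-facts) △ falling-facts ⟫ convolve n s) facts ρ k ⟩
    sem (convolve n s) σ k * sem facts ρ k
      ≡⟨ cong₂ _*_ (sem-convolve n s n≤B^s σ k) (sem-rising n uni ρ k) ⟩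
    D ^ s * sum (λ i → sum λ j → δ (toℕ i ℕ.+ toℕ j) K * (σ (inj₁ i) * σ (inj₂ j))) * fact K
      ≡⟨ cong (λ z → D ^ s * z * fact K) (sum-cong n λ i → sum-cong n λ j → cong (δ (toℕ i ℕ.+ toℕ j) K *_)
           (cong₂ _*_ (trans (sem-⊙ x rising-facts ρ i) (cong₂ _*_ (x≡u i) (sem-rising-facts ρ i)))
                      (sem-falling-facts ρ j))) ⟩
    D ^ s * Σ< n (λ i → Σ< n λ j → δ (i ℕ.+ j) K * (u i * φ′ i * φ j)) * fact K
      ≡⟨ trans (ℤₚ.*-assoc (D ^ s) _ (fact K)) (cong (D ^ s *_) (trans
           (*-distribʳ-sum {n} (fact K) (λ i → Σ< n λ j → δ (toℕ i ℕ.+ j) K * (u (toℕ i) * φ′ (toℕ i) * φ j)))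
           (sum-cong n λ i → trans
             (*-distribʳ-sum {n} (fact K) (λ j → δ (toℕ i ℕ.+ toℕ j) K * (u (toℕ i) * φ′ (toℕ i) * φ (toℕ j))))
             (sum-cong n λ j → ℤₚ.*-assoc (δ (toℕ i ℕ.+ toℕ j) K) (u (toℕ i) * φ′ (toℕ i) * φ (toℕ j)) (fact K))))) ⟩
    D ^ s * Σ< n (λ i → Σ< n λ j → δ (i ℕ.+ j) K * (u i * φ′ i * φ j * fact K))
      ≡⟨ cong (D ^ s *_) (Σ<-convolve n K (λ i j → u i * φ′ i * φ j * fact K) (λ i → c * (binom K i * u i))
           (Finₚ.toℕ<n k) diagonal beyond) ⟩
    D ^ s * Σ< n (λ i → c * (binom K i * u i))
      ≡⟨ cong (D ^ s *_) (*-distribˡ-sum {n} c (λ i → binom K (toℕ i) * u (toℕ i))) ⟨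
    D ^ s * (c * Σ< n (λ i → binom K i * u i))
      ≡⟨ ℤₚ.*-assoc (D ^ s) c _ ⟨
    differences-scale * Σ< n (λ i → binom K i * u i)
      ≡⟨ cong (differences-scale *_) (sum-cong n λ i → cong (λ m → binom K (toℕ i) * u m) (sym (ℕₚ.+-identityʳ (toℕ i)))) ⟩
    differences-scale * Σ< n (λ i → binom K i * u (i ℕ.+ 0))
      ≡⟨ cong (differences-scale *_) (∇^-expand K n u 0 (Finₚ.toℕ<n k)) ⟨
    differences-scale * ∇^ K u 0 ∎
    where
    open ≡-Reasoning
    K = toℕ k
    σ = sem ((x ⊙ rising-facts) △ falling-facts) ρ
    c = (- + 1) ^ e * (fact e * fact e)
    φ φ′ : ℕ → ℤ
    φ  j = falling (+ e) (e ℕ.∸ j)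
    φ′ i = rising (- + e) (e ℕ.∸ i)
    diagonal : ∀ i j → i ℕ.+ j ≡ K → u i * φ′ i * φ j * fact K ≡ c * (binom K i * u i)
    diagonal i j i+j≡K = begin
      u i * φ′ i * φ j * fact K           ≡⟨ lem₁ (u i) (φ′ i) (φ j) (fact K) ⟩
      u i * (φ′ i * φ j * fact K)         ≡⟨ cong (λ m → u i * (φ′ i * φ j * fact m)) i+j≡K ⟨
      u i * (φ′ i * φ j * fact (i ℕ.+ j)) ≡⟨ cong (u i *_) (binom-scaled e i j (subst (ℕ._≤ e) (sym i+j≡K) (toℕ≤e k))) ⟩
      u i * (c * binom (i ℕ.+ j) i)       ≡⟨ cong (λ m → u i * (c * binom m i)) i+j≡K ⟩
      u i * (c * binom K i)               ≡⟨ lem₂ (u i) c (binom K i) ⟩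
      c * (binom K i * u i)               ∎
      where
      lem₁ : ∀ u a b c → u * a * b * c ≡ u * (a * b * c)
      lem₁ = solve-∀
      lem₂ : ∀ u a b → u * (a * b) ≡ a * (b * u)
      lem₂ = solve-∀
    beyond : ∀ i → K ℕ.< i → c * (binom K i * u i) ≡ + 0
    beyond i K<i = trans (cong (λ z → c * (z * u i)) (binom-zero K i K<i)) (ℤₚ.*-zeroʳ c)

  -- The rising product of -a is k! · `binom a k`, and e! / k! replaces k! by the constant e!. The
  -- distance a may exceed n.
  weights : ∀ {J} → Circ J ⊤ → Circ J (Fin n)
  weights A = (A ⟫ gate sub zer (reg tt) ⟫ factors add n (reg tt)) ⊙ falling-facts

  sem-weights : ∀ {J} (A : Circ J ⊤) ρ a → sem A ρ tt ≡ + a →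
                ∀ k → sem (weights A) ρ k ≡ fact e * binom a (toℕ k)
  sem-weights A ρ a A≡a k = begin
    sem (weights A) ρ k
      ≡⟨ sem-⊙ (A ⟫ gate sub zer (reg tt) ⟫ factors add n (reg tt)) falling-facts ρ k ⟩
    sem (factors add n (reg tt)) (sem (A ⟫ gate sub zer (reg tt)) ρ) k * sem falling-facts ρ k
      ≡⟨ cong₂ _*_ (trans (sem-rising n (reg tt) (sem (A ⟫ gate sub zer (reg tt)) ρ) k)
           (cong (λ z → rising z K) (trans (ℤₚ.+-identityˡ _) (cong -_ A≡a)))) (sem-falling-facts ρ k) ⟩
    rising (- + a) K * falling (+ e) (e ℕ.∸ K)
      ≡⟨ cong (_* falling (+ e) (e ℕ.∸ K)) (binom-fact a K) ⟨
    binom a K * fact K * falling (+ e) (e ℕ.∸ K)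
      ≡⟨ lem (binom a K) (fact K) (falling (+ e) (e ℕ.∸ K)) ⟩
    falling (+ e) (e ℕ.∸ K) * fact K * binom a K
      ≡⟨ cong (_* binom a K) (subst (λ m → falling (+ m) (e ℕ.∸ K) * fact K ≡ fact m)
           (ℕₚ.m∸n+n≡m (toℕ≤e k)) (falling-fact (e ℕ.∸ K) K)) ⟩
    fact e * binom a K ∎
    where
    open ≡-Reasoning
    K = toℕ k
    lem : ∀ b f g → b * f * g ≡ g * f * b
    lem = solve-∀

  -- ∇^a u at k is the correlation Σ_i `binom a i` · u (i + k). Reversing u makes it a convolution,
  -- read off at e - k.
  shift : ∀ {J} → Circ J ⊤ → Circ J (Fin n) → Circ J (Fin n)
  shift A x = weights A △ (x ⟫ reversed) ⟫ convolve n s ⟫ reversed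

  shift-scale : ℤ
  shift-scale = D ^ s * fact e

  sem-shift : ∀ {J} (A : Circ J ⊤) (x : Circ J (Fin n)) ρ a u → sem A ρ tt ≡ + a →
    (∀ k → sem x ρ k ≡ u (toℕ k)) → (∀ m → e ℕ.< m → u m ≡ + 0) →
    ∀ k → sem (shift A x) ρ k ≡ shift-scale * ∇^ a u (toℕ k)
  sem-shift A x ρ a u A≡a x≡u u≡0 k = begin
    sem (convolve n s) σ (opposite k)
      ≡⟨ sem-convolve n s n≤B^s σ (opposite k) ⟩
    D ^ s * sum (λ i → sum λ j → δ (toℕ i ℕ.+ toℕ j) (toℕ (opposite k)) * (σ (inj₁ i) * σ (inj₂ j)))
      ≡⟨ cong (D ^ s *_) (sum-cong n λ i → sum-cong n λ j →
           cong₂ (λ d y → δ (toℕ i ℕ.+ toℕ j) d * y) (opposite-∸ k)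
             (cong₂ _*_ (sem-weights A ρ a A≡a i) (trans (x≡u (opposite j)) (cong u (opposite-∸ j))))) ⟩
    D ^ s * Σ< n (λ i → Σ< n λ j → δ (i ℕ.+ j) (e ℕ.∸ K) * (fact e * binom a i * u (e ℕ.∸ j)))
      ≡⟨ cong (D ^ s *_) (Σ<-convolve n (e ℕ.∸ K) (λ i j → fact e * binom a i * u (e ℕ.∸ j))
           (λ i → fact e * (binom a i * u (i ℕ.+ K))) (ℕ.s≤s (ℕₚ.m∸n≤m e K)) diagonal beyond) ⟩
    D ^ s * Σ< n (λ i → fact e * (binom a i * u (i ℕ.+ K)))
      ≡⟨ cong (D ^ s *_) (*-distribˡ-sum {n} (fact e) (λ i → binom a (toℕ i) * u (toℕ i ℕ.+ K))) ⟨
    D ^ s * (fact e * Σ< n (λ i → binom a i * u (i ℕ.+ K)))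
      ≡⟨ ℤₚ.*-assoc (D ^ s) (fact e) _ ⟨
    shift-scale * Σ< n (λ i → binom a i * u (i ℕ.+ K))
      ≡⟨ cong (shift-scale *_) (∇^-expand-truncated a n u K λ i →
           u≡0 (n ℕ.+ i ℕ.+ K) (ℕ.s≤s (ℕₚ.≤-trans (ℕₚ.m≤m+n e i) (ℕₚ.m≤m+n (e ℕ.+ i) K)))) ⟨
    shift-scale * ∇^ a u K ∎
    where
    open ≡-Reasoning
    K = toℕ k
    σ = sem (weights A △ (x ⟫ reversed)) ρ
    diagonal : ∀ i j → i ℕ.+ j ≡ e ℕ.∸ K →
      fact e * binom a i * u (e ℕ.∸ j) ≡ fact e * (binom a i * u (i ℕ.+ K))
    diagonal i j h = trans (ℤₚ.*-assoc (fact e) (binom a i) _)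
      (cong (λ m → fact e * (binom a i * u m)) (trans (cong (ℕ._∸ j) e-eq) (ℕₚ.m+n∸n≡m (i ℕ.+ K) j)))
      where
      e-eq : e ≡ i ℕ.+ K ℕ.+ j
      e-eq = trans (sym (ℕₚ.m∸n+n≡m (toℕ≤e k))) (trans (cong (ℕ._+ K) (sym h)) (lem i j K))
        where
        lem : ∀ i j k → i ℕ.+ j ℕ.+ k ≡ i ℕ.+ k ℕ.+ j
        lem = ℕ-Solver.solve-∀
    beyond : ∀ i → e ℕ.∸ K ℕ.< i → fact e * (binom a i * u (i ℕ.+ K)) ≡ + 0
    beyond i h = trans (cong (λ z → fact e * (binom a i * z)) (u≡0 (i ℕ.+ K) e<i+K))
      (trans (cong (fact e *_) (ℤₚ.*-zeroʳ (binom a i))) (ℤₚ.*-zeroʳ (fact e)))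
      where
      e<i+K : e ℕ.< i ℕ.+ K
      e<i+K = subst (ℕ._< i ℕ.+ K) (ℕₚ.m∸n+n≡m (toℕ≤e k)) (ℕₚ.+-monoˡ-< K h)

  -- From û l = ∇^l u 0 the middle step makes ∇^l u a, the Newton data at a; the involution then
  -- returns the values u (k + a).
  translate : ∀ {J} → Circ J ⊤ → Circ J (Fin n) → Circ J (Fin n)
  translate A x = differences (shift A (differences x))

  translate-scale : ℤ
  translate-scale = differences-scale * (shift-scale * differences-scale)

  sem-translate : ∀ {J} (A : Circ J ⊤) (x : Circ J (Fin n)) ρ a u → sem A ρ tt ≡ + a →
    (∀ k → sem x ρ k ≡ u (toℕ k)) → (∀ m → e ℕ.< m → ∇^ m u 0 ≡ + 0) →
    ∀ k → sem (translate A x) ρ k ≡ translate-scale * u (toℕ k ℕ.+ a)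
  sem-translate A x ρ a u A≡a x≡u u-degree k = begin
    sem (translate A x) ρ k
      ≡⟨ sem-differences (shift A (differences x)) ρ v shifted k ⟩
    c * ∇^ K v 0
      ≡⟨ cong (c *_) (∇^-scale K (c′ * c) (λ l → ∇^ l u a) 0) ⟩
    c * (c′ * c * ∇^ K (λ l → ∇^ l u a) 0)
      ≡⟨ cong (λ z → c * (c′ * c * z)) (∇^-dual K u 0 a) ⟩
    c * (c′ * c * u (K ℕ.+ a))
      ≡⟨ ℤₚ.*-assoc c (c′ * c) _ ⟨
    translate-scale * u (K ℕ.+ a) ∎
    where
    open ≡-Reasoning
    K = toℕ k
    c = differences-scale
    c′ = shift-scale
    û : ℕ → ℤ
    û m = c * ∇^ m u 0
    v : ℕ → ℤ
    v l = c′ * c * ∇^ l u a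
    shifted : ∀ l → sem (shift A (differences x)) ρ l ≡ v (toℕ l)
    shifted l = begin
      sem (shift A (differences x)) ρ l
        ≡⟨ sem-shift A (differences x) ρ a û A≡a (sem-differences x ρ u x≡u)
             (λ m e<m → trans (cong (c *_) (u-degree m e<m)) (ℤₚ.*-zeroʳ c)) l ⟩
      c′ * ∇^ a û (toℕ l)
        ≡⟨ cong (c′ *_) (∇^-scale a c (λ m → ∇^ m u 0) (toℕ l)) ⟩
      c′ * (c * ∇^ a (λ m → ∇^ m u 0) (toℕ l))
        ≡⟨ cong (λ z → c′ * (c * z)) (trans (∇^-dual a u (toℕ l) 0) (cong (∇^ (toℕ l) u) (ℕₚ.+-identityʳ a))) ⟩
      c′ * (c * ∇^ (toℕ l) u a)
        ≡⟨ ℤₚ.*-assoc c′ c _ ⟨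
      v (toℕ l) ∎

-- Products of arithmetic progressions

Π-split : ∀ h k f → Π (h ℕ.+ k) f ≡ Π h f * Π k (f ∘ (h ℕ.+_))
Π-split zero    k f = sym (ℤₚ.*-identityˡ _)
Π-split (suc h) k f = trans (cong (f 0 *_) (Π-split h k (f ∘ suc))) (sym (ℤₚ.*-assoc (f 0) _ _))

data Half : ℕ → Set where
  even : ∀ h → Half (h ℕ.+ h)
  odd  : ∀ h → Half (suc (h ℕ.+ h))

halve : ∀ k → Half k
halve zero    = even 0
halve (suc k) with halve k
... | even h = odd h
... | odd h  = subst Half (cong suc (ℕₚ.+-suc h h)) (even (suc h))

data Input : Set where
  mᵢ rᵢ : Input

var : ∀ {I} → I → Circ I ⊤
var i = wire λ _ → reg i

op₂ : ∀ {I} → Op → Circ I ⊤ → Circ I ⊤ → Circ I ⊤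
op₂ o c c′ = c △ c′ ⟫ gate o (reg (inj₁ tt)) (reg (inj₂ tt))

arithmetic : ∀ {I} n → Circ I ⊤ → Circ I ⊤ → Circ I (Fin n)
arithmetic n c c′ = c △ c′ ⟫ progression add n (reg (inj₁ tt)) (reg (inj₂ tt))

sem-arithmetic : ∀ {I} n (c c′ : Circ I ⊤) ρ k →
                 sem (arithmetic n c c′) ρ k ≡ sem c ρ tt + + toℕ k * sem c′ ρ tt
sem-arithmetic n c c′ ρ k = trans (sem-progression add n _ _ (sem (c △ c′) ρ) k) (fold-add (toℕ k) _ _)

size-arithmetic : ∀ {I} n (c c′ : Circ I ⊤) → size (arithmetic n c c′) ≡ size c ℕ.+ size c′ ℕ.+ n
size-arithmetic n c c′ = cong (size c ℕ.+ size c′ ℕ.+_) (size-scan add n)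

module Blocks (n : ℕ) (m r : ℤ) where

  term : ℕ → ℕ → ℤ
  term x j = r + m * + (x ℕ.+ j ℕ.* n)

  block : ℕ → ℕ → ℤ
  block k x = Π k (term x)

  block-double : ∀ h x → block (h ℕ.+ h) x ≡ block h x * block h (x ℕ.+ h ℕ.* n)
  block-double h x = trans (Π-split h h (term x)) (cong (block h x *_)
    (Π-cong h λ j → cong (λ y → r + m * + y) (lem x h j n)))
    where
    lem : ∀ x h j n → x ℕ.+ (h ℕ.+ j) ℕ.* n ≡ x ℕ.+ h ℕ.* n ℕ.+ j ℕ.* n
    lem = ℕ-Solver.solve-∀

  term-affine : ∀ x k → term x k ≡ r + m * (+ k * + n) + m * + x
  term-affine x k = trans (cong (λ z → r + m * (+ x + z)) (ℤₚ.pos-* k n)) (lem r m (+ x) (+ k * + n))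
    where
    lem : ∀ r m x k → r + m * (x + k) ≡ r + m * k + m * x
    lem = solve-∀

  -- Each of the k factors is affine in x and raises the degree by at most one.
  block-degree : ∀ k → (Degree< suc k) (block k)
  block-degree zero    x = refl
  block-degree (suc k) x = trans
    (∇^-cong (2 ℕ.+ k) (λ y → trans (Π-snoc k (term y)) (trans (ℤₚ.*-comm (block k y) (term y k))
      (cong (_* block k y) (term-affine y k)))) x)
    (Degree<-affine (suc k) (block k) (r + m * (+ k * + n)) m (block-degree k) x)

module Products (B C : ℕ) (B+B≤C : B ℕ.+ B ℕ.≤ C) .{{_ : NonZero C}} (I : Interpolation C)
                (e s : ℕ) (n≤B^s : suc e ℕ.≤ B ℕ.^ s) where

  open Convolution B C B+B≤C I
  open Transform B C B+B≤C I e s n≤B^s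

  private n = suc e

  size-differences : ∀ {J} (x : Circ J (Fin n)) →
    size (differences x) ℕ.≤ size x ℕ.+ size (convolve n s) ℕ.+ 10 ℕ.* n
  size-differences {J} x = ℕₚ.≤-trans (ℕₚ.≤-reflexive eq)
    (ℕₚ.≤-trans (ℕₚ.n≤1+n _) (ℕₚ.≤-reflexive (slack X U e)))
    where
    X = size x
    U = size (convolve n s)
    eq : size (differences x) ≡ X ℕ.+ U ℕ.+ (9 ℕ.+ 10 ℕ.* e)
    eq = trans (size-⊙ ((x ⊙ rising-facts) △ falling-facts ⟫ convolve n s) facts)
      (trans (cong₂ (λ a b → a ℕ.+ b ℕ.+ n)
        (cong (ℕ._+ U) (cong₂ ℕ._+_
          (trans (size-⊙ x rising-facts) (cong (λ a → X ℕ.+ a ℕ.+ n)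
            (cong₂ (λ a b → a ℕ.+ 1 ℕ.+ b ℕ.+ 0) (size-num {J} e) (size-factors {⊤} add n (reg tt)))))
          (cong₂ (λ a b → a ℕ.+ b ℕ.+ 0) (size-num {J} e) (size-factors {⊤} sub n (reg tt)))))
        (size-factors {J} add n uni)) (lem X U e))
      where
      lem : ∀ X U e → X ℕ.+ (e ℕ.+ 1 ℕ.+ ((1 ℕ.+ e) ℕ.+ (1 ℕ.+ e)) ℕ.+ 0) ℕ.+ (1 ℕ.+ e)
        ℕ.+ (e ℕ.+ ((1 ℕ.+ e) ℕ.+ (1 ℕ.+ e)) ℕ.+ 0) ℕ.+ U ℕ.+ ((1 ℕ.+ e) ℕ.+ (1 ℕ.+ e)) ℕ.+ (1 ℕ.+ e)
        ≡ X ℕ.+ U ℕ.+ (9 ℕ.+ 10 ℕ.* e)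
      lem = ℕ-Solver.solve-∀
    slack : ∀ X U e → 1 ℕ.+ (X ℕ.+ U ℕ.+ (9 ℕ.+ 10 ℕ.* e)) ≡ X ℕ.+ U ℕ.+ 10 ℕ.* (1 ℕ.+ e)
    slack = ℕ-Solver.solve-∀

  size-shift : ∀ {J} (A : Circ J ⊤) (x : Circ J (Fin n)) →
    size (shift A x) ≡ size A ℕ.+ size x ℕ.+ size (convolve n s) ℕ.+ 6 ℕ.* n
  size-shift {J} A x = trans
    (cong (λ a → a ℕ.+ (size x ℕ.+ 0) ℕ.+ size (convolve n s) ℕ.+ 0)
      (trans (size-⊙ (A ⟫ gate sub zer (reg tt) ⟫ factors add n (reg tt)) falling-facts)
        (cong₂ (λ a b → size A ℕ.+ 1 ℕ.+ a ℕ.+ b ℕ.+ n) (size-factors {⊤} add n (reg tt))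
          (cong₂ (λ a b → a ℕ.+ b ℕ.+ 0) (size-num {J} e) (size-factors {⊤} sub n (reg tt))))))
    (lem (size A) (size x) (size (convolve n s)) e)
    where
    lem : ∀ A X U e → A ℕ.+ 1 ℕ.+ ((1 ℕ.+ e) ℕ.+ (1 ℕ.+ e)) ℕ.+ (e ℕ.+ ((1 ℕ.+ e) ℕ.+ (1 ℕ.+ e)) ℕ.+ 0)
      ℕ.+ (1 ℕ.+ e) ℕ.+ (X ℕ.+ 0) ℕ.+ U ℕ.+ 0 ≡ A ℕ.+ X ℕ.+ U ℕ.+ 6 ℕ.* (1 ℕ.+ e)
    lem = ℕ-Solver.solve-∀

  size-translate : ∀ {J} (A : Circ J ⊤) (x : Circ J (Fin n)) →
    size (translate A x) ℕ.≤ size A ℕ.+ size x ℕ.+ 3 ℕ.* size (convolve n s) ℕ.+ 26 ℕ.* n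
  size-translate A x = begin
    size (translate A x)
      ≤⟨ size-differences (shift A (differences x)) ⟩
    size (shift A (differences x)) ℕ.+ U ℕ.+ 10 ℕ.* n
      ≡⟨ cong (λ a → a ℕ.+ U ℕ.+ 10 ℕ.* n) (size-shift A (differences x)) ⟩
    size A ℕ.+ size (differences x) ℕ.+ U ℕ.+ 6 ℕ.* n ℕ.+ U ℕ.+ 10 ℕ.* n
      ≡⟨ lem₁ (size A) (size (differences x)) U n ⟩
    size (differences x) ℕ.+ (size A ℕ.+ 2 ℕ.* U ℕ.+ 16 ℕ.* n)
      ≤⟨ ℕₚ.+-monoˡ-≤ _ (size-differences x) ⟩
    size x ℕ.+ U ℕ.+ 10 ℕ.* n ℕ.+ (size A ℕ.+ 2 ℕ.* U ℕ.+ 16 ℕ.* n)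
      ≡⟨ lem₂ (size A) (size x) U n ⟩
    size A ℕ.+ size x ℕ.+ 3 ℕ.* U ℕ.+ 26 ℕ.* n ∎
    where
    open ℕₚ.≤-Reasoning
    U = size (convolve n s)
    lem₁ : ∀ A X U n → A ℕ.+ X ℕ.+ U ℕ.+ 6 ℕ.* n ℕ.+ U ℕ.+ 10 ℕ.* n ≡ X ℕ.+ (A ℕ.+ 2 ℕ.* U ℕ.+ 16 ℕ.* n)
    lem₁ = ℕ-Solver.solve-∀
    lem₂ : ∀ A X U n → X ℕ.+ U ℕ.+ 10 ℕ.* n ℕ.+ (A ℕ.+ 2 ℕ.* U ℕ.+ 16 ℕ.* n)
      ≡ A ℕ.+ X ℕ.+ 3 ℕ.* U ℕ.+ 26 ℕ.* n
    lem₂ = ℕ-Solver.solve-∀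

  -- `c` stands in front of the product so that both factors read the same registers; building it
  -- into each would double the cost at every level.
  double : ℕ → Circ Input (Fin n) → Circ Input (Fin n)
  double h c = c ⟫ wire reg ⊙ translate (op₂ mul (num h) (num n)) (wire reg)

  terms : ℕ → Circ Input (Fin n)
  terms k = arithmetic n (op₂ add (var rᵢ) (op₂ mul (var mᵢ) (op₂ mul (num k) (num n)))) (var mᵢ)

  extend : (ℕ → Circ Input (Fin n)) → ∀ {k} → Half k → Circ Input (Fin n)
  extend P (even h) = double h (P h)
  extend P (odd h)  = double h (P h) ⊙ terms (h ℕ.+ h)

  -- t is fuel for the halvings of k. When it is used up the result is 1, which is right only for k
  -- = 0; hence k < 2^t in `sem-products`.
  products : ℕ → ℕ → Circ Input (Fin n)
  products zero    k = wire λ _ → uni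
  products (suc t) k = extend (products t) (halve k)

  extend-scale : (ℕ → ℤ) → ∀ {k} → Half k → ℤ
  extend-scale S (even h) = S h * (translate-scale * S h)
  extend-scale S (odd h)  = S h * (translate-scale * S h)

  products-scale : ℕ → ℕ → ℤ
  products-scale zero    k = + 1
  products-scale (suc t) k = extend-scale (products-scale t) (halve k)

  module _ (ρ : Input → ℤ) where

    open Blocks n (ρ mᵢ) (ρ rᵢ)

    sem-double : ∀ h c S → h ℕ.≤ e → (∀ k → sem c ρ k ≡ S * block h (toℕ k)) →
      ∀ k → sem (double h c) ρ k ≡ S * (translate-scale * S) * block (h ℕ.+ h) (toℕ k)
    sem-double h c S h≤e c≡ k = begin
      sem (double h c) ρ k
        ≡⟨ sem-⊙ (wire reg) (translate (op₂ mul (num h) (num n)) (wire reg)) (sem c ρ) k ⟩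
      sem c ρ k * sem (translate (op₂ mul (num h) (num n)) (wire reg)) (sem c ρ) k
        ≡⟨ cong₂ _*_ (c≡ k) (sem-translate (op₂ mul (num h) (num n)) (wire reg) (sem c ρ) (h ℕ.* n)
             (λ x → S * block h x)
             (trans (cong₂ _*_ (sem-num h (sem c ρ)) (sem-num n (sem c ρ))) (sym (ℤₚ.pos-* h n)))
             c≡ degree k) ⟩
      S * block h (toℕ k) * (translate-scale * (S * block h (toℕ k ℕ.+ h ℕ.* n)))
        ≡⟨ lem S translate-scale (block h (toℕ k)) (block h (toℕ k ℕ.+ h ℕ.* n)) ⟩
      S * (translate-scale * S) * (block h (toℕ k) * block h (toℕ k ℕ.+ h ℕ.* n))
        ≡⟨ cong (S * (translate-scale * S) *_) (block-double h (toℕ k)) ⟨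
      S * (translate-scale * S) * block (h ℕ.+ h) (toℕ k) ∎
      where
      open ≡-Reasoning
      lem : ∀ S T a b → S * a * (T * (S * b)) ≡ S * (T * S) * (a * b)
      lem = solve-∀
      degree : ∀ m → e ℕ.< m → ∇^ m (λ x → S * block h x) 0 ≡ + 0
      degree m e<m = trans (∇^-scale m S (block h) 0) (trans (cong (S *_) vanish) (ℤₚ.*-zeroʳ S))
        where
        vanish : ∇^ m (block h) 0 ≡ + 0
        vanish = subst (λ m → ∇^ m (block h) 0 ≡ + 0)
          (ℕₚ.m∸n+n≡m (ℕₚ.≤-trans (ℕ.s≤s h≤e) e<m))
          (Degree<-mono (suc h) (m ℕ.∸ suc h) (block h) (block-degree h) 0)

    sem-terms : ∀ k x → sem (terms k) ρ x ≡ term (toℕ x) k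
    sem-terms k x = trans (sem-arithmetic n
        (op₂ add (var rᵢ) (op₂ mul (var mᵢ) (op₂ mul (num k) (num n)))) (var mᵢ) ρ x) (trans
      (cong (λ z → ρ rᵢ + ρ mᵢ * z + + toℕ x * ρ mᵢ) (cong₂ _*_ (sem-num k ρ) (sem-num n ρ)))
      (trans (cong (λ z → ρ rᵢ + ρ mᵢ * (+ k * + n) + z) (ℤₚ.*-comm (+ toℕ x) (ρ mᵢ)))
             (sym (term-affine (toℕ x) k))))

    sem-products : ∀ t k → k ℕ.< 2 ℕ.^ t → k ℕ.≤ n →
      ∀ x → sem (products t k) ρ x ≡ products-scale t k * block k (toℕ x)
    sem-products zero    zero    _   _   x = refl
    sem-products zero    (suc k) (ℕ.s≤s ()) _ x
    sem-products (suc t) k k<2^t k≤n x = by-half (halve k) k<2^t k≤n x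
      where
      smaller : ∀ {h k} → h ℕ.+ h ℕ.≤ k → k ℕ.< 2 ℕ.^ suc t → h ℕ.< 2 ℕ.^ t
      smaller {h} {k} 2h≤k k<2^t with h ℕ.<? 2 ℕ.^ t
      ... | yes p = p
      ... | no  p = contradiction k<2^t (ℕₚ.≤⇒≯ (ℕₚ.≤-trans (ℕₚ.+-mono-≤ (ℕₚ.≮⇒≥ p)
        (ℕₚ.≤-trans (ℕₚ.≤-reflexive (ℕₚ.+-identityʳ (2 ℕ.^ t))) (ℕₚ.≮⇒≥ p))) 2h≤k))
      -- The degree h of `block h` must be below the number n of sample points for the translation
      -- to be exact.
      half≤e : ∀ {h} → h ℕ.+ h ℕ.≤ n → h ℕ.≤ e
      half≤e {zero}  _         = ℕ.z≤n
      half≤e {suc h} (ℕ.s≤s p) = ℕₚ.≤-trans (ℕₚ.m≤n+m (suc h) h) p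
      by-half : ∀ {k} (H : Half k) → k ℕ.< 2 ℕ.^ suc t → k ℕ.≤ n →
        ∀ x → sem (extend (products t) H) ρ x ≡ extend-scale (products-scale t) H * block k (toℕ x)
      by-half (even h) k<2^t k≤n x = sem-double h (products t h) (products-scale t h) (half≤e k≤n)
        (sem-products t h (smaller ℕₚ.≤-refl k<2^t) (ℕₚ.≤-trans (ℕₚ.m≤m+n h h) k≤n)) x
      by-half (odd h) k<2^t k<n x = begin
        sem (double h (products t h) ⊙ terms (h ℕ.+ h)) ρ x
          ≡⟨ sem-⊙ (double h (products t h)) (terms (h ℕ.+ h)) ρ x ⟩
        sem (double h (products t h)) ρ x * sem (terms (h ℕ.+ h)) ρ x
          ≡⟨ cong₂ _*_ (by-half (even h) (ℕₚ.<-trans (ℕₚ.n<1+n _) k<2^t) (ℕₚ.<⇒≤ k<n) x) (sem-terms (h ℕ.+ h) x) ⟩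
        S * block (h ℕ.+ h) (toℕ x) * term (toℕ x) (h ℕ.+ h)
          ≡⟨ ℤₚ.*-assoc S _ _ ⟩
        S * (block (h ℕ.+ h) (toℕ x) * term (toℕ x) (h ℕ.+ h))
          ≡⟨ cong (S *_) (Π-snoc (h ℕ.+ h) (term (toℕ x))) ⟨
        S * block (suc (h ℕ.+ h)) (toℕ x) ∎
        where
        open ≡-Reasoning
        S = extend-scale (products-scale t) (even h)

  -- Three convolutions per translation; 37 = 30 + 6 + 1 for the rest of the doubling, for `terms`,
  -- and for one more pointwise product.
  step-size : ℕ
  step-size = 3 ℕ.* size (convolve n s) ℕ.+ 37 ℕ.* n

  size-double : ∀ h c → h ℕ.≤ n → size (double h c) ℕ.≤ size c ℕ.+ (3 ℕ.* size (convolve n s) ℕ.+ 30 ℕ.* n)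
  size-double h c h≤n = ℕₚ.+-monoʳ-≤ (size c) (begin
    size (wire reg ⊙ translate A (wire reg))
      ≡⟨ size-⊙ {n = n} (wire reg) (translate A (wire reg)) ⟩
    size (translate A (wire reg)) ℕ.+ n
      ≤⟨ ℕₚ.+-monoˡ-≤ n (size-translate A (wire reg)) ⟩
    size A ℕ.+ 0 ℕ.+ 3 ℕ.* U ℕ.+ 26 ℕ.* n ℕ.+ n
      ≡⟨ cong (λ a → a ℕ.+ 0 ℕ.+ 3 ℕ.* U ℕ.+ 26 ℕ.* n ℕ.+ n)
           (cong₂ (λ a b → a ℕ.+ b ℕ.+ 1) (size-num {Fin n} h) (size-num {Fin n} n)) ⟩
    h ℕ.+ n ℕ.+ 1 ℕ.+ 0 ℕ.+ 3 ℕ.* U ℕ.+ 26 ℕ.* n ℕ.+ n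
      ≤⟨ ℕₚ.+-monoˡ-≤ n (ℕₚ.+-monoˡ-≤ (26 ℕ.* n) (ℕₚ.+-monoˡ-≤ (3 ℕ.* U) (ℕₚ.+-monoˡ-≤ 0
           (ℕₚ.+-mono-≤ (ℕₚ.+-monoˡ-≤ n h≤n) (ℕ.s≤s (ℕ.z≤n {e})))))) ⟩
    n ℕ.+ n ℕ.+ n ℕ.+ 0 ℕ.+ 3 ℕ.* U ℕ.+ 26 ℕ.* n ℕ.+ n
      ≡⟨ lem n U ⟩
    3 ℕ.* U ℕ.+ 30 ℕ.* n ∎)
    where
    open ℕₚ.≤-Reasoning
    U = size (convolve n s)
    A : Circ (Fin n) ⊤
    A = op₂ mul (num h) (num n)
    lem : ∀ n U → n ℕ.+ n ℕ.+ n ℕ.+ 0 ℕ.+ 3 ℕ.* U ℕ.+ 26 ℕ.* n ℕ.+ n ≡ 3 ℕ.* U ℕ.+ 30 ℕ.* n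
    lem = ℕ-Solver.solve-∀

  size-terms : ∀ k → k ℕ.≤ n → size (terms k) ℕ.≤ 6 ℕ.* n
  size-terms k k≤n = begin
    size (terms k)
      ≡⟨ size-arithmetic n (op₂ add (var rᵢ) (op₂ mul (var mᵢ) (op₂ mul (num k) (num n)))) (var mᵢ) ⟩
    size {Input} (num k) ℕ.+ size {Input} (num n) ℕ.+ 1 ℕ.+ 1 ℕ.+ 1 ℕ.+ 0 ℕ.+ n
      ≡⟨ cong₂ (λ a b → a ℕ.+ b ℕ.+ 1 ℕ.+ 1 ℕ.+ 1 ℕ.+ 0 ℕ.+ n) (size-num {Input} k) (size-num {Input} n) ⟩
    k ℕ.+ n ℕ.+ 1 ℕ.+ 1 ℕ.+ 1 ℕ.+ 0 ℕ.+ n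
      ≤⟨ ℕₚ.+-monoˡ-≤ n (ℕₚ.+-monoˡ-≤ 0 (ℕₚ.+-mono-≤ (ℕₚ.+-mono-≤ (ℕₚ.+-mono-≤ (ℕₚ.+-monoˡ-≤ n k≤n) 1≤n) 1≤n) 1≤n)) ⟩
    n ℕ.+ n ℕ.+ n ℕ.+ n ℕ.+ n ℕ.+ 0 ℕ.+ n
      ≡⟨ lem n ⟩
    6 ℕ.* n ∎
    where
    open ℕₚ.≤-Reasoning
    1≤n : 1 ℕ.≤ n
    1≤n = ℕ.s≤s ℕ.z≤n
    lem : ∀ n → n ℕ.+ n ℕ.+ n ℕ.+ n ℕ.+ n ℕ.+ 0 ℕ.+ n ≡ 6 ℕ.* n
    lem = ℕ-Solver.solve-∀

  size-products : ∀ t k → k ℕ.≤ n → size (products t k) ℕ.≤ t ℕ.* step-size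
  size-products zero    k _   = ℕ.z≤n
  size-products (suc t) k k≤n = by-half (halve k) k≤n
    where
    open ℕₚ.≤-Reasoning
    U = size (convolve n s)
    by-half : ∀ {k} (H : Half k) → k ℕ.≤ n → size (extend (products t) H) ℕ.≤ suc t ℕ.* step-size
    by-half (even h) k≤n = begin
      size (double h (products t h))
        ≤⟨ size-double h (products t h) h≤n ⟩
      size (products t h) ℕ.+ (3 ℕ.* U ℕ.+ 30 ℕ.* n)
        ≤⟨ ℕₚ.+-mono-≤ (size-products t h h≤n) (ℕₚ.+-monoʳ-≤ (3 ℕ.* U) (ℕₚ.*-monoˡ-≤ n (ℕₚ.m≤m+n 30 7))) ⟩
      t ℕ.* step-size ℕ.+ step-size
        ≡⟨ ℕₚ.+-comm (t ℕ.* step-size) step-size ⟩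
      suc t ℕ.* step-size ∎
      where
      h≤n = ℕₚ.≤-trans (ℕₚ.m≤m+n h h) k≤n
    by-half (odd h) k≤n = begin
      size (double h (products t h) ⊙ terms (h ℕ.+ h))
        ≡⟨ size-⊙ (double h (products t h)) (terms (h ℕ.+ h)) ⟩
      size (double h (products t h)) ℕ.+ size (terms (h ℕ.+ h)) ℕ.+ n
        ≤⟨ ℕₚ.+-monoˡ-≤ n (ℕₚ.+-mono-≤ (size-double h (products t h) h≤n) (size-terms (h ℕ.+ h) 2h≤n)) ⟩
      size (products t h) ℕ.+ (3 ℕ.* U ℕ.+ 30 ℕ.* n) ℕ.+ 6 ℕ.* n ℕ.+ n
        ≤⟨ ℕₚ.+-monoˡ-≤ n (ℕₚ.+-monoˡ-≤ (6 ℕ.* n) (ℕₚ.+-monoˡ-≤ (3 ℕ.* U ℕ.+ 30 ℕ.* n) (size-products t h h≤n))) ⟩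
      t ℕ.* step-size ℕ.+ (3 ℕ.* U ℕ.+ 30 ℕ.* n) ℕ.+ 6 ℕ.* n ℕ.+ n
        ≡⟨ lem t U n ⟩
      suc t ℕ.* step-size ∎
      where
      2h≤n = ℕₚ.<⇒≤ k≤n
      h≤n = ℕₚ.≤-trans (ℕₚ.m≤m+n h h) 2h≤n
      lem : ∀ t U n → t ℕ.* (3 ℕ.* U ℕ.+ 37 ℕ.* n) ℕ.+ (3 ℕ.* U ℕ.+ 30 ℕ.* n) ℕ.+ 6 ℕ.* n ℕ.+ n
        ≡ (1 ℕ.+ t) ℕ.* (3 ℕ.* U ℕ.+ 37 ℕ.* n)
      lem = ℕ-Solver.solve-∀

-- Probing for a factor

outcome-cases : ∀ N .{{_ : NonZero N}} g (P : Outcome → Set) →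
  (g ≡ 1 → P one) → (g ≡ N → P full) → (g ≢ 1 → g ≢ N → P proper) → P (outcome N g)
outcome-cases N g P p₁ p₂ p₃ with g ℕ.≡ᵇ 1 in e₁
... | true  = p₁ (ℕₚ.≡ᵇ⇒≡ g 1 (subst T (sym e₁) tt))
... | false with g ℕ.≡ᵇ N in e₂
...   | true  = p₂ (ℕₚ.≡ᵇ⇒≡ g N (subst T (sym e₂) tt))
...   | false = p₃ (λ e → subst T e₁ (ℕₚ.≡⇒≡ᵇ g 1 e)) (λ e → subst T e₂ (ℕₚ.≡⇒≡ᵇ g N e))

proper-factor : ∀ x N .{{_ : NonZero N}} → gcd x N ≢ 1 → gcd x N ≢ N → NontrivialFactor (gcd x N) N
proper-factor x N g≢1 g≢N = g∣N , ℕₚ.≤∧≢⇒< (ℕₚ.n≢0⇒n>0 g≢0) (g≢1 ∘ sym) , ℕₚ.≤∧≢⇒< (∣⇒≤ g∣N) g≢N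
  where
  g∣N = gcd[m,n]∣n x N
  g≢0 : gcd x N ≢ 0
  g≢0 e = ℕ.≢-nonZero⁻¹ N (0∣⇒≡0 (subst (_∣ N) e g∣N))

mutual
  probe : ∀ {k} n → (Fin n → Fin k) → (Fin n → ∀ {k′} → (Fin k → Fin k′) → Tree k′) →
          (∀ {k′} → (Fin k → Fin k′) → Tree k′) → Tree k
  probe zero    regs onFull rest = rest id
  probe (suc n) regs onFull rest = gcdN (regs zero) (probe-branch n regs onFull rest)

  -- A named function of the outcome, so that the proofs can abstract over the outcome with
  -- `outcome-cases`.
  probe-branch : ∀ {k} n → (Fin (suc n) → Fin k) →
    (Fin (suc n) → ∀ {k′} → (Fin k → Fin k′) → Tree k′) →
    (∀ {k′} → (Fin k → Fin k′) → Tree k′) → Outcome → Tree (suc k)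
  probe-branch n regs onFull rest one    =
    probe n (suc ∘ regs ∘ suc) (λ i w → onFull (suc i) (w ∘ suc)) (λ w → rest (w ∘ suc))
  probe-branch n regs onFull rest full   = onFull zero suc
  probe-branch n regs onFull rest proper = return zero

module _ (N : ℕ) .{{_ : NonZero N}} where

  Good : ∀ {k} → Tree k → Vec ℕ k → Set
  Good t ρ = NontrivialFactor (output N t ρ) N

  probe-correct : ∀ {k} n (regs : Fin n → Fin k)
    {onFull : Fin n → ∀ {k′} → (Fin k → Fin k′) → Tree k′} {rest : ∀ {k′} → (Fin k → Fin k′) → Tree k′}
    (ρ : Vec ℕ k) →
    (∀ i {k′} (ρ′ : Vec ℕ k′) w → Extends N ρ ρ′ w → gcd (lookup ρ (regs i)) N ≡ N → Good (onFull i w) ρ′) →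
    (∀ {k′} (ρ′ : Vec ℕ k′) w → Extends N ρ ρ′ w → (∀ i → gcd (lookup ρ (regs i)) N ≡ 1) → Good (rest w) ρ′) →
    Good (probe n regs onFull rest) ρ
  probe-correct zero    regs ρ hf hr = hr ρ id (extends λ _ → refl) λ ()
  probe-correct (suc n) regs {onFull} {rest} ρ hf hr =
    outcome-cases N g (λ o → Good (probe-branch n regs onFull rest o) (g ∷ ρ))
      (λ g≡1 → probe-correct n _ (g ∷ ρ)
        (λ i ρ′ w E → hf (suc i) ρ′ (w ∘ suc) (Extends-trans N E₁ E))
        (λ ρ′ w E h → hr ρ′ (w ∘ suc) (Extends-trans N E₁ E) λ { zero → g≡1 ; (suc i) → h i }))
      (λ g≡N → hf zero (g ∷ ρ) suc E₁ g≡N)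
      (proper-factor (lookup ρ (regs zero)) N)
    where
    g = gcd (lookup ρ (regs zero)) N
    E₁ : Extends N ρ (g ∷ ρ) suc
    E₁ = extends λ _ → refl

  probe-cost : ∀ {k} n (regs : Fin n → Fin k)
    {onFull : Fin n → ∀ {k′} → (Fin k → Fin k′) → Tree k′} {rest : ∀ {k′} → (Fin k → Fin k′) → Tree k′}
    (ρ : Vec ℕ k) b →
    (∀ i {k′} (ρ′ : Vec ℕ k′) w → cost N (onFull i w) ρ′ ℕ.≤ b) →
    (∀ {k′} (ρ′ : Vec ℕ k′) w → cost N (rest w) ρ′ ℕ.≤ b) →
    cost N (probe n regs onFull rest) ρ ℕ.≤ n ℕ.+ b
  probe-cost zero    regs ρ b hf hr = hr ρ id
  probe-cost (suc n) regs {onFull} {rest} ρ b hf hr = ℕ.s≤s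
    (outcome-cases N g (λ o → cost N (probe-branch n regs onFull rest o) (g ∷ ρ) ℕ.≤ n ℕ.+ b)
      (λ _ → probe-cost n _ (g ∷ ρ) b (λ i ρ′ w → hf (suc i) ρ′ (w ∘ suc)) (λ ρ′ w → hr ρ′ (w ∘ suc)))
      (λ _ → ℕₚ.≤-trans (hf zero (g ∷ ρ) suc) (ℕₚ.m≤n+m b n))
      (λ _ _ → ℕ.z≤n))
    where
    g = gcd (lookup ρ (regs zero)) N

  -- Registers are known only up to congruence modulo N, and a multiple of N does not change the
  -- common divisors with N.
  gcd-≈ : ∀ x z → _≈_ N x z → gcd x N ≡ gcd ∣ z ∣ N
  gcd-≈ x z (t , eq) = ∣-antisym
    (gcd-greatest (∣z (gcd[m,n]∣m x N) (gcd[m,n]∣n x N)) (gcd[m,n]∣n x N))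
    (gcd-greatest (∣x (gcd[m,n]∣m ∣ z ∣ N) (gcd[m,n]∣n ∣ z ∣ N)) (gcd[m,n]∣n ∣ z ∣ N))
    where
    ∣tN : ∀ {d} → d ∣ N → + d ℤ∣.∣ t * + N
    ∣tN d∣N = ℤ∣.∣n⇒∣m*n t (ℤ∣.∣ᵤ⇒∣ {+ _} {+ N} d∣N)
    ∣z : ∀ {d} → d ∣ x → d ∣ N → d ∣ ∣ z ∣
    ∣z {d} d∣x d∣N = ℤ∣.∣⇒∣ᵤ (subst (+ d ℤ∣.∣_) (trans (cong (_- t * + N) eq) (lem z (t * + N)))
      (ℤ∣.∣m∣n⇒∣m-n (ℤ∣.∣ᵤ⇒∣ {+ d} {+ x} d∣x) (∣tN d∣N)))
      where
      lem : ∀ z y → z + y - y ≡ z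
      lem = solve-∀
    ∣x : ∀ {d} → d ∣ ∣ z ∣ → d ∣ N → d ∣ x
    ∣x {d} d∣z d∣N = ℤ∣.∣⇒∣ᵤ (subst (+ d ℤ∣.∣_) (sym eq)
      (ℤ∣.∣m∣n⇒∣m+n (ℤ∣.∣ᵤ⇒∣ {+ d} {z} d∣z) (∣tN d∣N)))

-- Scales coprime to N

Unit : ℕ → ℤ → Set
Unit N z = gcd ∣ z ∣ N ≡ 1

unit-* : ∀ {N} a b → Unit N a → Unit N b → Unit N (a * b)
unit-* {N} a b ua ub = ∣1⇒≡1 (subst (g ∣_) ub (gcd-greatest g∣b (gcd[m,n]∣n ∣ a * b ∣ N)))
  where
  g = gcd ∣ a * b ∣ N
  g∣b : g ∣ ∣ b ∣
  g∣b = coprime-divisor {g} {∣ a ∣} (λ { {d} (d∣g , d∣a) → ∣1⇒≡1 (subst (d ∣_) ua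
      (gcd-greatest d∣a (∣-trans d∣g (gcd[m,n]∣n ∣ a * b ∣ N)))) })
    (subst (g ∣_) (ℤₚ.abs-* a b) (gcd[m,n]∣m ∣ a * b ∣ N))

unit-1 : ∀ N → Unit N (+ 1)
unit-1 = gcd-zeroˡ

unit-^ : ∀ {N} a n → Unit N a → Unit N (a ^ n)
unit-^ {N} a zero    u = unit-1 N
unit-^ {N} a (suc n) u = unit-* a (a ^ n) u (unit-^ a n u)

unit-Π : ∀ {N} n f → (∀ i → i ℕ.< n → Unit N (f i)) → Unit N (Π n f)
unit-Π {N} zero    f u = unit-1 N
unit-Π {N} (suc n) f u = unit-* (f 0) (Π n (f ∘ suc)) (u 0 (ℕ.s≤s ℕ.z≤n))
  (unit-Π n (f ∘ suc) λ i i<n → u (suc i) (ℕ.s≤s i<n))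

∣Π : ∀ n f i → i ℕ.< n → ∣ f i ∣ ∣ ∣ Π n f ∣
∣Π (suc n) f zero    _          = subst (∣ f 0 ∣ ∣_) (sym (ℤₚ.abs-* (f 0) _)) (m∣m*n _)
∣Π (suc n) f (suc i) (ℕ.s≤s i<n) = ∣-trans (∣Π n (f ∘ suc) i i<n)
  (subst (∣ Π n (f ∘ suc) ∣ ∣_) (sym (ℤₚ.abs-* (f 0) _)) (n∣m*n ∣ f 0 ∣))

module Units (N P : ℕ) (small : ∀ i → i ℕ.< P → Unit N (+ suc i)) where

  unit-fact : ∀ k → k ℕ.≤ P → Unit N (fact k)
  unit-fact k k≤P = unit-Π k (λ l → + 1 + + l) λ i i<k → small i (ℕₚ.<-≤-trans i<k k≤P)

  unit-leading : ∀ k → k ℕ.≤ P → Unit N (leading k)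
  unit-leading zero    _   = unit-1 N
  unit-leading (suc k) k<P = unit-* (- + suc k) (leading k) (small k k<P) (unit-leading k (ℕₚ.<⇒≤ k<P))

  unit-D : ∀ C → C ℕ.≤ P → Unit N (Interpolation.D (interpolation C))
  unit-D zero    _   = unit-1 N
  unit-D (suc C) C<P = unit-* (leading C) (Interpolation.D (interpolation C))
    (unit-leading C (ℕₚ.<⇒≤ C<P)) (unit-D C (ℕₚ.<⇒≤ C<P))

  module _ (B C : ℕ) (B+B≤C : B ℕ.+ B ℕ.≤ C) .{{_ : NonZero C}}
           (e s : ℕ) (n≤B^s : suc e ℕ.≤ B ℕ.^ s) (C≤P : C ℕ.≤ P) (e≤P : e ℕ.≤ P) where

    open Transform B C B+B≤C (interpolation C) e s n≤B^s
    open Products B C B+B≤C (interpolation C) e s n≤B^s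

    private D = Interpolation.D (interpolation C)

    unit-translate : Unit N translate-scale
    unit-translate = unit-* differences-scale (shift-scale * differences-scale) u
      (unit-* shift-scale differences-scale (unit-* (D ^ s) (fact e) uD uf) u)
      where
      uf = unit-fact e e≤P
      uD = unit-^ D s (unit-D C C≤P)
      u : Unit N differences-scale
      u = unit-* (D ^ s) ((- + 1) ^ e * (fact e * fact e)) uD
        (unit-* ((- + 1) ^ e) (fact e * fact e) (unit-^ (- + 1) e (unit-1 N)) (unit-* (fact e) (fact e) uf uf))

    unit-products : ∀ t k → Unit N (products-scale t k)
    unit-products zero    k = unit-1 N
    unit-products (suc t) k = by-half (halve k)
      where
      by-half : ∀ {k} (H : Half k) → Unit N (extend-scale (products-scale t) H)
      by-half (even h) = unit-* (products-scale t h) _ (unit-products t h)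
        (unit-* translate-scale (products-scale t h) unit-translate (unit-products t h))
      -- The extra factor `terms` is exact, so an odd step has the scale of the even one.
      by-half (odd h)  = by-half (even h)

-- Numerical consequences of the setting

module Facts {N b m r p d : ℕ} .{{_ : NonZero N}} .{{_ : NonZero m}}
             (S : Setting N b m r p) (c : d IsCeilSqrtOf b / m) where

  open Setting S

  -- For d ≤ 1 the defining inequality gives b ≤ m, against m < p < b.
  d≥2 : 2 ℕ.≤ d
  d≥2 = by-cases d (proj₁ c)
    where
    by-cases : ∀ d → b ℕ.≤ m ℕ.* (d ℕ.* d) → 2 ℕ.≤ d
    by-cases 0 b≤0 = contradiction (ℕₚ.<-≤-trans p<b (ℕₚ.≤-trans b≤0 (ℕₚ.≤-reflexive (ℕₚ.*-zeroʳ m)))) λ ()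
    by-cases 1 b≤m = contradiction (ℕₚ.≤-trans b≤m (ℕₚ.≤-reflexive (ℕₚ.*-identityʳ m)))
      (ℕₚ.<⇒≱ (ℕₚ.<-trans m<p p<b))
    by-cases (suc (suc d)) _ = ℕ.s≤s (ℕ.s≤s ℕ.z≤n)

  -- Minimality of d gives m (d - 1)² < b, and d² ≤ 5 (d - 1)² for d ≥ 2. With d = 2 + g the
  -- difference of these is 1 + 6 g + 4 g².
  md²<N : m ℕ.* (d ℕ.* d) ℕ.< N
  md²<N = by-cases d d≥2 (proj₂ c)
    where
    open ℕₚ.≤-Reasoning
    by-cases : ∀ d → 2 ℕ.≤ d → (∀ e → b ℕ.≤ m ℕ.* (e ℕ.* e) → d ℕ.≤ e) → m ℕ.* (d ℕ.* d) ℕ.< N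
    by-cases 1 (ℕ.s≤s ()) _
    by-cases (suc (suc g)) _ least = begin-strict
      m ℕ.* ((2 ℕ.+ g) ℕ.* (2 ℕ.+ g))
        ≤⟨ ℕₚ.m≤m+n _ (m ℕ.* (1 ℕ.+ 6 ℕ.* g ℕ.+ 4 ℕ.* (g ℕ.* g))) ⟩
      m ℕ.* ((2 ℕ.+ g) ℕ.* (2 ℕ.+ g)) ℕ.+ m ℕ.* (1 ℕ.+ 6 ℕ.* g ℕ.+ 4 ℕ.* (g ℕ.* g))
        ≡⟨ lem m g ⟩
      5 ℕ.* (m ℕ.* ((1 ℕ.+ g) ℕ.* (1 ℕ.+ g)))
        <⟨ ℕₚ.*-monoʳ-< 5 (ℕₚ.≰⇒> λ b≤ → ℕₚ.1+n≰n (least (suc g) b≤)) ⟩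
      5 ℕ.* b
        ≤⟨ b≤N/5 ⟩
      N ∎
      where
      lem : ∀ m g → m ℕ.* ((2 ℕ.+ g) ℕ.* (2 ℕ.+ g)) ℕ.+ m ℕ.* (1 ℕ.+ 6 ℕ.* g ℕ.+ 4 ℕ.* (g ℕ.* g))
        ≡ 5 ℕ.* (m ℕ.* ((1 ℕ.+ g) ℕ.* (1 ℕ.+ g)))
      lem = ℕ-Solver.solve-∀

  -- Guarantees that none of the small numbers tested at the start has gcd N with N.
  4d<N : 4 ℕ.* d ℕ.< N
  4d<N = begin-strict
    4 ℕ.* d             ≡⟨ ℕₚ.*-assoc 2 2 d ⟩
    2 ℕ.* (2 ℕ.* d)     ≤⟨ ℕₚ.*-mono-≤ 2≤m (ℕₚ.*-monoˡ-≤ d d≥2) ⟩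
    m ℕ.* (d ℕ.* d)     <⟨ md²<N ⟩
    N                   ∎
    where open ℕₚ.≤-Reasoning

  1<N : 1 ℕ.< N
  1<N = ℕₚ.≤-<-trans (ℕₚ.≤-trans (ℕₚ.≤-trans (ℕₚ.n≤1+n 1) d≥2) (ℕₚ.m≤m+n d _)) 4d<N

  p≢1 : p ≢ 1
  p≢1 p≡1 = ℕₚ.<⇒≱ m<p (subst (ℕ._≤ m) (sym p≡1) (ℕₚ.≤-trans (ℕₚ.n≤1+n 1) 2≤m))

  -- Otherwise m would divide the prime p although 1 < m < p. Positivity keeps N from dividing a
  -- term for the trivial reason that the term is zero.
  r>0 : 0 ℕ.< r
  r>0 = ℕₚ.n≢0⇒n>0 λ r≡0 → [ (λ m≡1 → contradiction (subst (2 ℕ.≤_) m≡1 2≤m) λ { (ℕ.s≤s ()) }) , ℕₚ.<⇒≢ m<p ]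
    (prime⇒irreducible p-prime (m%n≡0⇒n∣m p m (trans (sym r≡p%m) r≡0)))

  r<m : r ℕ.< m
  r<m = subst (ℕ._< m) (sym r≡p%m) (DM.m%n<n p m)

  p≡ : p ≡ r ℕ.+ m ℕ.* (p ℕ./ m)
  p≡ = trans (DM.m≡m%n+[m/n]*n p m) (cong₂ ℕ._+_ (sym r≡p%m) (ℕₚ.*-comm (p ℕ./ m) m))

  p/m<d² : p ℕ./ m ℕ.< d ℕ.* d
  p/m<d² = ℕₚ.*-cancelˡ-< m _ _ (begin-strict
    m ℕ.* (p ℕ./ m)       ≤⟨ ℕₚ.m≤n+m _ r ⟩
    r ℕ.+ m ℕ.* (p ℕ./ m) ≡⟨ p≡ ⟨
    p                     <⟨ p<b ⟩
    b                     ≤⟨ proj₁ c ⟩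
    m ℕ.* (d ℕ.* d)       ∎)
    where open ℕₚ.≤-Reasoning

  open Blocks d (+ m) (+ r)

  term-ℕ : ∀ x j → term x j ≡ + (r ℕ.+ m ℕ.* (x ℕ.+ j ℕ.* d))
  term-ℕ x j = cong (λ z → + r + z) (sym (ℤₚ.pos-* m (x ℕ.+ j ℕ.* d)))

  term-proper : ∀ x j → x ℕ.< d → j ℕ.< d → gcd ∣ term x j ∣ N ≢ N
  term-proper x j x<d j<d g≡N = ℕₚ.<⇒≱ term<N (∣⇒≤ N∣term)
    where
    open ℕₚ.≤-Reasoning
    y = x ℕ.+ j ℕ.* d
    instance
      term≢0 : NonZero (r ℕ.+ m ℕ.* y)
      term≢0 = ℕ.>-nonZero (ℕₚ.<-≤-trans r>0 (ℕₚ.m≤m+n r _))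
    N∣term : N ∣ r ℕ.+ m ℕ.* y
    N∣term = subst₂ _∣_ g≡N (cong ∣_∣ (term-ℕ x j)) (gcd[m,n]∣m ∣ term x j ∣ N)
    term<N : r ℕ.+ m ℕ.* y ℕ.< N
    term<N = begin-strict
      r ℕ.+ m ℕ.* y         <⟨ ℕₚ.+-monoˡ-< (m ℕ.* y) r<m ⟩
      m ℕ.+ m ℕ.* y         ≡⟨ ℕₚ.*-suc m y ⟨
      m ℕ.* (suc x ℕ.+ j ℕ.* d) ≤⟨ ℕₚ.*-monoʳ-≤ m (ℕₚ.+-mono-≤ x<d ℕₚ.≤-refl) ⟩
      m ℕ.* (suc j ℕ.* d)   ≤⟨ ℕₚ.*-monoʳ-≤ m (ℕₚ.*-monoˡ-≤ d j<d) ⟩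
      m ℕ.* (d ℕ.* d)       <⟨ md²<N ⟩
      N                     ∎

  p∣block : Σ[ x ∈ ℕ ] (x ℕ.< d × p ∣ ∣ block d x ∣)
  p∣block = x , DM.m%n<n K d , subst (_∣ ∣ block d x ∣) term≡p (∣Π d (term x) j (DM.m<n*o⇒m/o<n p/m<d²))
    where
    instance
      d≢0 : NonZero d
      d≢0 = ℕ.>-nonZero (ℕₚ.≤-trans (ℕₚ.n≤1+n 1) d≥2)
    -- Division of K by d yields the block x and the position j in it.
    K = p ℕ./ m
    x = K ℕ.% d
    j = K ℕ./ d
    term≡p : ∣ term x j ∣ ≡ p
    term≡p = trans (cong ∣_∣ (term-ℕ x j))
      (trans (cong (λ k → r ℕ.+ m ℕ.* k) (sym (DM.m≡m%n+[m/n]*n K d))) (sym p≡))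

-- The algorithm

n<2^n : ∀ n → n ℕ.< 2 ℕ.^ n
n<2^n zero    = ℕ.s≤s ℕ.z≤n
n<2^n (suc n) = ℕₚ.≤-trans (ℕₚ.+-mono-≤ (ℕₚ.≤-trans (ℕ.s≤s ℕ.z≤n) (n<2^n n)) (n<2^n n))
  (ℕₚ.≤-reflexive (cong (2 ℕ.^ n ℕ.+_) (sym (ℕₚ.+-identityʳ (2 ℕ.^ n)))))

abstract
  -- The exponent is raised only when B^s falls short of n + 2; then n + 2 ≤ 2 (n + 1) ≤ B · B^s,
  -- and the power overshoots by at most a factor B.
  power-cover : ∀ B → 2 ℕ.≤ B → ∀ n → Σ[ s ∈ ℕ ] (suc n ℕ.≤ B ℕ.^ s × B ℕ.^ s ℕ.≤ B ℕ.* suc n)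
  power-cover B 2≤B zero = 0 , ℕₚ.≤-refl ,
    ℕₚ.≤-trans (ℕₚ.≤-trans (ℕₚ.n≤1+n 1) 2≤B) (ℕₚ.≤-reflexive (sym (ℕₚ.*-identityʳ B)))
  power-cover B 2≤B (suc n) with power-cover B 2≤B n
  ... | s , lower , upper with suc (suc n) ℕ.≤? B ℕ.^ s
  ...   | yes p = s , p , ℕₚ.≤-trans upper (ℕₚ.*-monoʳ-≤ B (ℕₚ.n≤1+n (suc n)))
  ...   | no ¬p = suc s ,
    ℕₚ.≤-trans (ℕₚ.≤-trans (ℕₚ.m≤n+m (2 ℕ.+ n) n) (ℕₚ.≤-reflexive (lem n))) (ℕₚ.*-mono-≤ 2≤B lower) ,
    ℕₚ.*-monoʳ-≤ B (ℕₚ.<⇒≤ (ℕₚ.≰⇒> ¬p))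
    where
    lem : ∀ n → n ℕ.+ (2 ℕ.+ n) ≡ 2 ℕ.* (1 ℕ.+ n)
    lem = ℕ-Solver.solve-∀

-- Choice of the base

module Candidate (q e : ℕ) where

  -- Here n = e + 1 is the size parameter d. The base is a power of two so that 2^t = 2 B^s > n: the
  -- t halvings suffice, and t is linear in s.
  B C n s t : ℕ
  B = 2 ℕ.^ suc q
  C = 2 ℕ.^ suc (suc q)
  n = suc e

  2≤B : 2 ℕ.≤ B
  2≤B = ℕₚ.≤-trans (ℕ.s≤s (ℕ.s≤s ℕ.z≤n)) (ℕₚ.*-monoʳ-≤ 2 (ℕₚ.m^n>0 2 q))

  B+B≤C : B ℕ.+ B ℕ.≤ C
  B+B≤C = ℕₚ.≤-reflexive (cong (B ℕ.+_) (sym (ℕₚ.+-identityʳ B)))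

  instance
    C≢0 : NonZero C
    C≢0 = ℕₚ.m^n≢0 2 (2 ℕ.+ q)

  s = proj₁ (power-cover B 2≤B e)
  t = suc (suc q ℕ.* s)

  n≤B^s : n ℕ.≤ B ℕ.^ s
  n≤B^s = proj₁ (proj₂ (power-cover B 2≤B e))

  B^s≤Bn : B ℕ.^ s ℕ.≤ B ℕ.* n
  B^s≤Bn = proj₂ (proj₂ (power-cover B 2≤B e))

  n<2^t : n ℕ.< 2 ℕ.^ t
  n<2^t = ℕₚ.≤-<-trans n≤B^s (ℕₚ.≤-<-trans (ℕₚ.≤-reflexive (ℕₚ.^-*-assoc 2 (suc q) s))
    (ℕₚ.^-monoʳ-< 2 (ℕ.s≤s (ℕ.s≤s ℕ.z≤n)) (ℕₚ.n<1+n (suc q ℕ.* s))))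

  open Products B C B+B≤C (interpolation C) e s n≤B^s public
    using (products; products-scale; sem-products; size-products; step-size)
  open Convolution B C B+B≤C (interpolation C) public using (overhead; size-convolve)

  circuit : Circ Input (Fin n)
  circuit = products t n

candidateSize : ℕ → ℕ → ℕ
candidateSize e q = size (Candidate.circuit q e)

-- 2^q ≤ n says C ≤ 4 n, the range of the numbers tested in advance. The list is complete because q
-- < 2^q ≤ n.
admissible : ℕ → List ℕ
admissible e = filter (λ q → 2 ℕ.^ q ℕ.≤? suc e) (upTo (suc e))

abstract
  -- The default q = 0, that is B = 2, is admissible for every size.
  best : ℕ → ℕ
  best e = argmin (candidateSize e) 0 (admissible e)

  best-admissible : ∀ e → 2 ℕ.^ best e ℕ.≤ suc e
  best-admissible e = argmin-all (candidateSize e) {0} {admissible e} {P = λ q → 2 ℕ.^ q ℕ.≤ suc e}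
    (ℕ.s≤s ℕ.z≤n) (Allₚ.all-filter (λ q → 2 ℕ.^ q ℕ.≤? suc e) (upTo (suc e)))

  best-optimal : ∀ e q → 2 ℕ.^ q ℕ.≤ suc e → candidateSize e (best e) ℕ.≤ candidateSize e q
  best-optimal e q 2^q≤n = All.lookup
    (f[argmin]≤f[xs] {f = candidateSize e} 0 (admissible e))
    (∈-filter⁺ (λ q → 2 ℕ.^ q ℕ.≤? suc e) (∈-upTo⁺ (ℕₚ.<-≤-trans (n<2^n q) 2^q≤n)) 2^q≤n)

circuit : ∀ e → Circ Input (Fin (suc e))
circuit e = Candidate.circuit (best e) e

naturals : ∀ n → Circ Input (Fin n)
naturals n = arithmetic n (wire λ _ → uni) (wire λ _ → uni)

row : ∀ n → ℕ → Circ Input (Fin n)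
row n x = arithmetic n (op₂ add (var rᵢ) (op₂ mul (var mᵢ) (num x))) (op₂ mul (var mᵢ) (num n))

-- The arguments are the registers that hold 0, 1 and the inputs.
Search : Set
Search = ∀ k → (z u : Fin k) → (Input → Fin k) → Tree k

-- Fills the branches that the hypotheses exclude; its output is arbitrary.
abandon : Search
abandon k z u env = return u

test : ∀ {n} → Circ Input (Fin n) → (Fin n → Search) → Search → Search
test {n} c onFull rest k z u env = compile c z u env λ w rs → probe n rs
  (λ x {k′} w′ → onFull x k′ (w′ (w z)) (w′ (w u)) (w′ ∘ w ∘ env))
  (λ {k′} w′ → rest k′ (w′ (w z)) (w′ (w u)) (w′ ∘ w ∘ env))

searchRow : ℕ → ℕ → Search
searchRow n x = test (row n x) (λ _ → abandon) abandon

searchBlocks : ∀ {n} → Circ Input (Fin n) → Search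
searchBlocks {n} c = test c (λ x → searchRow n (toℕ x)) abandon

searchSmall : ∀ {n} → Circ Input (Fin n) → Search
searchSmall {n} c = test (naturals (4 ℕ.* n)) (λ _ → abandon) (searchBlocks c)

-- After zero has been pushed the registers are 0, N, b, m, r, 1.
position : Input → Fin 6
position mᵢ = suc (suc (suc zero))
position rᵢ = suc (suc (suc (suc zero)))

-- The constant 0 is obtained as 1 - 1. The value at d = 0 is a dummy, as d ≥ 2 in every setting.
algorithm : Algorithm
algorithm zero    = return zero
algorithm (suc e) = arith sub last last (searchSmall (circuit e) 6 zero (suc last) position)
  where
  last : Fin 5
  last = suc (suc (suc (suc zero)))

-- Correctness of the search

module _ (N : ℕ) .{{_ : NonZero N}} (σ : Input → ℤ) where

  record Located {k} (ρ : Vec ℕ k) (z u : Fin k) (env : Input → Fin k) : Set where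
    constructor located
    field
      at-z   : _≈_ N (lookup ρ z) (+ 0)
      at-u   : _≈_ N (lookup ρ u) (+ 1)
      at-env : ∀ i → _≈_ N (lookup ρ (env i)) (σ i)
  open Located

  preserve-located : ∀ {k k′} {ρ : Vec ℕ k} {ρ′ : Vec ℕ k′} {w z u env} → Extends N ρ ρ′ w →
                     Located ρ z u env → Located ρ′ (w z) (w u) (w ∘ env)
  preserve-located E (located a b c) =
    located (preserve-≈ N E _ a) (preserve-≈ N E _ b) (λ i → preserve-≈ N E _ (c i))

  record Succeeds (s : Search) : Set where
    constructor succeeds
    field succeed : ∀ {k} (ρ : Vec ℕ k) z u env → Located ρ z u env → Good N (s k z u env) ρ
  open Succeeds public

  test-succeeds : ∀ {n} (c : Circ Input (Fin n)) (v : Fin n → ℤ) onFull rest → (∀ x → sem c σ x ≡ v x) →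
    (∀ x → gcd ∣ v x ∣ N ≡ N → Succeeds (onFull x)) → ((∀ x → Unit N (v x)) → Succeeds rest) →
    Succeeds (test c onFull rest)
  test-succeeds {n} c v onFull rest c≡v hf hr = succeeds λ ρ z u env L →
    compile-correct N c (λ g → NontrivialFactor g N) (at-z L) (at-u L) (at-env L) λ ρ₁ w rs E₁ hrs →
      let gcd-reg : ∀ x → gcd (lookup ρ₁ (rs x)) N ≡ gcd ∣ v x ∣ N
          gcd-reg x = trans (gcd-≈ N _ _ (hrs x)) (cong (λ y → gcd ∣ y ∣ N) (c≡v x))
      in probe-correct N n rs ρ₁
        (λ x ρ₂ w′ E₂ g≡N → succeed (hf x (trans (sym (gcd-reg x)) g≡N)) ρ₂ _ _ _
          (preserve-located (Extends-trans N E₁ E₂) L))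
        (λ ρ₂ w′ E₂ h → succeed (hr λ x → trans (sym (gcd-reg x)) (h x)) ρ₂ _ _ _
          (preserve-located (Extends-trans N E₁ E₂) L))

record Bounded (N : ℕ) .{{_ : NonZero N}} (b : ℕ) (s : Search) : Set where
  constructor bounded
  field bound : ∀ {k} (ρ : Vec ℕ k) z u env → cost N (s k z u env) ρ ℕ.≤ b
open Bounded

test-bounded : ∀ N .{{_ : NonZero N}} {n} (c : Circ Input (Fin n)) onFull rest b →
  (∀ x → Bounded N b (onFull x)) → Bounded N b rest → Bounded N (size c ℕ.+ (n ℕ.+ b)) (test c onFull rest)
test-bounded N {n} c onFull rest b hf hr = bounded λ ρ z u env →
  compile-cost N c (n ℕ.+ b) λ ρ₁ w rs → probe-cost N n rs ρ₁ b
    (λ x ρ₂ w′ → bound (hf x) ρ₂ _ _ _) (λ ρ₂ w′ → bound hr ρ₂ _ _ _)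

module Correct {N b m r p e : ℕ} .{{_ : NonZero N}} .{{_ : NonZero m}}
               (S : Setting N b m r p) (c : suc e IsCeilSqrtOf b / m) where

  open Setting S
  open Facts S c
  open Blocks (suc e) (+ m) (+ r)

  private n = suc e

  σ : Input → ℤ
  σ mᵢ = + m
  σ rᵢ = + r

  -- If a whole row were coprime to N, then so would be its product.
  searchRow-succeeds : ∀ x → x ℕ.< n → ¬ Unit N (block n x) → Succeeds N σ (searchRow n x)
  searchRow-succeeds x x<n not-unit = test-succeeds N σ (row n x) (λ j → term x (toℕ j)) (λ _ → abandon) abandon sem-row
    (λ j g≡N → contradiction g≡N (term-proper x (toℕ j) x<n (Finₚ.toℕ<n j)))
    (λ h → contradiction (unit-Π n (term x) λ j j<n →
      subst (λ j → Unit N (term x j)) (Finₚ.toℕ-fromℕ< j<n) (h (fromℕ< j<n))) not-unit)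
    where
    sem-row : ∀ j → sem (row n x) σ j ≡ term x (toℕ j)
    sem-row j = trans (sem-arithmetic n (op₂ add (var rᵢ) (op₂ mul (var mᵢ) (num x))) (op₂ mul (var mᵢ) (num n)) σ j)
      (trans (cong₂ (λ a b → + r + + m * a + + toℕ j * (+ m * b)) (sem-num x σ) (sem-num n σ))
      (trans (lem (+ r) (+ m) (+ x) (+ toℕ j) (+ n))
             (cong (λ y → + r + + m * (+ x + y)) (sym (ℤₚ.pos-* (toℕ j) n)))))
      where
      lem : ∀ r m x j n → r + m * x + j * (m * n) ≡ r + m * (x + j * n)
      lem = solve-∀

  module _ (small : ∀ i → i ℕ.< 4 ℕ.* n → Unit N (+ suc i)) where

    open Candidate (best e) e using (B; C; s; t; B+B≤C; n≤B^s; n<2^t; products-scale; sem-products)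

    scale : ℤ
    scale = products-scale t n

    scale-unit : Unit N scale
    scale-unit = Units.unit-products N (4 ℕ.* n) small B C B+B≤C {{Candidate.C≢0 (best e) e}} e s n≤B^s
      -- C = 4 · 2^q ≤ 4 n for the chosen q.
      (ℕₚ.≤-trans (ℕₚ.≤-reflexive (sym (ℕₚ.*-assoc 2 2 (2 ℕ.^ best e)))) (ℕₚ.*-monoʳ-≤ 4 (best-admissible e)))
      (ℕₚ.≤-trans (ℕₚ.n≤1+n e) (ℕₚ.m≤m+n n _)) t n

    no-unit-block : ∀ {A : Set} → (∀ x → x ℕ.< n → Unit N (scale * block n x)) → A
    no-unit-block h with p∣block
    ... | x , x<n , p∣ = contradiction (∣1⇒≡1 (subst (p ∣_) (h x x<n) (gcd-greatest
      (subst (p ∣_) (sym (ℤₚ.abs-* scale (block n x))) (∣-trans p∣ (n∣m*n ∣ scale ∣))) p∣N))) p≢1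

    searchBlocks-succeeds : Succeeds N σ (searchBlocks (circuit e))
    searchBlocks-succeeds = test-succeeds N σ (circuit e) (λ x → scale * block n (toℕ x))
      (λ x → searchRow n (toℕ x)) abandon
      (sem-products σ t n n<2^t ℕₚ.≤-refl)
      -- Were the block coprime to N, its scaled value would be so too, and its gcd N would equal 1.
      (λ x g≡N → searchRow-succeeds (toℕ x) (Finₚ.toℕ<n x) λ unit → ℕₚ.<⇒≢ 1<N
        (trans (sym (unit-* scale (block n (toℕ x)) scale-unit unit)) g≡N))
      (λ h → no-unit-block λ x x<n →
        subst (λ x → Unit N (scale * block n x)) (Finₚ.toℕ-fromℕ< x<n) (h (fromℕ< x<n)))

  searchSmall-succeeds : Succeeds N σ (searchSmall (circuit e))
  searchSmall-succeeds = test-succeeds N σ (naturals (4 ℕ.* n)) (λ i → + suc (toℕ i))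
    (λ _ → abandon) (searchBlocks (circuit e))
    (λ i → trans (sem-arithmetic (4 ℕ.* n) (wire λ _ → uni) (wire λ _ → uni) σ i)
      (cong (λ z → + 1 + z) (ℤₚ.*-identityʳ (+ toℕ i))))
    (λ i g≡N → contradiction
      (∣⇒≤ (subst (_∣ suc (toℕ i)) g≡N (gcd[m,n]∣m (suc (toℕ i)) N)))
      (ℕₚ.<⇒≱ (ℕₚ.≤-<-trans (Finₚ.toℕ<n i) 4d<N)))
    (λ h → searchBlocks-succeeds λ i i<4n →
      subst (λ i → Unit N (+ suc i)) (Finₚ.toℕ-fromℕ< i<4n) (h (fromℕ< i<4n)))

  algorithm-correct : Good N (algorithm n) (inputs N b m r)
  algorithm-correct = succeed searchSmall-succeeds (⟦_⟧ N sub 1 1 ∷ inputs N b m r) _ _ _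
    (located (op-≈ N sub (≈-refl N 1) (≈-refl N 1)) (≈-refl N 1) λ { mᵢ → ≈-refl N m ; rᵢ → ≈-refl N r })

-- The cost

size-row : ∀ n x → x ℕ.≤ n → 1 ℕ.≤ n → size (row n x) ℕ.≤ 6 ℕ.* n
size-row n x x≤n 1≤n = begin
  size (row n x)
    ≡⟨ size-arithmetic n (op₂ add (var rᵢ) (op₂ mul (var mᵢ) (num x))) (op₂ mul (var mᵢ) (num n)) ⟩
  size {Input} (num x) ℕ.+ 1 ℕ.+ 1 ℕ.+ (size {Input} (num n) ℕ.+ 1) ℕ.+ n
    ≡⟨ cong₂ (λ a b → a ℕ.+ 1 ℕ.+ 1 ℕ.+ (b ℕ.+ 1) ℕ.+ n) (size-num {Input} x) (size-num {Input} n) ⟩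
  x ℕ.+ 1 ℕ.+ 1 ℕ.+ (n ℕ.+ 1) ℕ.+ n
    ≤⟨ ℕₚ.+-monoˡ-≤ n (ℕₚ.+-mono-≤ (ℕₚ.+-mono-≤ (ℕₚ.+-mono-≤ x≤n 1≤n) 1≤n) (ℕₚ.+-monoʳ-≤ n 1≤n)) ⟩
  n ℕ.+ n ℕ.+ n ℕ.+ (n ℕ.+ n) ℕ.+ n
    ≡⟨ lem n ⟩
  6 ℕ.* n ∎
  where
  open ℕₚ.≤-Reasoning
  lem : ∀ n → n ℕ.+ n ℕ.+ n ℕ.+ (n ℕ.+ n) ℕ.+ n ≡ 6 ℕ.* n
  lem = ℕ-Solver.solve-∀

-- 17 n covers the 4 n small numbers and their gcds, the n gcds of the blocks, 7 n for a row with
-- its gcds, and the initial subtraction.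
total : ℕ → ℕ
total e = candidateSize e (best e) ℕ.+ 17 ℕ.* suc e

abandon-bounded : ∀ N .{{_ : NonZero N}} → Bounded N 0 abandon
abandon-bounded N = bounded λ _ _ _ _ → ℕ.z≤n

Bounded-mono : ∀ {N} .{{_ : NonZero N}} {a b s} → a ℕ.≤ b → Bounded N a s → Bounded N b s
Bounded-mono a≤b (bounded h) = bounded λ ρ z u env → ℕₚ.≤-trans (h ρ z u env) a≤b

searchRow-bounded : ∀ N .{{_ : NonZero N}} n x → x ℕ.< n → Bounded N (7 ℕ.* n) (searchRow n x)
searchRow-bounded N n x x<n = Bounded-mono
  (ℕₚ.≤-trans (ℕₚ.+-monoˡ-≤ (n ℕ.+ 0) (size-row n x (ℕₚ.<⇒≤ x<n) (ℕₚ.≤-trans (ℕ.s≤s ℕ.z≤n) x<n)))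
    (ℕₚ.≤-reflexive (lem n)))
  (test-bounded N (row n x) (λ _ → abandon) abandon 0 (λ _ → abandon-bounded N) (abandon-bounded N))
  where
  lem : ∀ n → 6 ℕ.* n ℕ.+ (n ℕ.+ 0) ≡ 7 ℕ.* n
  lem = ℕ-Solver.solve-∀

algorithm-cost : ∀ N .{{_ : NonZero N}} e ρ → cost N (algorithm (suc e)) ρ ℕ.≤ total e
algorithm-cost N e ρ = ℕₚ.≤-trans (ℕ.s≤s (Bounded.bound search _ _ _ _)) (begin
  suc (size {Input} (naturals (4 ℕ.* n)) ℕ.+ (4 ℕ.* n ℕ.+ (Z ℕ.+ (n ℕ.+ 7 ℕ.* n))))
    ≡⟨ cong (λ a → suc (a ℕ.+ (4 ℕ.* n ℕ.+ (Z ℕ.+ (n ℕ.+ 7 ℕ.* n)))))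
         (size-arithmetic {Input} (4 ℕ.* n) (wire λ _ → uni) (wire λ _ → uni)) ⟩
  suc (4 ℕ.* n ℕ.+ (4 ℕ.* n ℕ.+ (Z ℕ.+ (n ℕ.+ 7 ℕ.* n))))
    ≤⟨ ℕₚ.m≤m+n _ e ⟩
  suc (4 ℕ.* n ℕ.+ (4 ℕ.* n ℕ.+ (Z ℕ.+ (n ℕ.+ 7 ℕ.* n)))) ℕ.+ e
    ≡⟨ lem Z e ⟩
  total e ∎)
  where
  open ℕₚ.≤-Reasoning
  n = suc e
  Z = candidateSize e (best e)
  search = test-bounded N (naturals (4 ℕ.* n)) (λ _ → abandon) (searchBlocks (circuit e)) (Z ℕ.+ (n ℕ.+ 7 ℕ.* n))
    (λ _ → Bounded-mono ℕ.z≤n (abandon-bounded N))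
    (test-bounded N (circuit e) (λ x → searchRow n (toℕ x)) abandon (7 ℕ.* n)
      (λ x → searchRow-bounded N n (toℕ x) (Finₚ.toℕ<n x)) (Bounded-mono ℕ.z≤n (abandon-bounded N)))
  lem : ∀ Z e → 1 ℕ.+ (4 ℕ.* (1 ℕ.+ e) ℕ.+ (4 ℕ.* (1 ℕ.+ e) ℕ.+ (Z ℕ.+ ((1 ℕ.+ e) ℕ.+ 7 ℕ.* (1 ℕ.+ e))))) ℕ.+ e ≡ Z ℕ.+ 17 ℕ.* (1 ℕ.+ e)
  lem = ℕ-Solver.solve-∀

^-distribʳ-* : ∀ m n k → (m ℕ.* n) ℕ.^ k ≡ m ℕ.^ k ℕ.* n ℕ.^ k
^-distribʳ-* m n zero    = refl
^-distribʳ-* m n (suc k) = trans (cong (m ℕ.* n ℕ.*_) (^-distribʳ-* m n k)) (ℕₚ.[m*n]*[o*p]≡[m*o]*[n*p] m n _ _)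

-- Obtained from t ≤ (2 + q)(1 + s) and 3 (2 + s κ) + 37 ≤ (43 + 3 κ)(1 + s), with κ the overhead.
-- As κ depends on q alone, it can be taken at e = 0.
rate : ℕ → ℕ
rate q = (2 ℕ.+ q) ℕ.* (43 ℕ.+ 3 ℕ.* Candidate.overhead q 0)

module _ (q e : ℕ) where

  open Candidate q e using (B; C; n; s; t; B+B≤C; n≤B^s; step-size; size-products; size-convolve; overhead)

  candidate-bound : candidateSize e q ℕ.+ 17 ℕ.* n ℕ.≤ rate q ℕ.* (2 ℕ.^ s ℕ.* 2 ℕ.^ s ℕ.* 2 ℕ.^ s ℕ.* B ℕ.^ s)
  candidate-bound = begin
    candidateSize e q ℕ.+ 17 ℕ.* n
      ≤⟨ ℕₚ.+-mono-≤ (size-products t n ℕₚ.≤-refl) (ℕₚ.*-monoʳ-≤ 17 n≤P) ⟩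
    t ℕ.* step-size ℕ.+ 17 ℕ.* P
      ≤⟨ ℕₚ.+-monoˡ-≤ (17 ℕ.* P) (ℕₚ.*-monoʳ-≤ t
           (ℕₚ.+-mono-≤ (ℕₚ.*-monoʳ-≤ 3 (size-convolve n s)) (ℕₚ.*-monoʳ-≤ 37 n≤P))) ⟩
    t ℕ.* (3 ℕ.* (P ℕ.* (2 ℕ.+ s ℕ.* overhead)) ℕ.+ 37 ℕ.* P) ℕ.+ 17 ℕ.* P
      -- The slack is the difference to the next bound, with nonnegative coefficients; adding it
      -- turns the inequality into a ring identity.
      ≤⟨ ℕₚ.m≤m+n _ (slack q s overhead ℕ.* P) ⟩
    t ℕ.* (3 ℕ.* (P ℕ.* (2 ℕ.+ s ℕ.* overhead)) ℕ.+ 37 ℕ.* P) ℕ.+ 17 ℕ.* P ℕ.+ slack q s overhead ℕ.* P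
      ≡⟨ lem q s overhead P ⟩
    rate q ℕ.* (suc s ℕ.* suc s ℕ.* P)
      ≤⟨ ℕₚ.*-monoʳ-≤ (rate q) (ℕₚ.*-monoˡ-≤ P (ℕₚ.*-mono-≤ (n<2^n s) (n<2^n s))) ⟩
    rate q ℕ.* (2 ℕ.^ s ℕ.* 2 ℕ.^ s ℕ.* P)
      -- The third factor 2^s comes from C = 2 B; the other two have just replaced (1 + s)².
      ≡⟨ cong (λ z → rate q ℕ.* (2 ℕ.^ s ℕ.* 2 ℕ.^ s ℕ.* z)) (^-distribʳ-* 2 B s) ⟩
    rate q ℕ.* (2 ℕ.^ s ℕ.* 2 ℕ.^ s ℕ.* (2 ℕ.^ s ℕ.* B ℕ.^ s))
      ≡⟨ cong (rate q ℕ.*_) (ℕₚ.*-assoc (2 ℕ.^ s ℕ.* 2 ℕ.^ s) (2 ℕ.^ s) (B ℕ.^ s)) ⟨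
    rate q ℕ.* (2 ℕ.^ s ℕ.* 2 ℕ.^ s ℕ.* 2 ℕ.^ s ℕ.* B ℕ.^ s) ∎
    where
    open ℕₚ.≤-Reasoning
    P = C ℕ.^ s
    n≤P : n ℕ.≤ P
    n≤P = ℕₚ.≤-trans n≤B^s (ℕₚ.^-monoˡ-≤ s (ℕₚ.≤-trans (ℕₚ.m≤m+n B B) B+B≤C))
    slack : ℕ → ℕ → ℕ → ℕ
    slack q s κ = (1 ℕ.+ (1 ℕ.+ q) ℕ.* s) ℕ.* (43 ℕ.* s ℕ.+ 3 ℕ.* κ) ℕ.+ (1 ℕ.+ s ℕ.+ q) ℕ.* (43 ℕ.* s ℕ.+ 3 ℕ.* κ)
      ℕ.+ 26 ℕ.+ 3 ℕ.* s ℕ.* κ ℕ.+ (s ℕ.+ q) ℕ.* (43 ℕ.+ 3 ℕ.* s ℕ.* κ)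
    lem : ∀ q s κ P → (1 ℕ.+ (1 ℕ.+ q) ℕ.* s) ℕ.* (3 ℕ.* (P ℕ.* (2 ℕ.+ s ℕ.* κ)) ℕ.+ 37 ℕ.* P) ℕ.+ 17 ℕ.* P
      ℕ.+ ((1 ℕ.+ (1 ℕ.+ q) ℕ.* s) ℕ.* (43 ℕ.* s ℕ.+ 3 ℕ.* κ) ℕ.+ (1 ℕ.+ s ℕ.+ q) ℕ.* (43 ℕ.* s ℕ.+ 3 ℕ.* κ)
        ℕ.+ 26 ℕ.+ 3 ℕ.* s ℕ.* κ ℕ.+ (s ℕ.+ q) ℕ.* (43 ℕ.+ 3 ℕ.* s ℕ.* κ)) ℕ.* P
      ≡ (2 ℕ.+ q) ℕ.* (43 ℕ.+ 3 ℕ.* κ) ℕ.* ((1 ℕ.+ s) ℕ.* (1 ℕ.+ s) ℕ.* P)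
    lem = ℕ-Solver.solve-∀

-- With B = 2^(1+q) and B^s ≤ B n, the v-th power of 8^s is at most B^s.
candidate-power : ∀ v e → 1 ℕ.≤ v → let q = 3 ℕ.* v; B = 2 ℕ.^ suc q in
  (candidateSize e q ℕ.+ 17 ℕ.* suc e) ℕ.^ v ℕ.≤ (rate q ℕ.* (B ℕ.* B)) ℕ.^ v ℕ.* suc e ℕ.^ suc v
candidate-power v e 1≤v = begin
  (candidateSize e q ℕ.+ 17 ℕ.* n) ℕ.^ v
    ≤⟨ ℕₚ.^-monoˡ-≤ v (candidate-bound q e) ⟩
  (M ℕ.* (E ℕ.* B ℕ.^ s)) ℕ.^ v
    ≡⟨ trans (^-distribʳ-* M (E ℕ.* B ℕ.^ s) v) (cong (M ℕ.^ v ℕ.*_) (^-distribʳ-* E (B ℕ.^ s) v)) ⟩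
  M ℕ.^ v ℕ.* (E ℕ.^ v ℕ.* (B ℕ.^ s) ℕ.^ v)
    ≤⟨ ℕₚ.*-monoʳ-≤ (M ℕ.^ v) (ℕₚ.*-mono-≤ E^v≤ (ℕₚ.^-monoˡ-≤ v B^s≤Bn)) ⟩
  M ℕ.^ v ℕ.* (B ℕ.* n ℕ.* (B ℕ.* n) ℕ.^ v)
    ≡⟨ cong (λ z → M ℕ.^ v ℕ.* (B ℕ.* n ℕ.* z)) (^-distribʳ-* B n v) ⟩
  M ℕ.^ v ℕ.* (B ℕ.* n ℕ.* (B ℕ.^ v ℕ.* n ℕ.^ v))
    ≡⟨ lem (M ℕ.^ v) B n (B ℕ.^ v) (n ℕ.^ v) ⟩
  M ℕ.^ v ℕ.* (B ℕ.* B ℕ.^ v) ℕ.* n ℕ.^ suc v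
    -- The stray B is enlarged to B^v so that the constant becomes a v-th power.
    ≤⟨ ℕₚ.*-monoˡ-≤ (n ℕ.^ suc v) (ℕₚ.*-monoʳ-≤ (M ℕ.^ v) (ℕₚ.*-monoˡ-≤ (B ℕ.^ v) B≤B^v)) ⟩
  M ℕ.^ v ℕ.* (B ℕ.^ v ℕ.* B ℕ.^ v) ℕ.* n ℕ.^ suc v
    ≡⟨ cong (ℕ._* n ℕ.^ suc v) (trans (^-distribʳ-* M (B ℕ.* B) v) (cong (M ℕ.^ v ℕ.*_) (^-distribʳ-* B B v))) ⟨
  (M ℕ.* (B ℕ.* B)) ℕ.^ v ℕ.* n ℕ.^ suc v ∎
  where
  open ℕₚ.≤-Reasoning
  q = 3 ℕ.* v
  open Candidate q e using (B; n; s; B^s≤Bn)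
  M = rate q
  E = 2 ℕ.^ s ℕ.* 2 ℕ.^ s ℕ.* 2 ℕ.^ s
  instance
    B≢0 : NonZero B
    B≢0 = ℕₚ.m^n≢0 2 (suc q)
  lem : ∀ M B n x y → M ℕ.* (B ℕ.* n ℕ.* (x ℕ.* y)) ≡ M ℕ.* (B ℕ.* x) ℕ.* (n ℕ.* y)
  lem = ℕ-Solver.solve-∀
  B≤B^v : B ℕ.≤ B ℕ.^ v
  B≤B^v = ℕₚ.≤-trans (ℕₚ.≤-reflexive (sym (ℕₚ.^-identityʳ B))) (ℕₚ.^-monoʳ-≤ B 1≤v)
  E≡ : E ≡ 2 ℕ.^ (s ℕ.+ s ℕ.+ s)
  E≡ = sym (trans (ℕₚ.^-distribˡ-+-* 2 (s ℕ.+ s) s) (cong (ℕ._* 2 ℕ.^ s) (ℕₚ.^-distribˡ-+-* 2 s s)))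
  E^v≤ : E ℕ.^ v ℕ.≤ B ℕ.* n
  E^v≤ = begin
    E ℕ.^ v                 ≡⟨ cong (ℕ._^ v) E≡ ⟩
    (2 ℕ.^ (s ℕ.+ s ℕ.+ s)) ℕ.^ v ≡⟨ ℕₚ.^-*-assoc 2 (s ℕ.+ s ℕ.+ s) v ⟩
    2 ℕ.^ ((s ℕ.+ s ℕ.+ s) ℕ.* v) ≡⟨ cong (2 ℕ.^_) (lem₃ s v) ⟩
    2 ℕ.^ (q ℕ.* s)           ≤⟨ ℕₚ.^-monoʳ-≤ 2 (ℕₚ.m≤n+m (q ℕ.* s) s) ⟩
    2 ℕ.^ (suc q ℕ.* s)       ≡⟨ ℕₚ.^-*-assoc 2 (suc q) s ⟨
    B ℕ.^ s                 ≤⟨ B^s≤Bn ⟩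
    B ℕ.* n                 ∎
    where
    lem₃ : ∀ s v → (s ℕ.+ s ℕ.+ s) ℕ.* v ≡ 3 ℕ.* v ℕ.* s
    lem₃ = ℕ-Solver.solve-∀

member≤sum : ∀ n (f : ℕ → ℕ) i → i ℕ.< n → f i ℕ.≤ Sℕ.Σ< n f
member≤sum (suc n) f zero    _           = ℕₚ.m≤m+n (f 0) _
member≤sum (suc n) f (suc i) (ℕ.s≤s i<n) = ℕₚ.≤-trans (member≤sum n (f ∘ suc) i i<n) (ℕₚ.m≤n+m _ (f 0))

-- The second summand is for the finitely many d < 2^q, where the base 2^(1+q) is
-- not admissible.
constant : ℕ → ℕ
constant v = rate q ℕ.* (B ℕ.* B) ℕ.+ Sℕ.Σ< (2 ℕ.^ q) total
  where
  q = 3 ℕ.* v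
  B = 2 ℕ.^ suc q

-- Since u / v ≥ 1 / v, the exponent 1 + 1 / v suffices, and the constant depends on the denominator
-- alone.
total-power : ∀ v u e → 1 ℕ.≤ v → 1 ℕ.≤ u → total e ℕ.^ v ℕ.≤ constant v ℕ.^ v ℕ.* suc e ℕ.^ (v ℕ.+ u)
total-power v u e 1≤v 1≤u with 2 ℕ.^ (3 ℕ.* v) ℕ.≤? suc e
... | yes 2^q≤n = begin
  total e ℕ.^ v
    ≤⟨ ℕₚ.^-monoˡ-≤ v (ℕₚ.+-monoˡ-≤ (17 ℕ.* suc e) (best-optimal e (3 ℕ.* v) 2^q≤n)) ⟩
  (candidateSize e (3 ℕ.* v) ℕ.+ 17 ℕ.* suc e) ℕ.^ v
    ≤⟨ candidate-power v e 1≤v ⟩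
  (rate (3 ℕ.* v) ℕ.* (2 ℕ.^ suc (3 ℕ.* v) ℕ.* 2 ℕ.^ suc (3 ℕ.* v))) ℕ.^ v ℕ.* suc e ℕ.^ suc v
    ≤⟨ ℕₚ.*-mono-≤ (ℕₚ.^-monoˡ-≤ v (ℕₚ.m≤m+n _ (Sℕ.Σ< (2 ℕ.^ (3 ℕ.* v)) total)))
         (ℕₚ.^-monoʳ-≤ (suc e) (ℕₚ.≤-trans (ℕₚ.+-monoˡ-≤ v 1≤u) (ℕₚ.≤-reflexive (ℕₚ.+-comm u v)))) ⟩
  constant v ℕ.^ v ℕ.* suc e ℕ.^ (v ℕ.+ u) ∎
  where open ℕₚ.≤-Reasoning
... | no 2^q≰n = ℕₚ.≤-trans
  (ℕₚ.^-monoˡ-≤ v (ℕₚ.≤-trans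
    (member≤sum (2 ℕ.^ (3 ℕ.* v)) total e (ℕₚ.<-trans (ℕₚ.n<1+n e) (ℕₚ.≰⇒> 2^q≰n)))
    (ℕₚ.m≤n+m _ (rate (3 ℕ.* v) ℕ.* (2 ℕ.^ suc (3 ℕ.* v) ℕ.* 2 ℕ.^ suc (3 ℕ.* v))))))
  (ℕₚ.m≤m*n (constant v ℕ.^ v) (suc e ℕ.^ (v ℕ.+ u)) {{ℕₚ.m^n≢0 (suc e) (v ℕ.+ u)}})

factor-found : ∀ N b m r p d .{{_ : NonZero N}} .{{_ : NonZero m}} →
  Setting N b m r p → d IsCeilSqrtOf b / m →
  NontrivialFactor (output N (algorithm d) (inputs N b m r)) N
factor-found N b m r p zero    S c = contradiction (Facts.d≥2 S c) λ ()
factor-found N b m r p (suc e) S c = Correct.algorithm-correct S c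

cost-bound : ∀ ε → Positive ε → Σ[ C ∈ ℕ ] (∀ N b m r p d .{{_ : NonZero N}} .{{_ : NonZero m}} →
  Setting N b m r p → d IsCeilSqrtOf b / m →
  cost N (algorithm d) (inputs N b m r) ≤ C · d ^[1+ ε ])
cost-bound (mkℚ (+ suc u) v _) _ = constant (suc v) , bounds
  where
  bounds : ∀ N b m r p d .{{_ : NonZero N}} .{{_ : NonZero m}} →
    Setting N b m r p → d IsCeilSqrtOf b / m →
    cost N (algorithm d) (inputs N b m r) ℕ.^ suc v ℕ.≤ constant (suc v) ℕ.^ suc v ℕ.* d ℕ.^ (suc v ℕ.+ suc u)
  bounds N b m r p zero    S c = contradiction (Facts.d≥2 S c) λ ()
  bounds N b m r p (suc e) S c = ℕₚ.≤-trans
    (ℕₚ.^-monoˡ-≤ (suc v) (algorithm-cost N e (inputs N b m r)))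
    (total-power (suc v) (suc u) e (ℕ.s≤s ℕ.z≤n) (ℕ.s≤s ℕ.z≤n))

theorem4p1 : Σ[ A ∈ Algorithm ] ((∀ N b m r p d → .{{_ : NonZero N}} → .{{_ : NonZero m}} →
    Setting N b m r p → d IsCeilSqrtOf b / m →
    NontrivialFactor (output N (A d) (inputs N b m r)) N)
    × (∀ (ε : ℚ) → Positive ε →
    Σ[ C ∈ ℕ ] (∀ N b m r p d → .{{_ : NonZero N}} → .{{_ : NonZero m}} →
    Setting N b m r p → d IsCeilSqrtOf b / m →
    cost N (A d) (inputs N b m r) ≤ C · d ^[1+ ε ])))
theorem4p1 = algorithm , factor-found , cost-bound
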